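{- (a) Let $f(x)\in R$ be monic and irreducible with nonzero constant coefficient $f_0$, and let $f^*(x)=F(x^n)$ be its bound, where $F\in\mathbb{K}[y]$ has degree $s$. If $\deg f=s\ell$ with $\ell=\ell_F$, then $$\mathrm{N}_{\mathbb{L}/\mathbb{K}}(f_0)=(-1)^{s\ell(n-1)}F_0^{\ell},$$ where $F_0$ is the constant coefficient of $F(x^n)$. (b) Let $F(y)\in\mathbb{K}[y]$ be monic irreducible of degree $s$, $F(y)\neq y$, and let $g(x)$ be a monic divisor of $F(x^n)$ in $R$ of degree $sh\ell$ for some $h\in\{1,\dots,m\}$, where $\ell=\ell_F$ and $m=m_F$. Then $$\mathrm{N}_{\mathbb{L}/\mathbb{K}}(g_0)=(-1)^{sh\ell(n-1)}F_0^{h\ell},$$ where $g_0$ and $F_0$ are the constant coefficients of $g(x)$ and $F(x^n)$.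
   Context: Let $\mathbb{K}$ be a field, $\mathbb{L}/\mathbb{K}$ a cyclic Galois extension of degree $n\ge2$, $\sigma$ a generator of $\mathrm{Gal}(\mathbb{L}/\mathbb{K})$, and $R=\mathbb{L}[x;\sigma]$ the skew polynomial ring with $xa=\sigma(a)x$ for $a\in\mathbb{L}$; its centre is $\mathbb{K}[x^n]$. The bound of a nonconstant $f\in R$ with nonzero constant coefficient is the unique $F(x^n)$, $F\in\mathbb{K}[y]$ monic, generating the largest two-sided ideal contained in $Rf$. For $F(y)\in\mathbb{K}[y]$ monic irreducible with $F(y)\ne y$, $m_F$ denotes the number of irreducible factors in a factorisation of $F(x^n)$ in $R$ (this number divides $n$), and $\ell_F=n/m_F$. $\mathrm{N}_{\mathbb{L}/\mathbb{K}}$ is the field norm. -}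

module Defs where

open import Level using (Level; _⊔_) renaming (suc to lsuc)
open import Algebra.Bundles using (CommutativeRing)
open import Data.Nat as ℕ using (ℕ; zero; suc; _∸_)
open import Data.List using (List; []; _∷_; _++_; replicate; map; foldr)
open import Data.Product using (Σ; ∃; _×_; _,_)
open import Data.Sum using (_⊎_)
open import Relation.Nullary using (¬_)

iter : ∀ {a} {A : Set a} → ℕ → (A → A) → A → A
iter zero    f x = x
iter (suc k) f x = f (iter k f x)

-- A field L with an automorphism σ of order exactly n ≥ 2.
-- K is the fixed field of σ; by Artin's theorem L/K is cyclic Galois of
-- degree n with Gal(L/K) = ⟨σ⟩, and every such data (L/K, σ) arises this way.
record CyclicSetup (c ℓ : Level) : Set (lsuc (c ⊔ ℓ)) where
  field
    L : CommutativeRing c ℓ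
  open CommutativeRing L public
  field
    1≉0     : ¬ (1# ≈ 0#)
    inverse : ∀ x → ¬ (x ≈ 0#) → ∃ λ y → x * y ≈ 1#
    σ       : Carrier → Carrier
    σ-cong  : ∀ {a b} → a ≈ b → σ a ≈ σ b
    σ-+     : ∀ a b → σ (a + b) ≈ σ a + σ b
    σ-*     : ∀ a b → σ (a * b) ≈ σ a * σ b
    σ-1     : σ 1# ≈ 1#
    σ-surj  : ∀ b → ∃ λ a → σ a ≈ b
    n       : ℕ
    2≤n     : 2 ℕ.≤ n
    σ^n≈id  : ∀ a → iter n σ a ≈ a
    σ-order : ∀ k → 0 ℕ.< k → k ℕ.< n → ∃ λ a → ¬ (iter k σ a ≈ a)

module Skew {c ℓ : Level} (S : CyclicSetup c ℓ) where
  open CyclicSetup S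

  InK : Carrier → Set ℓ
  InK a = σ a ≈ a

  Poly : Set c
  Poly = List Carrier

  coeff : Poly → ℕ → Carrier
  coeff []      _       = 0#
  coeff (a ∷ p) zero    = a
  coeff (a ∷ p) (suc i) = coeff p i

  _≋_ : Poly → Poly → Set ℓ
  p ≋ q = ∀ i → coeff p i ≈ coeff q i

  _⊕_ : Poly → Poly → Poly
  []      ⊕ q       = q
  (a ∷ p) ⊕ []      = a ∷ p
  (a ∷ p) ⊕ (b ∷ q) = (a + b) ∷ (p ⊕ q)

  -- multiplication twisted by τ :  x a = τ(a) x
  -- (a + p' x) q = a q + (p' τ(q)) x
  mulWith : (Carrier → Carrier) → Poly → Poly → Poly
  mulWith τ []      q = []
  mulWith τ (a ∷ p) q = map (a *_) q ⊕ (0# ∷ mulWith τ p (map τ q))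

  _·_ : Poly → Poly → Poly
  _·_ = mulWith σ

  _⊗_ : Poly → Poly → Poly
  _⊗_ = mulWith (λ a → a)

  KPoly : Poly → Set ℓ
  KPoly F = ∀ i → InK (coeff F i)

  MonicDeg : Poly → ℕ → Set ℓ
  MonicDeg p d = coeff p d ≈ 1# × (∀ i → d ℕ.< i → coeff p i ≈ 0#)

  IsUnit : Poly → Set ℓ
  IsUnit p = ¬ (coeff p 0 ≈ 0#) × (∀ i → coeff p (suc i) ≈ 0#)

  IrreducibleR : Poly → Set (c ⊔ ℓ)
  IrreducibleR p = ¬ (p ≋ []) × ¬ IsUnit p
                 × (∀ g h → p ≋ (g · h) → IsUnit g ⊎ IsUnit h)

  IrreducibleK : Poly → Set (c ⊔ ℓ)
  IrreducibleK F = KPoly F × ¬ (F ≋ []) × ¬ IsUnit F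
                 × (∀ G H → KPoly G → KPoly H → F ≋ (G ⊗ H) → IsUnit G ⊎ IsUnit H)

  lift : Poly → Poly
  lift []      = []
  lift (a ∷ F) = a ∷ (replicate (n ∸ 1) 0# ++ lift F)

  InLeft : Poly → Poly → Set (c ⊔ ℓ)
  InLeft f p = ∃ λ q → p ≋ (q · f)

  TwoSided : (Poly → Set (c ⊔ ℓ)) → Set (c ⊔ ℓ)
  TwoSided I = (∀ p q → p ≋ q → I p → I q) × I []
             × (∀ p q → I p → I q → I (p ⊕ q))
             × (∀ r p → I p → I (r · p)) × (∀ p r → I p → I (p · r))

  -- F is the bound of f: F ∈ K[y] monic, and F(x^n) (central, so R F(x^n) is
  -- the two-sided ideal it generates) generates the largest two-sided ideal in R f
  Bound : Poly → Poly → Set (lsuc (c ⊔ ℓ))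
  Bound f F = KPoly F × (∃ λ s → MonicDeg F s)
            × (∀ p → InLeft (lift F) p → InLeft f p)
            × (∀ (I : Poly → Set (c ⊔ ℓ)) → TwoSided I → (∀ p → I p → InLeft f p)
                 → ∀ p → I p → InLeft (lift F) p)

  prodR : List Poly → Poly
  prodR = foldr _·_ (1# ∷ [])

  data AllIrr : List Poly → Set (c ⊔ ℓ) where
    []  : AllIrr []
    _∷_ : ∀ {p ps} → IrreducibleR p → AllIrr ps → AllIrr (p ∷ ps)

  -- F(x^n) factors in R as a product of m irreducible elements
  -- (so m = m_F, this number being independent of the factorisation)
  FactorsInto : Poly → ℕ → Set (c ⊔ ℓ)
  FactorsInto F m = ∃ λ ps → Data.List.length ps ≡L m × AllIrr ps × (prodR ps ≋ lift F)
    where open import Relation.Binary.PropositionalEquality renaming (_≡_ to _≡L_)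

  pow : Carrier → ℕ → Carrier
  pow a zero    = 1#
  pow a (suc k) = a * pow a k

  normAux : ℕ → Carrier → Carrier
  normAux zero    a = 1#
  normAux (suc k) a = iter k σ a * normAux k a

  Norm : Carrier → Carrier
  Norm a = normAux n a

  -1# : Carrier
  -1# = - 1#

{-# OPTIONS --safe #-}
module Submission where

-- Let M = R / R g, of dimension d = s k over L, let P = det (1 - T xⁿ | M), and let
-- F* be the reversal of F. Since x acts on M by a semilinear companion operator of
-- determinant ± g₀, the determinant of xⁿ on M is N (± g₀), so it suffices to show
-- P = F*ᵏ and compare leading coefficients. The n-th power of P is the analogous
-- determinant on L ⊗ M (over K); irreducibility of F over K gives a basis of vectors
-- xⁿʲ u (j < s) of this space with u defined over K, whence Pⁿ = F*ᵏⁿ. As P has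
-- coefficients in K, which is reduced, n-th roots with constant term 1 are unique.
--
-- Equality in L is neither decidable nor stable, so the basis only exists up to
-- double negation. The identity Pⁿ = F*ᵏⁿ does hold after multiplication by each of
-- the finitely many determinants of candidate bases; not all of them vanish, and an
-- anisotropic norm form combines them into one invertible multiplier.

-- The detour through the n-th power is forced. Over L the polynomial F may split, and then a
-- nonzero vector of M may generate a block shorter than s. Over K this cannot happen, since K[y]/F
-- is a field; and L ⊗ M decomposes into the n conjugates of M under the powers of σ, each of which
-- contributes the same factor because P is fixed by σ. That K is reduced is itself something to
-- prove: the field axiom inverts elements known to be nonzero, so ε² = 0 yields only that ε is not
-- nonzero. The equality ε = 0 is extracted from the irreducibility hypothesis, whose conclusion is
-- a disjunction: applied to the factorisation of f into 1 + ε x and (1 - ε x) f, each alternative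
-- gives ε = 0. In (a) irreducibility is assumed of f in R, while F is known only as its bound. That
-- F has no proper factor over K and a nonzero constant term is deduced from the simplicity of R / R
-- f. After that both parts are instances of one formula, with k = ℓ in (a) and k = h ℓ in (b).

open import Defs
open import Level using (Level; _⊔_)
open import Algebra.Bundles using (CommutativeRing; RawRing)
import Algebra.Solver.Ring
open import Algebra.Solver.Ring.AlmostCommutativeRing using (fromCommutativeRing; _-Raw-AlmostCommutative⟶_)
open import Data.Empty using (⊥; ⊥-elim)
open import Data.Fin using (Fin; zero; suc; toℕ; fromℕ; fromℕ<; inject₁; punchIn; punchOut; splitAt; remQuot; combine)
import Data.Fin.Properties as Fin
open import Data.List using (List; []; _∷_; length; lookup; replicate) renaming (map to mapₗ; _++_ to _++ₗ_)
import Data.List as List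
open import Data.List.Relation.Unary.All as ListAll using ([]; _∷_)
import Data.List.Relation.Unary.All.Properties as ListAll
open import Data.Maybe using (Maybe; just; nothing)
open import Data.Nat as ℕ using (ℕ; zero; suc; s≤s; z≤n; _∸_; _!) renaming (_*_ to _*ℕ_; _≤_ to _≤ℕ_)
open import Data.Nat.DivMod using (m/n*n≡m)
open import Data.Nat.Divisibility using (_∣_; divides; ∣⇒≤)
open import Data.Nat.Induction using (<-rec)
open import Data.Nat.ListAction using (product)
open import Data.Nat.Primality using (Prime; euclidsLemma; prime⇒nonZero; prime⇒nonTrivial)
open import Data.Nat.Primality.Factorisation using (factorise; PrimeFactorisation)
import Data.Nat.Properties as ℕ
open import Data.Product using (_×_; _,_; ∃; proj₁; proj₂; uncurry)
open import Data.Sum using (_⊎_; inj₁; inj₂; [_,_])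
open import Data.Unit.Polymorphic using (⊤; tt)
open import Data.Vec using (Vec; []; _∷_; map; _++_; tabulate)
import Data.Vec.Properties as Vec
open import Data.Vec.Relation.Binary.Pointwise.Inductive as Pointwise using (Pointwise; []; _∷_)
open import Data.Vec.Relation.Unary.All as VecAll using ([]; _∷_) renaming (All to Allᵥ)
open import Data.Vec.Relation.Unary.All.Properties using (++⁺)
open import Function using (_∘_; id)
open import Relation.Binary.Definitions using (tri<; tri≈; tri>)
open import Relation.Binary.PropositionalEquality as ≡ using (_≡_)
open import Relation.Nullary using (¬_; yes; no; contradiction)
open import Relation.Nullary.Decidable using (¬¬-excluded-middle)

-- Normalisation of ring identities

-- Formal differences of naturals serve as solver coefficients, so that
-- identities involving cancellation are decided in every commutative ring.
module RingSolver {c ℓ} (R : CommutativeRing c ℓ) where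
  open CommutativeRing R
  open import Algebra.Properties.Semiring.Mult semiring using (×-homo-+; ×1-homo-*) renaming (_×_ to _×ₙ_)
  open import Algebra.Properties.Ring ring using (x[y-z]≈xy-xz; [y-z]x≈yx-zx)
  open import Algebra.Properties.AbelianGroup +-abelianGroup using (⁻¹-∙-comm; ⁻¹-anti-homo‿-; ε⁻¹≈ε)
  open import Algebra.Properties.CommutativeSemigroup +-commutativeSemigroup using (interchange)
  open import Relation.Binary.Reasoning.Setoid setoid

  private
    cancel : ℕ × ℕ → ℕ × ℕ
    cancel (suc a , suc b) = cancel (a , b)
    cancel p               = p

    coefficients : RawRing _ _
    coefficients = record
      { Carrier = ℕ × ℕ
      ; _≈_ = _≡_
      ; _+_ = λ (a , b) (c , d) → cancel (a ℕ.+ c , b ℕ.+ d)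
      ; _*_ = λ (a , b) (c , d) → cancel (a ℕ.* c ℕ.+ b ℕ.* d , a ℕ.* d ℕ.+ b ℕ.* c)
      ; -_ = λ (a , b) → (b , a)
      ; 0# = (0 , 0)
      ; 1# = (1 , 0)
      }

    ι : ℕ → Carrier
    ι a = a ×ₙ 1#

    ⟦_⟧ : ℕ × ℕ → Carrier
    ⟦ (a , b) ⟧ = ι a - ι b

    [x-y]+[z-w] : ∀ x y z w → (x + z) - (y + w) ≈ (x - y) + (z - w)
    [x-y]+[z-w] x y z w = begin
      (x + z) - (y + w)      ≈⟨ +-congˡ (⁻¹-∙-comm y w) ⟨
      (x + z) + (- y + - w)  ≈⟨ interchange x z (- y) (- w) ⟩
      (x - y) + (z - w)      ∎

    [x-y]*[z-w] : ∀ x y z w → (x * z + y * w) - (x * w + y * z) ≈ (x - y) * (z - w)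
    [x-y]*[z-w] x y z w = begin
      (x * z + y * w) - (x * w + y * z)      ≈⟨ [x-y]+[z-w] _ _ _ _ ⟩
      (x * z - x * w) + (y * w - y * z)      ≈⟨ +-cong (x[y-z]≈xy-xz x z w) (⁻¹-anti-homo‿- (y * z) (y * w)) ⟨
      x * (z - w) + - (y * z - y * w)        ≈⟨ +-congˡ (-‿cong (x[y-z]≈xy-xz y z w)) ⟨
      x * (z - w) - y * (z - w)              ≈⟨ [y-z]x≈yx-zx (z - w) x y ⟨
      (x - y) * (z - w)                      ∎

    ⟦0⟧ : ι 0 - ι 0 ≈ 0#
    ⟦0⟧ = -‿inverseʳ 0#

    ⟦1⟧ : ι 1 - ι 0 ≈ 1#
    ⟦1⟧ = trans (+-cong (+-identityʳ 1#) ε⁻¹≈ε) (+-identityʳ 1#)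

    -- The first two clauses make the constants 0 and 1 denote 0# and 1# definitionally.
    ⟦_⟧′ : ℕ × ℕ → Carrier
    ⟦ (0 , 0) ⟧′ = 0#
    ⟦ (1 , 0) ⟧′ = 1#
    ⟦ p ⟧′       = ⟦ p ⟧

    ⟦_⟧′≈ : ∀ p → ⟦ p ⟧′ ≈ ⟦ p ⟧
    ⟦ (0 , 0) ⟧′≈ = sym ⟦0⟧
    ⟦ (1 , 0) ⟧′≈ = sym ⟦1⟧
    ⟦ (0 , suc _) ⟧′≈ = refl
    ⟦ (1 , suc _) ⟧′≈ = refl
    ⟦ (suc (suc _) , _) ⟧′≈ = refl

    ⟦cancel⟧ : ∀ p → ⟦ cancel p ⟧ ≈ ⟦ p ⟧
    ⟦cancel⟧ (zero , b)      = refl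
    ⟦cancel⟧ (suc a , zero)  = refl
    ⟦cancel⟧ (suc a , suc b) = trans (⟦cancel⟧ (a , b)) (begin
      ι a - ι b                    ≈⟨ +-identityˡ _ ⟨
      0# + (ι a - ι b)             ≈⟨ +-congʳ (-‿inverseʳ 1#) ⟨
      (1# - 1#) + (ι a - ι b)      ≈⟨ [x-y]+[z-w] 1# 1# (ι a) (ι b) ⟨
      (1# + ι a) - (1# + ι b)      ∎)

    morphism : coefficients -Raw-AlmostCommutative⟶ fromCommutativeRing R
    morphism = record
      { ⟦_⟧ = ⟦_⟧′
      ; +-homo = λ p@(a , b) q@(c , d) →
          trans (trans (trans ⟦ cancel (a ℕ.+ c , b ℕ.+ d) ⟧′≈ (⟦cancel⟧ (a ℕ.+ c , b ℕ.+ d))) (trans (+-cong (×-homo-+ 1# a c) (-‿cong (×-homo-+ 1# b d)))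
                                      ([x-y]+[z-w] (ι a) (ι b) (ι c) (ι d))))
                (sym (+-cong ⟦ p ⟧′≈ ⟦ q ⟧′≈))
      ; *-homo = λ p@(a , b) q@(c , d) →
          trans (trans (trans ⟦ cancel (a ℕ.* c ℕ.+ b ℕ.* d , a ℕ.* d ℕ.+ b ℕ.* c) ⟧′≈ (⟦cancel⟧ (a ℕ.* c ℕ.+ b ℕ.* d , a ℕ.* d ℕ.+ b ℕ.* c))) (trans
                (+-cong (trans (×-homo-+ 1# (a ℕ.* c) (b ℕ.* d)) (+-cong (×1-homo-* a c) (×1-homo-* b d)))
                        (-‿cong (trans (×-homo-+ 1# (a ℕ.* d) (b ℕ.* c)) (+-cong (×1-homo-* a d) (×1-homo-* b c)))))
                ([x-y]*[z-w] (ι a) (ι b) (ι c) (ι d))))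
                (sym (*-cong ⟦ p ⟧′≈ ⟦ q ⟧′≈))
      ; -‿homo = λ p@(a , b) →
          trans (trans ⟦ (b , a) ⟧′≈ (sym (⁻¹-anti-homo‿- (ι a) (ι b)))) (sym (-‿cong ⟦ p ⟧′≈))
      ; 0-homo = refl
      ; 1-homo = refl
      }

    _≟_ : ∀ p q → Maybe (⟦ p ⟧′ ≈ ⟦ q ⟧′)
    p@(a , b) ≟ q@(c , d) with (a ℕ.+ d) ℕ.≟ (c ℕ.+ b)
    ... | no _ = nothing
    ... | yes a+d≡c+b = just (begin
      ⟦ p ⟧′                         ≈⟨ ⟦ p ⟧′≈ ⟩
      ι a - ι b                      ≈⟨ +-identityʳ _ ⟨
      (ι a - ι b) + 0#               ≈⟨ +-congˡ (-‿inverseʳ (ι d)) ⟨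
      (ι a - ι b) + (ι d - ι d)      ≈⟨ [x-y]+[z-w] _ _ _ _ ⟨
      (ι a + ι d) - (ι b + ι d)      ≈⟨ +-cong (trans (sym (×-homo-+ 1# a d)) (trans (reflexive (≡.cong ι a+d≡c+b)) (×-homo-+ 1# c b)))
                                              (-‿cong (+-comm (ι b) (ι d))) ⟩
      (ι c + ι b) - (ι d + ι b)      ≈⟨ [x-y]+[z-w] _ _ _ _ ⟩
      (ι c - ι d) + (ι b - ι b)      ≈⟨ +-congˡ (-‿inverseʳ (ι b)) ⟩
      (ι c - ι d) + 0#               ≈⟨ +-identityʳ _ ⟩
      ι c - ι d                      ≈⟨ ⟦ q ⟧′≈ ⟨
      ⟦ q ⟧′                         ∎)

  open Algebra.Solver.Ring coefficients (fromCommutativeRing R) morphism _≟_ public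
    using (solve; _:=_; _:+_; _:*_; _:-_; :-_; con; Polynomial)

  :0 :1 : ∀ {n} → Polynomial n
  :0 = con (0 , 0)
  :1 = con (1 , 0)

-- Vectors and linear maps over a commutative ring

module Vectors {c ℓ} (A : CommutativeRing c ℓ) where
  open CommutativeRing A hiding (zero)
  open import Algebra.Properties.Semiring.Sum semiring public
    using (sum; sum-cong-≋; ∑-distrib-+; *-distribˡ-sum; sum-replicate-zero)
  open RingSolver A
  open import Relation.Binary.Reasoning.Setoid setoid

  V : ℕ → Set c
  V D = Fin D → Carrier

  infix 4 _≋_
  infixl 6 _⊞_
  infixl 7 _⊡_

  _≋_ : ∀ {D} → V D → V D → Set ℓ
  v ≋ w = ∀ i → v i ≈ w i

  _⊞_ : ∀ {D} → V D → V D → V D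
  (v ⊞ w) i = v i + w i

  _⊡_ : ∀ {D} → Carrier → V D → V D
  (a ⊡ v) i = a * v i

  𝟎 : ∀ {D} → V D
  𝟎 _ = 0#

  record IsLinear {D E} (t : V D → V E) : Set (c ⊔ ℓ) where
    field
      ⟨cong⟩ : ∀ {v w} → v ≋ w → t v ≋ t w
      ⟨+⟩    : ∀ v w → t (v ⊞ w) ≋ t v ⊞ t w
      ⟨*⟩    : ∀ a v → t (a ⊡ v) ≋ a ⊡ t v

    ⟨0⟩ : t 𝟎 ≋ 𝟎
    ⟨0⟩ i = trans (⟨cong⟩ (λ j → sym (zeroˡ 0#)) i) (trans (⟨*⟩ 0# 𝟎 i) (zeroˡ _))

    ⟨∑⟩ : ∀ {k} (a : V k) (w : Fin k → V D) →
          t (λ i → sum (λ j → a j * w j i)) ≋ (λ i → sum (λ j → a j * t (w j) i))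
    ⟨∑⟩ {zero}  a w = ⟨0⟩
    ⟨∑⟩ {suc k} a w i = trans (⟨+⟩ (a zero ⊡ w zero) _ i)
      (+-cong (⟨*⟩ (a zero) (w zero) i) (⟨∑⟩ (a ∘ suc) (w ∘ suc) i))

  tl : ∀ {D} → V (suc D) → V D
  tl v = v ∘ suc

  0∷_ : ∀ {D} → V D → V (suc D)
  (0∷ v) zero    = 0#
  (0∷ v) (suc i) = v i

  tl-linear : ∀ {D} → IsLinear (tl {D})
  tl-linear = record { ⟨cong⟩ = λ p i → p (suc i) ; ⟨+⟩ = λ _ _ _ → refl ; ⟨*⟩ = λ _ _ _ → refl }

  0∷-linear : ∀ {D} → IsLinear (0∷_ {D})
  0∷-linear = record
    { ⟨cong⟩ = λ { p zero → refl ; p (suc i) → p i }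
    ; ⟨+⟩ = λ { _ _ zero → sym (+-identityʳ 0#) ; _ _ (suc _) → refl }
    ; ⟨*⟩ = λ { a _ zero → sym (zeroʳ a) ; _ _ (suc _) → refl } }

  e : ∀ {D} → Fin D → V D
  e zero    zero    = 1#
  e zero    (suc _) = 0#
  e (suc i) = 0∷ e i

  ∑-e : ∀ {D} (v : V D) → v ≋ (λ i → sum (λ j → v j * e j i))
  ∑-e {suc D} v zero = begin
    v zero                                        ≈⟨ solve 1 (λ a → a := a :* :1 :+ :0) refl (v zero) ⟩
    v zero * 1# + 0#                              ≈⟨ +-congˡ (sum-replicate-zero D) ⟨
    v zero * 1# + sum {D} (λ _ → 0#)              ≈⟨ +-congˡ (sum-cong-≋ (λ j → sym (zeroʳ (v (suc j))))) ⟩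
    v zero * 1# + sum (λ j → v (suc j) * 0#)      ∎
  ∑-e {suc D} v (suc i) = begin
    v (suc i)                                      ≈⟨ ∑-e (tl v) i ⟩
    sum (λ j → v (suc j) * e j i)                  ≈⟨ solve 2 (λ a b → b := a :* :0 :+ b) refl (v zero) _ ⟩
    v zero * 0# + sum (λ j → v (suc j) * e j i)    ∎

  linear-∑ : ∀ {D E} {t : V D → V E} → IsLinear t → ∀ v → t v ≋ (λ i → sum (λ j → v j * t (e j) i))
  linear-∑ T v i = trans (⟨cong⟩ (∑-e v) i) (⟨∑⟩ v e i)
    where open IsLinear T

  std : ∀ D → Vec (V D) D
  std zero    = []
  std (suc D) = e zero ∷ map 0∷_ (std D)

  -- The recursive form suits inductions on the dimension, the tabulated one suits operators given
  -- by their columns.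
  std-tabulate : ∀ D → std D ≡ tabulate e
  std-tabulate zero    = ≡.refl
  std-tabulate (suc D) = ≡.cong (e zero ∷_) (≡.trans (≡.cong (map 0∷_) (std-tabulate D)) (≡.sym (tabulate-∘ 0∷_ e)))
    where open import Data.Vec.Properties using (tabulate-∘)

  -- Column j of a linear map is the image of e j.
  app : ∀ {D E} → (Fin D → V E) → V D → V E
  app cols v i = sum (λ j → v j * cols j i)

  app-linear : ∀ {D E} (cols : Fin D → V E) → IsLinear (app cols)
  app-linear cols = record
    { ⟨cong⟩ = λ p i → sum-cong-≋ (λ j → *-congʳ (p j))
    ; ⟨+⟩ = λ v w i → trans (sum-cong-≋ (λ j → distribʳ (cols j i) (v j) (w j))) (∑-distrib-+ (λ j → v j * cols j i) _)
    ; ⟨*⟩ = λ a v i → trans (sum-cong-≋ (λ j → *-assoc a (v j) (cols j i))) (sym (*-distribˡ-sum a (λ j → v j * cols j i))) }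

  app-e : ∀ {D E} (cols : Fin D → V E) j → app cols (e j) ≋ cols j
  app-e {suc D} cols zero i = begin
    1# * cols zero i + sum (λ j → 0# * cols (suc j) i)  ≈⟨ +-cong (*-identityˡ _) (trans (sum-cong-≋ (λ j → zeroˡ (cols (suc j) i))) (sum-replicate-zero D)) ⟩
    cols zero i + 0#                                    ≈⟨ +-identityʳ _ ⟩
    cols zero i                                         ∎
  app-e {suc D} cols (suc j) i = begin
    0# * cols zero i + app (cols ∘ suc) (e j) i  ≈⟨ +-cong (zeroˡ _) (app-e (cols ∘ suc) j i) ⟩
    0# + cols (suc j) i                          ≈⟨ +-identityˡ _ ⟩
    cols (suc j) i                               ∎

-- Alternating forms and determinants

module Alternating {c ℓ} (A : CommutativeRing c ℓ) where
  open CommutativeRing A hiding (zero)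
  open Vectors A
  open RingSolver A
  open import Relation.Binary.Reasoning.Setoid setoid

  Form : ℕ → ℕ → Set c
  Form D m = Vec (V D) m → Carrier

  record HeadLinear {D m} (f : Form D (suc m)) : Set (c ⊔ ℓ) where
    field
      ⟨cong⟩ : ∀ {v w} vs → v ≋ w → f (v ∷ vs) ≈ f (w ∷ vs)
      ⟨+⟩    : ∀ v w vs → f (v ⊞ w ∷ vs) ≈ f (v ∷ vs) + f (w ∷ vs)
      ⟨*⟩    : ∀ a v vs → f (a ⊡ v ∷ vs) ≈ a * f (v ∷ vs)

    ⟨0⟩ : ∀ vs → f (𝟎 ∷ vs) ≈ 0#
    ⟨0⟩ vs = trans (⟨cong⟩ vs (λ _ → sym (zeroˡ 0#))) (trans (⟨*⟩ 0# 𝟎 vs) (zeroˡ _))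

  VanishesOnRepeat : ∀ {D m} → Form D (suc m) → Set (c ⊔ ℓ)
  VanishesOnRepeat {m = zero}  f = ⊤
  VanishesOnRepeat {m = suc m} f = ∀ v vs → f (v ∷ v ∷ vs) ≈ 0#

  -- Linearity in the first slot and vanishing on equal first two arguments are demanded again after
  -- every initial segment is fixed. This amounts to multilinearity and vanishing on adjacent
  -- repeats, in a shape made for induction on the number of arguments.
  data IsAlt {D} : ∀ {m} → Form D m → Set (c ⊔ ℓ) where
    []    : ∀ {f : Form D 0} → IsAlt f
    mkAlt : ∀ {m} {f : Form D (suc m)} → HeadLinear f → VanishesOnRepeat f →
            (∀ v → IsAlt (f ∘ (v ∷_))) → IsAlt f

  headLinear : ∀ {D m} {f : Form D (suc m)} → IsAlt f → HeadLinear f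
  headLinear (mkAlt h _ _) = h

  repeat : ∀ {D m} {f : Form D (suc (suc m))} → IsAlt f → ∀ v vs → f (v ∷ v ∷ vs) ≈ 0#
  repeat (mkAlt _ r _) = r

  partial : ∀ {D m} {f : Form D (suc m)} → IsAlt f → ∀ v → IsAlt (f ∘ (v ∷_))
  partial (mkAlt _ _ p) = p

  alt-cong : ∀ {D m} {f : Form D m} → IsAlt f → ∀ {vs ws} → Pointwise _≋_ vs ws → f vs ≈ f ws
  alt-cong _ [] = refl
  alt-cong F (p ∷ ps) = trans (HeadLinear.⟨cong⟩ (headLinear F) _ p) (alt-cong (partial F _) ps)

  ≈-alt : ∀ {D m} {f g : Form D m} → (∀ vs → f vs ≈ g vs) → IsAlt f → IsAlt g
  ≈-alt f≈g [] = []
  ≈-alt {m = suc m} {f} {g} f≈g (mkAlt h r p) = mkAlt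
    (record
      { ⟨cong⟩ = λ vs q → trans (sym (f≈g _)) (trans (H.⟨cong⟩ vs q) (f≈g _))
      ; ⟨+⟩ = λ v w vs → trans (sym (f≈g _)) (trans (H.⟨+⟩ v w vs) (+-cong (f≈g _) (f≈g _)))
      ; ⟨*⟩ = λ a v vs → trans (sym (f≈g _)) (trans (H.⟨*⟩ a v vs) (*-congˡ (f≈g _))) })
    (rep m f≈g r)
    (λ v → ≈-alt (λ vs → f≈g (v ∷ vs)) (p v))
    where
    module H = HeadLinear h
    rep : ∀ m {f g : Form _ (suc m)} → (∀ vs → f vs ≈ g vs) → VanishesOnRepeat f → VanishesOnRepeat g
    rep zero    _ _ = tt
    rep (suc m) q r v vs = trans (sym (q _)) (r v vs)

  pullback : ∀ {D E m} {f : Form E m} {t : V D → V E} → IsLinear t → IsAlt f → IsAlt (f ∘ map t)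
  pullback T [] = []
  pullback {m = suc m} {f} {t} T (mkAlt h r p) = mkAlt
    (record
      { ⟨cong⟩ = λ vs q → H.⟨cong⟩ _ (T.⟨cong⟩ q)
      ; ⟨+⟩ = λ v w vs → trans (H.⟨cong⟩ _ (T.⟨+⟩ v w)) (H.⟨+⟩ _ _ _)
      ; ⟨*⟩ = λ a v vs → trans (H.⟨cong⟩ _ (T.⟨*⟩ a v)) (H.⟨*⟩ _ _ _) })
    (rep m r)
    (λ v → pullback T (p (t v)))
    where
    module H = HeadLinear h
    module T = IsLinear T
    rep : ∀ m {f : Form _ (suc m)} → VanishesOnRepeat f → VanishesOnRepeat (f ∘ map t)
    rep zero    _ = tt
    rep (suc m) r v vs = r (t v) (map t vs)

  -- Linear combinations are taken in the one shape a f - b g that is needed.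
  sub-alt : ∀ {D m} {f g : Form D m} a b → IsAlt f → IsAlt g → IsAlt (λ vs → a * f vs - b * g vs)
  sub-alt a b [] [] = []
  sub-alt {m = suc m} {f} {g} a b (mkAlt h r p) (mkAlt h′ r′ p′) = mkAlt
    (record
      { ⟨cong⟩ = λ vs q → +-cong (*-congˡ (H.⟨cong⟩ vs q)) (-‿cong (*-congˡ (H′.⟨cong⟩ vs q)))
      ; ⟨+⟩ = λ v w vs → trans (+-cong (*-congˡ (H.⟨+⟩ v w vs)) (-‿cong (*-congˡ (H′.⟨+⟩ v w vs))))
          (solve 6 (λ a b x y z w → a :* (x :+ y) :- b :* (z :+ w) := (a :* x :- b :* z) :+ (a :* y :- b :* w)) refl a b _ _ _ _)
      ; ⟨*⟩ = λ k v vs → trans (+-cong (*-congˡ (H.⟨*⟩ k v vs)) (-‿cong (*-congˡ (H′.⟨*⟩ k v vs))))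
          (solve 5 (λ a b k x y → a :* (k :* x) :- b :* (k :* y) := k :* (a :* x :- b :* y)) refl a b k _ _) })
    (rep m r r′)
    (λ v → sub-alt a b (p v) (p′ v))
    where
    module H = HeadLinear h
    module H′ = HeadLinear h′
    rep : ∀ m {f g : Form _ (suc m)} → VanishesOnRepeat f → VanishesOnRepeat g → VanishesOnRepeat (λ vs → a * f vs - b * g vs)
    rep zero    _ _ = tt
    rep (suc m) r r′ v vs = trans (+-cong (*-congˡ (r v vs)) (-‿cong (*-congˡ (r′ v vs))))
      (solve 2 (λ a b → a :* :0 :- b :* :0 := :0) refl a b)

  swap : ∀ {D m} {f : Form D (suc (suc m))} → IsAlt f → ∀ v w vs → f (v ∷ w ∷ vs) ≈ - f (w ∷ v ∷ vs)
  swap {f = f} F v w vs = begin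
    f (v ∷ w ∷ vs)
      ≈⟨ solve 2 (λ x y → x := ((:0 :+ x) :+ (y :+ :0)) :- y) refl _ (f (w ∷ v ∷ vs)) ⟩
    ((0# + f (v ∷ w ∷ vs)) + (f (w ∷ v ∷ vs) + 0#)) - f (w ∷ v ∷ vs)
      ≈⟨ +-congʳ (+-cong (+-congʳ (repeat F v vs)) (+-congˡ (repeat F w vs))) ⟨
    ((f (v ∷ v ∷ vs) + f (v ∷ w ∷ vs)) + (f (w ∷ v ∷ vs) + f (w ∷ w ∷ vs))) - f (w ∷ v ∷ vs)
      ≈⟨ +-congʳ (+-cong (P.⟨+⟩ v v w vs) (P.⟨+⟩ w v w vs)) ⟨
    (f (v ∷ v ⊞ w ∷ vs) + f (w ∷ v ⊞ w ∷ vs)) - f (w ∷ v ∷ vs)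
      ≈⟨ +-congʳ (H.⟨+⟩ v w (v ⊞ w ∷ vs)) ⟨
    f (v ⊞ w ∷ v ⊞ w ∷ vs) - f (w ∷ v ∷ vs)
      ≈⟨ +-congʳ (repeat F (v ⊞ w) vs) ⟩
    0# - f (w ∷ v ∷ vs)
      ≈⟨ +-identityˡ _ ⟩
    - f (w ∷ v ∷ vs) ∎
    where
    module H = HeadLinear (headLinear F)
    module P v = HeadLinear (headLinear (partial F v))

  shear : ∀ {D m} {f : Form D (suc (suc m))} → IsAlt f → ∀ a v w vs → f (v ∷ w ⊞ a ⊡ v ∷ vs) ≈ f (v ∷ w ∷ vs)
  shear {f = f} F a v w vs = begin
    f (v ∷ w ⊞ a ⊡ v ∷ vs)                ≈⟨ P.⟨+⟩ w (a ⊡ v) vs ⟩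
    f (v ∷ w ∷ vs) + f (v ∷ a ⊡ v ∷ vs)   ≈⟨ +-congˡ (trans (P.⟨*⟩ a v vs) (trans (*-congˡ (repeat F v vs)) (zeroʳ a))) ⟩
    f (v ∷ w ∷ vs) + 0#                   ≈⟨ +-identityʳ _ ⟩
    f (v ∷ w ∷ vs)                        ∎
    where module P = HeadLinear (headLinear (partial F v))

  -- The exterior product of f with the i-th coordinate functional.
  expand : ∀ {D m} → Fin D → Form D m → Form D (suc m)
  expand {m = zero}  i f (v ∷ [])     = v i * f []
  expand {m = suc m} i f (v ∷ vs)     = v i * f vs - expand i (f ∘ (v ∷_)) vs

  expand-cong : ∀ {D m} (i : Fin D) {f g : Form D m} → (∀ vs → f vs ≈ g vs) → ∀ vs → expand i f vs ≈ expand i g vs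
  expand-cong {m = zero}  i p (v ∷ []) = *-congˡ (p [])
  expand-cong {m = suc m} i p (v ∷ vs) = +-cong (*-congˡ (p vs)) (-‿cong (expand-cong i (λ ws → p (v ∷ ws)) vs))

  expand-sub : ∀ {D m} (i : Fin D) a b (f g : Form D m) vs →
               expand i (λ ws → a * f ws - b * g ws) vs ≈ a * expand i f vs - b * expand i g vs
  expand-sub {m = zero} i a b f g (v ∷ []) =
    solve 5 (λ v a b x y → v :* (a :* x :- b :* y) := a :* (v :* x) :- b :* (v :* y)) refl (v i) a b (f []) (g [])
  expand-sub {m = suc m} i a b f g (v ∷ vs) = trans (+-congˡ (-‿cong (expand-sub i a b _ _ vs)))
    (solve 7 (λ v a b x y z w → v :* (a :* x :- b :* y) :- (a :* z :- b :* w) := a :* (v :* x :- z) :- b :* (v :* y :- w))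
       refl (v i) a b (f vs) (g vs) _ _)

  expand-+ : ∀ {D m} (i : Fin D) (f g : Form D m) vs →
             expand i (λ ws → f ws + g ws) vs ≈ expand i f vs + expand i g vs
  expand-+ i f g vs = trans (expand-cong i (λ ws → solve 2 (λ x y → x :+ y := :1 :* x :- (:- :1) :* y) refl (f ws) (g ws)) vs)
    (trans (expand-sub i 1# (- 1#) f g vs) (solve 2 (λ x y → :1 :* x :- (:- :1) :* y := x :+ y) refl _ _))

  expand-* : ∀ {D m} (i : Fin D) a (f : Form D m) vs → expand i (λ ws → a * f ws) vs ≈ a * expand i f vs
  expand-* i a f vs = trans (expand-cong i (λ ws → solve 2 (λ a x → a :* x := a :* x :- :0 :* x) refl a (f ws)) vs)
    (trans (expand-sub i a 0# f f vs) (solve 2 (λ a x → a :* x :- :0 :* x := a :* x) refl a _))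

  expand-0 : ∀ {D m} (i : Fin D) {f : Form D m} → (∀ vs → f vs ≈ 0#) → ∀ vs → expand i f vs ≈ 0#
  expand-0 i {f} p vs = trans (expand-cong i (λ ws → trans (p ws) (sym (zeroˡ 0#))) vs)
    (trans (expand-* i 0# (λ _ → 0#) vs) (zeroˡ _))

  expand-alt : ∀ {D m} (i : Fin D) {f : Form D m} → IsAlt f → IsAlt (expand i f)
  expand-alt i {f} [] = mkAlt
    (record { ⟨cong⟩ = λ { [] p → *-congʳ (p i) }
            ; ⟨+⟩ = λ { v w [] → distribʳ _ _ _ }
            ; ⟨*⟩ = λ { a v [] → *-assoc _ _ _ } })
    tt (λ _ → [])
  expand-alt {m = suc m} i {f} F = mkAlt
    (record { ⟨cong⟩ = λ { vs p → +-cong (*-congʳ (p i)) (-‿cong (expand-cong i (λ ws → H.⟨cong⟩ ws p) vs)) }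
            ; ⟨+⟩ = λ { v w vs → trans (+-congˡ (-‿cong (trans (expand-cong i (H.⟨+⟩ v w) vs) (expand-+ i _ _ vs))))
                (solve 5 (λ v w x y z → (v :+ w) :* x :- (y :+ z) := (v :* x :- y) :+ (w :* x :- z)) refl (v i) (w i) (f vs) _ _) }
            ; ⟨*⟩ = λ { a v vs → trans (+-congˡ (-‿cong (trans (expand-cong i (H.⟨*⟩ a v) vs) (expand-* i a _ vs))))
                (solve 4 (λ a v x y → (a :* v) :* x :- (a :* y) := a :* (v :* x :- y)) refl a (v i) (f vs) _) } })
    (rep F)
    (λ v → ≈-alt (λ vs → solve 3 (λ a x y → a :* x :- :1 :* y := a :* x :- y) refl (v i) (f vs) (expand i (f ∘ (v ∷_)) vs))
                 (sub-alt (v i) 1# F (expand-alt i (partial F v))))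
    where
    module H = HeadLinear (headLinear F)
    rep : ∀ {m} {f : Form _ (suc m)} → IsAlt f → ∀ v vs → expand i f (v ∷ v ∷ vs) ≈ 0#
    rep {zero}  {f} F v [] = -‿inverseʳ (v i * f (v ∷ []))
    rep {suc m} {f} F v vs = begin
      v i * f (v ∷ vs) - (v i * f (v ∷ vs) - expand i (λ ws → f (v ∷ v ∷ ws)) vs)
        ≈⟨ +-congˡ (-‿cong (+-congˡ (-‿cong (expand-0 i (repeat F v) vs)))) ⟩
      v i * f (v ∷ vs) - (v i * f (v ∷ vs) - 0#)
        ≈⟨ solve 1 (λ x → x :- (x :- :0) := :0) refl (v i * f (v ∷ vs)) ⟩
      0# ∎

  -- Modulo e zero, every vector may be replaced by one with head 0.
  private
    z : ∀ {D} → V (suc D) → V (suc D)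
    z v = 0∷ tl v

    split : ∀ {D} (v : V (suc D)) → v ≋ z v ⊞ v zero ⊡ e zero
    split v zero    = solve 1 (λ a → a := :0 :+ a :* :1) refl (v zero)
    split v (suc i) = solve 2 (λ a b → b := b :+ a :* :0) refl (v zero) (v (suc i))

    zs : ∀ {D m} → Vec (V (suc D)) m → Vec (V (suc D)) m
    zs vs = map 0∷_ (map tl vs)

    clear : ∀ {D m} {f : Form (suc D) (suc m)} → IsAlt f → ∀ vs → f (e zero ∷ vs) ≈ f (e zero ∷ zs vs)
    clear F [] = refl
    clear {f = f} F (v ∷ vs) = begin
      f (e zero ∷ v ∷ vs)                           ≈⟨ HeadLinear.⟨cong⟩ (headLinear (partial F _)) vs (split v) ⟩
      f (e zero ∷ z v ⊞ v zero ⊡ e zero ∷ vs)       ≈⟨ shear F (v zero) (e zero) (z v) vs ⟩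
      f (e zero ∷ z v ∷ vs)                         ≈⟨ swap F _ _ vs ⟩
      -- The form left after fixing `z v` starts with `e zero` again, so the induction applies to
      -- it.
      - f (z v ∷ e zero ∷ vs)                       ≈⟨ -‿cong (clear (partial F (z v)) vs) ⟩
      - f (z v ∷ e zero ∷ zs vs)                    ≈⟨ swap F _ _ _ ⟨
      f (e zero ∷ z v ∷ zs vs)                      ∎

    -- The exterior power of a line plus a hyperplane: `f` is its restriction to vectors with head 0
    -- plus the exterior product of coordinate zero with the contraction of `f` by `e zero`. Both
    -- pieces live in one dimension less, which drives the two inductions below.
    expandHead : ∀ {D m} {f : Form (suc D) (suc m)} → IsAlt f → ∀ vs →
                 f vs ≈ f (zs vs) + expand zero (λ ws → f (e zero ∷ zs ws)) vs
    expandHead {f = f} F (v ∷ vs) = begin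
      f (v ∷ vs)                                ≈⟨ H.⟨cong⟩ vs (split v) ⟩
      f (z v ⊞ v zero ⊡ e zero ∷ vs)            ≈⟨ H.⟨+⟩ _ _ vs ⟩
      f (z v ∷ vs) + f (v zero ⊡ e zero ∷ vs)   ≈⟨ +-congˡ (trans (H.⟨*⟩ _ _ vs) (*-congˡ (clear F vs))) ⟩
      f (z v ∷ vs) + v zero * f (e zero ∷ zs vs) ≈⟨ rest F v vs ⟩
      f (zs (v ∷ vs)) + expand zero (λ ws → f (e zero ∷ zs ws)) (v ∷ vs) ∎
      where
      module H = HeadLinear (headLinear F)
      rest : ∀ {D m} {f : Form (suc D) (suc m)} → IsAlt f → ∀ v (vs : Vec (V (suc D)) m) →
             f (z v ∷ vs) + v zero * f (e zero ∷ zs vs) ≈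
             f (zs (v ∷ vs)) + expand zero (λ ws → f (e zero ∷ zs ws)) (v ∷ vs)
      rest F v [] = refl
      rest {f = f} F v vs@(_ ∷ _) = begin
        f (z v ∷ vs) + v zero * f (e zero ∷ zs vs)
          ≈⟨ +-congʳ (expandHead (partial F (z v)) vs) ⟩
        (f (z v ∷ zs vs) + expand zero (λ ws → f (z v ∷ e zero ∷ zs ws)) vs) + v zero * f (e zero ∷ zs vs)
          ≈⟨ +-congʳ (+-congˡ (trans (expand-cong zero (λ ws → trans (swap F _ _ _)
               (solve 1 (λ x → :- x := (:- :1) :* x) refl _)) vs) (expand-* zero (- 1#) _ vs))) ⟩
        (f (z v ∷ zs vs) + - 1# * expand zero (λ ws → f (e zero ∷ z v ∷ zs ws)) vs) + v zero * f (e zero ∷ zs vs)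
          ≈⟨ solve 3 (λ x y w → (x :+ (:- :1) :* y) :+ w := x :+ (w :- y)) refl _ _ _ ⟩
        f (z v ∷ zs vs) + (v zero * f (e zero ∷ zs vs) - expand zero (λ ws → f (e zero ∷ z v ∷ zs ws)) vs) ∎

  alt-vanishes : ∀ {D m} {f : Form D m} → IsAlt f → D ℕ.< m → ∀ vs → f vs ≈ 0#
  alt-vanishes {zero} {suc m} {f} F _ (v ∷ vs) =
    trans (H.⟨cong⟩ vs (λ ())) (H.⟨0⟩ vs)
    where module H = HeadLinear (headLinear F)
  alt-vanishes {suc D} {suc m} {f} F (s≤s D<m) vs = begin
    f vs
      ≈⟨ expandHead F vs ⟩
    f (zs vs) + expand zero (λ ws → f (e zero ∷ zs ws)) vs
      ≈⟨ +-cong (alt-vanishes (pullback 0∷-linear F) (ℕ.m<n⇒m<1+n D<m) (map tl vs))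
                (expand-0 zero (λ ws → alt-vanishes (pullback 0∷-linear (partial F (e zero))) D<m (map tl ws)) vs) ⟩
    0# + 0#
      ≈⟨ +-identityʳ 0# ⟩
    0# ∎

  det : ∀ {D} → Form D D
  det {zero}  [] = 1#
  det {suc D} = expand zero (det ∘ map tl)

  det-alt : ∀ {D} → IsAlt (det {D})
  det-alt {zero}  = []
  det-alt {suc D} = expand-alt zero (pullback tl-linear det-alt)

  -- The restriction to the hyperplane has more arguments than the dimension allows and vanishes, so
  -- `f` is the expansion of a form covered by the induction. The multiplicativity of determinants
  -- rests on this.
  alt-unique : ∀ {D} {f : Form D D} → IsAlt f → ∀ vs → f vs ≈ det vs * f (std D)
  alt-unique {zero}  F [] = sym (*-identityˡ _)
  alt-unique {suc D} {f} F vs = begin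
    f vs
      ≈⟨ expandHead F vs ⟩
    f (zs vs) + expand zero (λ ws → f (e zero ∷ zs ws)) vs
      ≈⟨ +-cong (alt-vanishes (pullback 0∷-linear F) ℕ.≤-refl (map tl vs))
                (expand-cong zero (λ ws → trans (alt-unique (pullback 0∷-linear (partial F (e zero))) (map tl ws))
                                                (*-comm _ _)) vs) ⟩
    0# + expand zero (λ ws → f (std (suc D)) * det (map tl ws)) vs
      ≈⟨ trans (+-identityˡ _) (expand-* zero _ _ vs) ⟩
    f (std (suc D)) * det vs
      ≈⟨ *-comm _ _ ⟩
    det vs * f (std (suc D)) ∎

  det-std : ∀ D → det (std D) ≈ 1#
  det-std zero = refl
  det-std (suc D) = rec {f = det} (std D) (det-std D)
    where
    headless : ∀ {m} (f : Form (suc D) m) (vs : Vec (V D) (suc m)) → expand zero f (map 0∷_ vs) ≈ 0#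
    headless {zero}  f (v ∷ []) = zeroˡ _
    headless {suc m} f (v ∷ vs) = trans (+-cong (zeroˡ _) (-‿cong (headless _ vs))) (-‿inverseʳ 0#)
    rec : ∀ {m} {f : Form D m} (vs : Vec (V D) m) → f vs ≈ 1# → expand zero (f ∘ map tl) (e zero ∷ map 0∷_ vs) ≈ 1#
    rec [] p = trans (*-identityˡ _) p
    rec {f = f} vs@(_ ∷ _) p = trans (+-cong (*-identityˡ _) (-‿cong (headless _ vs)))
      (trans (solve 1 (λ x → x :- :0 := x) refl _) (trans (reflexive (≡.cong f (tl-0∷ vs))) p))
      where
      tl-0∷ : ∀ {m} (vs : Vec (V D) m) → map tl (map 0∷_ vs) ≡ vs
      tl-0∷ [] = ≡.refl
      tl-0∷ (v ∷ vs) = ≡.cong (v ∷_) (tl-0∷ vs)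

  det-map : ∀ {D} {t : V D → V D} → IsLinear t → ∀ vs → det (map t vs) ≈ det vs * det (map t (std D))
  det-map T = alt-unique (pullback T det-alt)

  prefix-alt : ∀ {D} m {k} {f : Form D (m ℕ.+ k)} → IsAlt f → ∀ ws → IsAlt {m = m} (λ vs → f (vs ++ ws))
  prefix-alt zero F ws = []
  prefix-alt {D} (suc m) {k} F ws = mkAlt
    (record { ⟨cong⟩ = λ vs → H.⟨cong⟩ (vs ++ ws) ; ⟨+⟩ = λ v w vs → H.⟨+⟩ v w (vs ++ ws) ; ⟨*⟩ = λ a v vs → H.⟨*⟩ a v (vs ++ ws) })
    (rep m F)
    (λ v → prefix-alt m (partial F v) ws)
    where
    module H = HeadLinear (headLinear F)
    rep : ∀ m {f : Form D (suc m ℕ.+ k)} → IsAlt f → VanishesOnRepeat {m = m} (λ vs → f (vs ++ ws))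
    rep zero F = tt
    rep (suc m) F v vs = repeat F v (vs ++ ws)

  suffix-alt : ∀ {D m k} {f : Form D (m ℕ.+ k)} → IsAlt f → ∀ (vs : Vec (V D) m) → IsAlt {m = k} (λ ws → f (vs ++ ws))
  suffix-alt F [] = F
  suffix-alt F (v ∷ vs) = suffix-alt (partial F v) vs

-- Formal power series

module PowerSeries {c ℓ} (A : CommutativeRing c ℓ) where
  open CommutativeRing A hiding (zero)
  open RingSolver A
  open import Relation.Binary.Reasoning.Setoid setoid

  Series : Set c
  Series = ℕ → Carrier

  infixl 7 _⋆_

  _⋆_ : Series → Series → Series
  (p ⋆ q) zero    = p 0 * q 0
  (p ⋆ q) (suc k) = p 0 * q (suc k) + ((p ∘ suc) ⋆ q) k

  const : Carrier → Series
  const a zero    = a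
  const a (suc _) = 0#

  𝕋 : Series
  𝕋 zero = 0#
  𝕋 (suc k) = const 1# k

  ⋆-cong : ∀ {p p′ q q′} → (∀ i → p i ≈ p′ i) → (∀ i → q i ≈ q′ i) → ∀ k → (p ⋆ q) k ≈ (p′ ⋆ q′) k
  ⋆-cong P Q zero    = *-cong (P 0) (Q 0)
  ⋆-cong P Q (suc k) = +-cong (*-cong (P 0) (Q (suc k))) (⋆-cong (P ∘ suc) Q k)

  ⋆-distribʳ : ∀ r p q k → ((λ i → p i + q i) ⋆ r) k ≈ (p ⋆ r) k + (q ⋆ r) k
  ⋆-distribʳ r p q zero    = distribʳ _ _ _
  ⋆-distribʳ r p q (suc k) = trans (+-congˡ (⋆-distribʳ r (p ∘ suc) (q ∘ suc) k))
    (solve 5 (λ p q r x y → (p :+ q) :* r :+ (x :+ y) := (p :* r :+ x) :+ (q :* r :+ y)) refl (p 0) (q 0) (r (suc k)) _ _)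

  ⋆-scale : ∀ a p q k → ((λ i → a * p i) ⋆ q) k ≈ a * (p ⋆ q) k
  ⋆-scale a p q zero    = *-assoc _ _ _
  ⋆-scale a p q (suc k) = trans (+-congˡ (⋆-scale a (p ∘ suc) q k))
    (solve 4 (λ a p q x → a :* p :* q :+ a :* x := a :* (p :* q :+ x)) refl a (p 0) (q (suc k)) _)

  ⋆-zeroˡ : ∀ {p} q → (∀ i → p i ≈ 0#) → ∀ k → (p ⋆ q) k ≈ 0#
  ⋆-zeroˡ q P zero    = trans (*-congʳ (P 0)) (zeroˡ _)
  ⋆-zeroˡ q P (suc k) = trans (+-cong (trans (*-congʳ (P 0)) (zeroˡ _)) (⋆-zeroˡ q (P ∘ suc) k)) (+-identityʳ 0#)

  const-⋆ : ∀ a q k → (const a ⋆ q) k ≈ a * q k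
  const-⋆ a q zero    = refl
  const-⋆ a q (suc k) = trans (+-congˡ (⋆-zeroˡ q (λ _ → refl) k)) (+-identityʳ _)

  ⋆-suc : ∀ p q k → (p ⋆ q) (suc k) ≈ p (suc k) * q 0 + (p ⋆ (q ∘ suc)) k
  ⋆-suc p q zero    = +-comm _ _
  ⋆-suc p q (suc k) = trans (+-congˡ (⋆-suc (p ∘ suc) q k))
    (solve 3 (λ x y z → x :+ (y :+ z) := y :+ (x :+ z)) refl _ _ _)

  ⋆-comm : ∀ p q k → (p ⋆ q) k ≈ (q ⋆ p) k
  ⋆-comm p q zero    = *-comm _ _
  ⋆-comm p q (suc k) = trans (+-cong (*-comm _ _) (⋆-comm (p ∘ suc) q k)) (sym (⋆-suc q p k))

  ⋆-assoc : ∀ p q r k → ((p ⋆ q) ⋆ r) k ≈ (p ⋆ (q ⋆ r)) k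
  ⋆-assoc p q r zero    = *-assoc _ _ _
  ⋆-assoc p q r (suc k) = begin
    p 0 * q 0 * r (suc k) + ((λ i → p 0 * q (suc i) + ((p ∘ suc) ⋆ q) i) ⋆ r) k
      ≈⟨ +-congˡ (trans (⋆-distribʳ r (λ i → p 0 * q (suc i)) ((p ∘ suc) ⋆ q) k) (+-cong (⋆-scale (p 0) (q ∘ suc) r k) (⋆-assoc (p ∘ suc) q r k))) ⟩
    p 0 * q 0 * r (suc k) + (p 0 * ((q ∘ suc) ⋆ r) k + ((p ∘ suc) ⋆ (q ⋆ r)) k)
      ≈⟨ solve 5 (λ p q r x y → p :* q :* r :+ (p :* x :+ y) := p :* (q :* r :+ x) :+ y) refl (p 0) (q 0) (r (suc k)) _ _ ⟩
    p 0 * (q 0 * r (suc k) + ((q ∘ suc) ⋆ r) k) + ((p ∘ suc) ⋆ (q ⋆ r)) k ∎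

  seriesRing : CommutativeRing c ℓ
  seriesRing = record
    { Carrier = Series
    ; _≈_ = λ p q → ∀ i → p i ≈ q i
    ; _+_ = λ p q i → p i + q i
    ; _*_ = _⋆_
    ; -_ = λ p i → - p i
    ; 0# = λ _ → 0#
    ; 1# = const 1#
    ; isCommutativeRing = record
      { isRing = record
        { +-isAbelianGroup = record
          { isGroup = record
            { isMonoid = record
              { isSemigroup = record
                { isMagma = record
                  { isEquivalence = record { refl = λ _ → refl ; sym = λ p i → sym (p i) ; trans = λ p q i → trans (p i) (q i) }
                  ; ∙-cong = λ p q i → +-cong (p i) (q i) }
                ; assoc = λ p q r i → +-assoc _ _ _ }
              ; identity = (λ p i → +-identityˡ _) , (λ p i → +-identityʳ _) }
            ; inverse = (λ p i → -‿inverseˡ _) , (λ p i → -‿inverseʳ _)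
            ; ⁻¹-cong = λ p i → -‿cong (p i) }
          ; comm = λ p q i → +-comm _ _ }
        ; *-cong = ⋆-cong
        ; *-assoc = ⋆-assoc
        ; *-identity = one , (λ p i → trans (⋆-comm p (const 1#) i) (one p i))
        ; distrib = (λ p q r k → trans (⋆-comm p _ k) (trans (⋆-distribʳ p q r k) (+-cong (⋆-comm q p k) (⋆-comm r p k))))
                  , ⋆-distribʳ }
      ; *-comm = ⋆-comm } }
    where
    one : ∀ p i → (const 1# ⋆ p) i ≈ p i
    one p i = trans (const-⋆ 1# p i) (*-identityˡ _)

  -- A formal leading coefficient: `t` may be zero, so degrees of products and differences are
  -- bounded without deciding where a series stops.
  HasTop : ℕ → Series → Carrier → Set ℓ
  HasTop n p t = p n ≈ t × (∀ i → n ℕ.< i → p i ≈ 0#)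

  top-⋆ : ∀ m {n p q s t} → HasTop m p s → HasTop n q t → HasTop (m ℕ.+ n) (p ⋆ q) (s * t)
  top-⋆ zero {n} {p} {q} {s} (ps , p>) (qt , q>) =
    trans (only n) (*-cong ps qt) , λ i n<i → trans (only i) (trans (*-congˡ (q> i n<i)) (zeroʳ _))
    where
    only : ∀ i → (p ⋆ q) i ≈ p 0 * q i
    only zero = refl
    only (suc i) = trans (+-congˡ (⋆-zeroˡ q (λ j → p> (suc j) (s≤s z≤n)) i)) (+-identityʳ _)
  top-⋆ (suc m) {n} {p} {q} (ps , p>) Q@(_ , q>) =
    trans (+-cong (high (m ℕ.+ n) (ℕ.m≤n+m n m)) (proj₁ rec)) (+-identityˡ _) ,
    λ { (suc i) (s≤s m+n<i) → trans (+-cong (high i (ℕ.≤-trans (ℕ.m≤n+m n m) (ℕ.<⇒≤ m+n<i))) (proj₂ rec i m+n<i)) (+-identityʳ 0#) }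
    where
    rec = top-⋆ m {p = p ∘ suc} {q} (ps , λ i m<i → p> (suc i) (s≤s m<i)) Q
    high : ∀ i → n ℕ.≤ i → p 0 * q (suc i) ≈ 0#
    high i n≤i = trans (*-congˡ (q> (suc i) (s≤s n≤i))) (zeroʳ _)

  -- Orders are only bounded from below, since the first nonzero coefficient of a series cannot be
  -- located.
  ⋆-low : ∀ a {b p q} → (∀ i → i ℕ.< a → p i ≈ 0#) → (∀ i → i ℕ.< b → q i ≈ 0#) → (p ⋆ q) (a ℕ.+ b) ≈ p a * q b
  ⋆-low zero {b} {p} {q} _ Q = trans (⋆-comm p q b) (trans (rec b q Q) (*-comm _ _))
    where
    rec : ∀ b q → (∀ i → i ℕ.< b → q i ≈ 0#) → (q ⋆ p) b ≈ q b * p 0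
    rec zero    q Q = refl
    rec (suc b) q Q = trans (+-cong (trans (*-congʳ (Q 0 (s≤s z≤n))) (zeroˡ _)) (rec b (q ∘ suc) (λ i i<b → Q (suc i) (s≤s i<b)))) (+-identityˡ _)
  ⋆-low (suc a) {b} {p} {q} P Q =
    trans (+-cong (trans (*-congʳ (P 0 (s≤s z≤n))) (zeroˡ _)) (⋆-low a {p = p ∘ suc} (λ i i<a → P (suc i) (s≤s i<a)) Q)) (+-identityˡ _)

-- Uniqueness of roots of power series

module PrimeBinomial where
  open import Data.Nat.Combinatorics using (_C_; nCk≡n!/k![n-k]!; k![n∸k]!∣n!)

  prime∤! : ∀ {p} → Prime p → ∀ k → k ℕ.< p → ¬ (p ∣ k !)
  prime∤! {p} pp zero _ p∣1 = contradiction (∣⇒≤ p∣1) (ℕ.<⇒≱ (ℕ.nonTrivial⇒n>1 p {{prime⇒nonTrivial pp}}))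
  prime∤! pp (suc k) k<p p∣ with euclidsLemma (suc k) (k !) pp p∣
  ... | inj₁ p∣1+k = contradiction (∣⇒≤ p∣1+k) (ℕ.<⇒≱ k<p)
  ... | inj₂ p∣k!  = prime∤! pp k (ℕ.<-trans ℕ.≤-refl k<p) p∣k!

  prime∣C : ∀ {p} → Prime p → ∀ {k} → 0 ℕ.< k → k ℕ.< p → p ∣ p C k
  prime∣C {p} pp {k} 0<k k<p with euclidsLemma (p C k) (k ! ℕ.* (p ℕ.∸ k) !) pp (≡.subst (p ∣_) p!≡ (p∣p! p pp))
    where
    instance _ = (ℕ.m*n≢0 (k !) ((p ℕ.∸ k) !) {{k ℕ.!≢0}} {{(p ℕ.∸ k) ℕ.!≢0}})
    p!≡ : p ! ≡ (p C k) ℕ.* (k ! ℕ.* (p ℕ.∸ k) !)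
    p!≡ = ≡.sym (≡.trans (≡.cong (ℕ._* (k ! ℕ.* (p ℕ.∸ k) !)) (nCk≡n!/k![n-k]! (ℕ.<⇒≤ k<p))) (m/n*n≡m (k![n∸k]!∣n! (ℕ.<⇒≤ k<p))))
    p∣p! : ∀ p → Prime p → p ∣ p !
    p∣p! zero pp = contradiction ≡.refl (ℕ.≢-nonZero⁻¹ 0 {{prime⇒nonZero pp}})
    p∣p! (suc p) _ = divides (p !) (ℕ.*-comm (suc p) (p !))
  ... | inj₁ p∣C = p∣C
  ... | inj₂ p∣k![p-k]! with euclidsLemma (k !) ((p ℕ.∸ k) !) pp p∣k![p-k]!
  ...   | inj₁ p∣k! = contradiction p∣k! (prime∤! pp k k<p)
  ...   | inj₂ p∣[p-k]! = contradiction p∣[p-k]! (prime∤! pp (p ℕ.∸ k) (ℕ.∸-monoʳ-< 0<k (ℕ.<⇒≤ k<p)))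

-- The field axioms make square-zero elements vanish only up to double negation, so genuine
-- vanishing is carried as data. It is asked of a subring because it will be available for elements
-- of K.
record ReducedSubring {c ℓ} (A : CommutativeRing c ℓ) (S : CommutativeRing.Carrier A → Set ℓ) : Set (c ⊔ ℓ) where
  open CommutativeRing A
  field
    S-resp  : ∀ {x y} → x ≈ y → S x → S y
    S-0     : S 0#
    S-1     : S 1#
    S-+     : ∀ {x y} → S x → S y → S (x + y)
    S-*     : ∀ {x y} → S x → S y → S (x * y)
    S-neg   : ∀ {x} → S x → S (- x)
    reduced : ∀ {x} → S x → x * x ≈ 0# → x ≈ 0#

module Roots {c ℓ} {A : CommutativeRing c ℓ} {S} (RS : ReducedSubring A S) where
  open ReducedSubring RS
  open CommutativeRing A hiding (zero)
  open import Algebra.Properties.Semiring.Mult semiring using () renaming (_×_ to _×ₙ_)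
  open import Algebra.Properties.Semiring.Exp semiring using (_^_)
  open RingSolver A
  open import Relation.Binary.Reasoning.Setoid setoid

  S-×ₙ : ∀ n {x} → S x → S (n ×ₙ x)
  S-×ₙ zero    s = S-0
  S-×ₙ (suc n) s = S-+ s (S-×ₙ n s)

  S-^ : ∀ n {x} → S x → S (x ^ n)
  S-^ zero    s = S-1
  S-^ (suc n) s = S-* s (S-^ n s)

  nilpotent⇒0 : ∀ n {x} → S x → x ^ suc n ≈ 0# → x ≈ 0#
  nilpotent⇒0 zero    {x} s p = trans (sym (*-identityʳ x)) p
  nilpotent⇒0 (suc n) {x} s p = nilpotent⇒0 n s (reduced (S-^ (suc n) s) (begin
    (x * x ^ n) * (x * x ^ n)  ≈⟨ solve 2 (λ x y → (x :* y) :* (x :* y) := (x :* (x :* y)) :* y) refl x (x ^ n) ⟩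
    (x * (x * x ^ n)) * x ^ n  ≈⟨ *-congʳ p ⟩
    0# * x ^ n                 ≈⟨ zeroˡ _ ⟩
    0#                         ∎))

  geometric : Carrier → Carrier → ℕ → Carrier
  geometric a b zero    = 0#
  geometric a b (suc n) = a ^ n + b * geometric a b n

  geometric-sum : ∀ a b n → a ^ n - b ^ n ≈ (a - b) * geometric a b n
  geometric-sum a b zero = trans (-‿inverseʳ 1#) (sym (zeroʳ _))
  geometric-sum a b (suc n) = begin
    a * a ^ n - b * b ^ n
      ≈⟨ solve 4 (λ a b x y → a :* x :- b :* y := (a :- b) :* x :+ b :* (x :- y)) refl a b (a ^ n) (b ^ n) ⟩
    (a - b) * a ^ n + b * (a ^ n - b ^ n)
      ≈⟨ +-congˡ (*-congˡ (geometric-sum a b n)) ⟩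
    (a - b) * a ^ n + b * ((a - b) * geometric a b n)
      ≈⟨ solve 4 (λ a b x y → (a :- b) :* x :+ b :* ((a :- b) :* y) := (a :- b) :* (x :+ b :* y)) refl a b _ _ ⟩
    (a - b) * (a ^ n + b * geometric a b n) ∎

module Frobenius {c ℓ} (A : CommutativeRing c ℓ) where
  open PrimeBinomial
  open import Data.Nat.Combinatorics using (_C_; nCn≡1)
  open CommutativeRing A hiding (zero)
  open import Algebra.Properties.Semiring.Mult semiring using (×-assoc-*; ×-congʳ; ×-assocˡ; ×-homo-1) renaming (_×_ to _×ₙ_)
  open import Algebra.Properties.Semiring.Exp semiring using (_^_)
  open import Algebra.Properties.Semiring.Sum semiring using (sum; sum-cong-≋; sum-init-last; sum-replicate-zero)
  open import Algebra.Properties.CommutativeSemiring.Binomial commutativeSemiring using (theorem; binomialTerm)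
  open import Relation.Binary.Reasoning.Setoid setoid

  n×0≈0 : ∀ n → n ×ₙ 0# ≈ 0#
  n×0≈0 zero = refl
  n×0≈0 (suc n) = trans (+-identityˡ _) (n×0≈0 n)

  -- Every middle term of the binomial expansion contains both `d` and a binomial coefficient
  -- divisible by the prime. Hence it is enough that the prime annihilates `d`; the characteristic
  -- of the ring is left open.
  frobenius : ∀ {p} → Prime p → ∀ {d} → p ×ₙ d ≈ 0# → ∀ q → (d + q) ^ p ≈ q ^ p + d ^ p
  frobenius {zero} pp = contradiction ≡.refl (ℕ.≢-nonZero⁻¹ 0 {{prime⇒nonZero pp}})
  frobenius {suc p} pp {d} pd≈0 q = begin
    (d + q) ^ suc p
      ≈⟨ theorem (suc p) d q ⟩
    term zero + sum (term ∘ suc)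
      ≈⟨ +-cong first (sum-init-last (term ∘ suc)) ⟩
    q ^ suc p + (sum (λ i → term (suc (inject₁ i))) + term (fromℕ (suc p)))
      ≈⟨ +-congˡ (+-cong (trans (sum-cong-≋ middle) (sum-replicate-zero p)) last) ⟩
    q ^ suc p + (0# + d ^ suc p)
      ≈⟨ +-congˡ (+-identityˡ _) ⟩
    q ^ suc p + d ^ suc p ∎
    where
    term = binomialTerm d q (suc p)
    first : term zero ≈ q ^ suc p
    first = trans (×-homo-1 _) (*-identityˡ _)
    last : term (fromℕ (suc p)) ≈ d ^ suc p
    last rewrite Fin.toℕ-fromℕ p | nCn≡1 (suc p) | ℕ.n∸n≡0 p = trans (×-homo-1 _) (*-identityʳ _)
    vanish : ∀ {n} → suc p ∣ n → ∀ x → n ×ₙ (d * x) ≈ 0#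
    vanish (divides k ≡.refl) x = begin
      (k ℕ.* suc p) ×ₙ (d * x)    ≈⟨ ×-assoc-* (k ℕ.* suc p) d x ⟨
      ((k ℕ.* suc p) ×ₙ d) * x    ≈⟨ *-congʳ (×-assocˡ d k (suc p)) ⟨
      (k ×ₙ (suc p ×ₙ d)) * x     ≈⟨ *-congʳ (trans (×-congʳ k pd≈0) (n×0≈0 k)) ⟩
      0# * x                      ≈⟨ zeroˡ x ⟩
      0#                          ∎
    middle : ∀ i → term (suc (inject₁ i)) ≈ 0#
    middle i = trans (×-congʳ (suc p C suc k) (*-assoc d (d ^ k) _))
                     (vanish (prime∣C pp (s≤s z≤n) (s≤s (≡.subst (ℕ._< p) (≡.sym (Fin.toℕ-inject₁ i)) (Fin.toℕ<n i)))) _)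
      where k = toℕ (inject₁ i)

module SeriesRoots {c ℓ} {A : CommutativeRing c ℓ} {S} (RS : ReducedSubring A S) where
  open ReducedSubring RS
  open CommutativeRing A hiding (zero)
  open PowerSeries A
  open RingSolver A
  open import Algebra.Properties.Semiring.Mult semiring using (×-assoc-*; ×-congʳ) renaming (_×_ to _×ₙ_)
  open import Relation.Binary.Reasoning.Setoid setoid
  open import Algebra.Properties.AbelianGroup +-abelianGroup using (x∙y⁻¹≈ε⇒x≈y; x≈y⇒x∙y⁻¹≈ε)
  private
    module P = CommutativeRing seriesRing
    module R = Roots RS
  open import Algebra.Properties.Semiring.Exp P.semiring using (_^_; ^-assocʳ; ^-congˡ)
  open import Algebra.Properties.Semiring.Mult P.semiring using () renaming (_×_ to _×ₛ_)

  ⋆-S : ∀ {p q} → (∀ i → S (p i)) → (∀ i → S (q i)) → ∀ k → S ((p ⋆ q) k)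
  ⋆-S P Q zero    = S-* (P 0) (Q 0)
  ⋆-S P Q (suc k) = S-+ (S-* (P 0) (Q (suc k))) (⋆-S (P ∘ suc) Q k)

  seriesReduced : ReducedSubring seriesRing (λ p → ∀ i → S (p i))
  seriesReduced = record
    { S-resp = λ p s i → S-resp (p i) (s i)
    ; S-0 = λ _ → S-0
    ; S-1 = λ { zero → S-1 ; (suc _) → S-0 }
    ; S-+ = λ s t i → S-+ (s i) (t i)
    ; S-* = ⋆-S
    ; S-neg = λ s i → S-neg (s i)
    -- Once the coefficients below k vanish, coefficient 2k of the square is the square of
    -- coefficient k.
    ; reduced = λ {x} s x²≈0 → <-rec (λ k → x k ≈ 0#) (λ k below → reduced (s k)
        (trans (sym (⋆-low k {p = x} {q = x} (λ i i<k → below i<k) (λ i i<k → below i<k))) (x²≈0 (k ℕ.+ k)))) }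

  private
    module Q = Roots seriesReduced

  ×ₛ-coefficient : ∀ n p i → (n ×ₛ p) i ≈ n ×ₙ p i
  ×ₛ-coefficient zero    p i = refl
  ×ₛ-coefficient (suc n) p i = +-congˡ (×ₛ-coefficient n p i)

  ^-head : ∀ {p} → p 0 ≈ 1# → ∀ n → (p ^ n) 0 ≈ 1#
  ^-head p0 zero    = refl
  ^-head p0 (suc n) = trans (*-cong p0 (^-head p0 n)) (*-identityˡ 1#)

  geometric-head : ∀ {p q} → p 0 ≈ 1# → q 0 ≈ 1# → ∀ n → Q.geometric p q n 0 ≈ n ×ₙ 1#
  geometric-head p0 q0 zero    = refl
  geometric-head p0 q0 (suc n) = +-cong (^-head p0 n) (trans (*-cong q0 (geometric-head p0 q0 n)) (*-identityˡ _))

  -- The characteristic cannot be decided, so one argument must serve all cases. The constant term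
  -- of `U` is `m`, and `δ ⋆ U = 0` therefore shows that `m` annihilates `δ`; then `frobenius` turns
  -- the equality of m-th powers into `δ ^ m = 0`, and reducedness concludes.
  prime-root : ∀ {m} → Prime m → ∀ {p q} → (∀ i → S (p i)) → (∀ i → S (q i)) → p 0 ≈ 1# → q 0 ≈ 1# →
               p ^ m P.≈ q ^ m → p P.≈ q
  prime-root {zero} pm = contradiction ≡.refl (ℕ.≢-nonZero⁻¹ 0 {{prime⇒nonZero pm}})
  prime-root {m@(suc m′)} pm {p} {q} Sp Sq p0 q0 pᵐ≈qᵐ i = x∙y⁻¹≈ε⇒x≈y _ _ (Q.nilpotent⇒0 m′ Sδ δᵐ≈0 i)
    where
    δ = p P.- q
    Sδ : ∀ i → S (δ i)
    Sδ i = S-+ (Sp i) (S-neg (Sq i))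
    U = Q.geometric p q m

    δU≈0 : δ ⋆ U P.≈ P.0#
    δU≈0 = P.trans (P.sym (Q.geometric-sum p q m)) (λ i → x≈y⇒x∙y⁻¹≈ε (pᵐ≈qᵐ i))

    -- Multiplication by `m` makes the coefficients below k vanish by induction, so this product is
    -- the lowest coefficient of `m δ` times `U`.
    mδ⋆U : ∀ k → (∀ {i} → i ℕ.< k → m ×ₙ δ i ≈ 0#) → (m ×ₙ δ k) * (m ×ₙ 1#) ≈ 0#
    mδ⋆U k below = begin
      (m ×ₙ δ k) * (m ×ₙ 1#)                 ≈⟨ *-congˡ (geometric-head p0 q0 m) ⟨
      (m ×ₙ δ k) * U 0                       ≈⟨ ⋆-low k {b = 0} {p = λ i → m ×ₙ δ i} {q = U} (λ i i<k → below i<k) (λ _ ()) ⟨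
      ((λ i → m ×ₙ δ i) ⋆ U) (k ℕ.+ 0)       ≈⟨ ⋆-cong (λ i → ×-as-* (δ i)) (λ _ → refl) (k ℕ.+ 0) ⟩
      ((λ i → (m ×ₙ 1#) * δ i) ⋆ U) (k ℕ.+ 0) ≈⟨ ⋆-scale (m ×ₙ 1#) δ U (k ℕ.+ 0) ⟩
      (m ×ₙ 1#) * (δ ⋆ U) (k ℕ.+ 0)          ≈⟨ trans (*-congˡ (δU≈0 (k ℕ.+ 0))) (zeroʳ _) ⟩
      0#                                     ∎
      where
      ×-as-* : ∀ x → m ×ₙ x ≈ (m ×ₙ 1#) * x
      ×-as-* x = sym (trans (×-assoc-* m 1# x) (×-congʳ m (*-identityˡ x)))

    mδ≈0 : ∀ k → m ×ₙ δ k ≈ 0#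
    -- The square of `m δ k` contains the vanishing product above as a factor.
    mδ≈0 k = <-rec (λ k → m ×ₙ δ k ≈ 0#) (λ k below → reduced (R.S-×ₙ m (Sδ k)) (begin
      (m ×ₙ δ k) * (m ×ₙ δ k)           ≈⟨ *-congˡ (trans (×-congʳ m (sym (*-identityˡ (δ k)))) (sym (×-assoc-* m 1# (δ k)))) ⟩
      (m ×ₙ δ k) * ((m ×ₙ 1#) * δ k)    ≈⟨ *-assoc _ _ _ ⟨
      ((m ×ₙ δ k) * (m ×ₙ 1#)) * δ k    ≈⟨ trans (*-congʳ (mδ⋆U k below)) (zeroˡ _) ⟩
      0#                                ∎)) k

    δᵐ≈0 : δ ^ m P.≈ P.0#
    δᵐ≈0 i = begin
      (δ ^ m) i                          ≈⟨ solve 2 (λ x y → x := (y :+ x) :- y) refl _ _ ⟩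
      ((q ^ m) i + (δ ^ m) i) - (q ^ m) i ≈⟨ +-congʳ (F.frobenius pm (λ i → trans (×ₛ-coefficient m δ i) (mδ≈0 i)) q i) ⟨
      ((δ P.+ q) ^ m) i - (q ^ m) i      ≈⟨ +-congʳ (^-congˡ m (λ i → solve 2 (λ p q → (p :- q) :+ q := p) refl (p i) (q i)) i) ⟩
      (p ^ m) i - (q ^ m) i              ≈⟨ x≈y⇒x∙y⁻¹≈ε (pᵐ≈qᵐ i) ⟩
      0#                                 ∎
      where module F = Frobenius seriesRing

  -- Roots are taken one prime at a time, because the binomial argument needs a prime exponent. The
  -- intermediate powers keep their coefficients in the subring and their constant term 1.
  root-unique : ∀ n .{{_ : ℕ.NonZero n}} {p q} → (∀ i → S (p i)) → (∀ i → S (q i)) → p 0 ≈ 1# → q 0 ≈ 1# →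
                p ^ n P.≈ q ^ n → p P.≈ q
  root-unique n {p} {q} Sp Sq p0 q0 pⁿ≈qⁿ =
    rec (factors) factorsPrime (≡.subst (λ n → p ^ n P.≈ q ^ n) isFactorisation pⁿ≈qⁿ)
    where
    open PrimeFactorisation (factorise n)
    rec : ∀ ms → ListAll.All Prime ms → p ^ product ms P.≈ q ^ product ms → p P.≈ q
    rec [] [] eq = P.trans (P.sym (P.*-identityʳ p)) (P.trans eq (P.*-identityʳ q))
    rec (m ∷ ms) (pm ∷ pms) eq = rec ms pms
      (prime-root pm (Q.S-^ (product ms) Sp) (Q.S-^ (product ms) Sq) (^-head p0 (product ms)) (^-head q0 (product ms))
        (P.trans (^-assocʳ p (product ms) m) (P.trans (P.reflexive (≡.cong (p ^_) (ℕ.*-comm (product ms) m)))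
          (P.trans eq (P.trans (P.reflexive (≡.cong (q ^_) (ℕ.*-comm m (product ms)))) (P.sym (^-assocʳ q (product ms) m)))))))

-- Spans and independence, with double negation shifted over finite index sets

¬¬-∀ : ∀ {p} {n} {P : Fin n → Set p} → (∀ i → ¬ ¬ P i) → ¬ ¬ (∀ i → P i)
¬¬-∀ {n = zero}  _ k = k (λ ())
¬¬-∀ {n = suc n} h k = h zero (λ p₀ → ¬¬-∀ (h ∘ suc) (λ ps → k (λ { zero → p₀ ; (suc i) → ps i })))

module Spans {c ℓ} (A : CommutativeRing c ℓ) where
  open CommutativeRing A hiding (zero)
  open Vectors A
  open Alternating A
  open RingSolver A
  open import Algebra.Properties.Ring ring using (-1*x≈-x)
  open import Relation.Binary.Reasoning.Setoid setoid

  record IsSemilinear {D E} (τ : Carrier → Carrier) (t : V D → V E) : Set (c ⊔ ℓ) where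
    field
      ⟨cong⟩ : ∀ {v w} → v ≋ w → t v ≋ t w
      ⟨+⟩    : ∀ v w → t (v ⊞ w) ≋ t v ⊞ t w
      ⟨*⟩    : ∀ a v → t (a ⊡ v) ≋ τ a ⊡ t v

  linear⇒semilinear : ∀ {D E} {t : V D → V E} → IsLinear t → IsSemilinear id t
  linear⇒semilinear T = record { ⟨cong⟩ = ⟨cong⟩ ; ⟨+⟩ = ⟨+⟩ ; ⟨*⟩ = ⟨*⟩ }
    where open IsLinear T

  semilinear-𝟎 : ∀ {D E τ} {t : V D → V E} → IsSemilinear τ t → t 𝟎 ≋ 𝟎
  semilinear-𝟎 {t = t} T i = begin
    t 𝟎 i                       ≈⟨ solve 1 (λ x → x := (x :+ x) :- x) refl (t 𝟎 i) ⟩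
    (t 𝟎 i + t 𝟎 i) - t 𝟎 i     ≈⟨ +-congʳ (⟨+⟩ 𝟎 𝟎 i) ⟨
    t (𝟎 ⊞ 𝟎) i - t 𝟎 i         ≈⟨ +-congʳ (⟨cong⟩ (λ _ → +-identityʳ 0#) i) ⟩
    t 𝟎 i - t 𝟎 i               ≈⟨ -‿inverseʳ _ ⟩
    0#                          ∎
    where open IsSemilinear T

  comb : ∀ {m D} → V m → Vec (V D) m → V D
  comb α []       = 𝟎
  comb α (v ∷ vs) = α zero ⊡ v ⊞ comb (α ∘ suc) vs

  comb-linear : ∀ {m D} (vs : Vec (V D) m) → IsLinear (λ α → comb α vs)
  comb-linear [] = record { ⟨cong⟩ = λ _ _ → refl ; ⟨+⟩ = λ _ _ _ → sym (+-identityʳ 0#) ; ⟨*⟩ = λ a _ _ → sym (zeroʳ a) }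
  comb-linear (v ∷ vs) = record
    { ⟨cong⟩ = λ p i → +-cong (*-congʳ (p zero)) (⟨cong⟩ (p ∘ suc) i)
    ; ⟨+⟩ = λ α β i → trans (+-congˡ (⟨+⟩ (α ∘ suc) (β ∘ suc) i))
        (solve 5 (λ a b v x y → (a :+ b) :* v :+ (x :+ y) := (a :* v :+ x) :+ (b :* v :+ y)) refl (α zero) (β zero) (v i) _ _)
    ; ⟨*⟩ = λ a α i → trans (+-congˡ (⟨*⟩ a (α ∘ suc) i))
        (solve 4 (λ a b v x → (a :* b) :* v :+ a :* x := a :* (b :* v :+ x)) refl a (α zero) (v i) _) }
    where open IsLinear (comb-linear vs)

  record Span {m D} (vs : Vec (V D) m) (v : V D) : Set (c ⊔ ℓ) where
    constructor _,_
    field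
      coefficients : V m
      combination  : v ≋ comb coefficients vs

  open Span

  module _ {m D} {vs : Vec (V D) m} where
    private module C = IsLinear (comb-linear vs)

    span-≋ : ∀ {v w} → v ≋ w → Span vs v → Span vs w
    span-≋ v≋w (α , p) = α , λ i → trans (sym (v≋w i)) (p i)

    span-0 : Span vs 𝟎
    span-0 = 𝟎 , λ i → sym (C.⟨0⟩ i)

    span-+ : ∀ {v w} → Span vs v → Span vs w → Span vs (v ⊞ w)
    span-+ (α , p) (β , q) = (α ⊞ β) , λ i → trans (+-cong (p i) (q i)) (sym (C.⟨+⟩ α β i))

    span-* : ∀ {v} a → Span vs v → Span vs (a ⊡ v)
    span-* a (α , p) = (a ⊡ α) , λ i → trans (*-congˡ (p i)) (sym (C.⟨*⟩ a α i))

    span-head : ∀ v → Span (v ∷ vs) v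
    span-head v = (λ { zero → 1# ; (suc _) → 0# }) , λ i → trans
      (solve 1 (λ x → x := :1 :* x :+ :0) refl (v i)) (+-congˡ (sym (C.⟨0⟩ i)))

    span-tail : ∀ {v} w → Span vs v → Span (w ∷ vs) v
    span-tail w (α , p) = (λ { zero → 0# ; (suc i) → α i }) , λ i → trans (p i)
      (solve 2 (λ w x → x := :0 :* w :+ x) refl (w i) _)

  span-split : ∀ {m D} {vs : Vec (V D) m} {w v} → Span (w ∷ vs) v → ∃ λ a → ∃ λ u → Span vs u × v ≋ a ⊡ w ⊞ u
  span-split (α , p) = α zero , _ , (α ∘ suc , λ _ → refl) , p

  span-image : ∀ {m m′ D E τ} {vs : Vec (V D) m} {ws : Vec (V E) m′} {t : V D → V E} → IsSemilinear τ t →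
               Allᵥ (λ v → Span ws (t v)) vs → ∀ {v} → Span vs v → Span ws (t v)
  span-image {vs = []} {t = t} T [] {v} (α , p) =
    span-≋ (λ i → trans (sym (semilinear-𝟎 T i)) (sym (⟨cong⟩ p i))) span-0
    where open IsSemilinear T
  span-image {τ = τ} {vs = w ∷ vs} {t = t} T (h ∷ hs) s with span-split s
  ... | a , u , su , p = span-≋ (λ i → sym (trans (⟨cong⟩ p i) (trans (⟨+⟩ _ u i) (+-congʳ (⟨*⟩ a w i)))))
                                (span-+ (span-* (τ a) h) (span-image T hs su))
    where open IsSemilinear T

  span-trans : ∀ {m m′ D} {vs : Vec (V D) m} {ws : Vec (V D) m′} → Allᵥ (Span ws) vs → ∀ {v} → Span vs v → Span ws v
  span-trans = span-image (record { ⟨cong⟩ = id ; ⟨+⟩ = λ _ _ _ → refl ; ⟨*⟩ = λ _ _ _ → refl })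

  -- The coefficients of v₁, …, vₘ in the expansion of f along any coordinate do
  -- not depend on the coordinate.
  expand-span : ∀ {m D} (f : Form D m) (vs : Vec (V D) (suc m)) → Span vs (λ i → expand i f vs)
  expand-span {zero}  f (v ∷ []) = span-≋ (λ i → *-comm (f []) (v i)) (span-* (f []) (span-head v))
  expand-span {suc m} f (v ∷ vs) = span-≋ (λ i → +-cong (*-comm (f vs) (v i)) (-1*x≈-x _))
    (span-+ (span-* (f vs) (span-head v)) (span-* (- 1#) (span-tail v (expand-span (f ∘ (v ∷_)) vs))))

  -- Some alternating form does not vanish on vs; over a field with decidable
  -- equality this is linear independence.
  Independent : ∀ {m D} → Vec (V D) m → Set (c ⊔ ℓ)
  Independent vs = ¬ (∀ f → IsAlt f → ¬ ¬ (f vs ≈ 0#))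

  module _ (1≉0 : ¬ 1# ≈ 0#) where

    independent-[] : ∀ {D} → Independent {D = D} []
    independent-[] all = all (λ _ → 1#) [] 1≉0

    independent-det : ∀ {D} {vs : Vec (V D) D} → Independent vs → ¬ (det vs ≈ 0#)
    independent-det {vs = vs} ind p = ind (λ f F k → k (trans (alt-unique F vs) (trans (*-congʳ p) (zeroˡ _))))

    -- Writing the standard basis through m vectors pulls the determinant back to a form with D
    -- arguments in dimension m; this vanishes, although its value on the standard basis is 1.
    too-few-to-span : ∀ {m D} (vs : Vec (V D) m) → m ℕ.< D → ¬ (∀ i → Span vs (e i))
    too-few-to-span {D = D} vs m<D spans = 1≉0 (begin
      1#                                             ≈⟨ det-std D ⟨
      det (std D)                                    ≈⟨ reflexive (≡.cong (det {D}) (std-tabulate D)) ⟩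
      det (tabulate (e {D}))                            ≈⟨ alt-cong (det-alt {D}) (images e (coefficients ∘ spans) (combination ∘ spans)) ⟩
      det (map (λ α → comb α vs) (tabulate (coefficients ∘ spans))) ≈⟨ alt-vanishes (pullback (comb-linear vs) det-alt) m<D _ ⟩
      0#                                             ∎)
      where
      images : ∀ {k} (w : Fin k → V D) α → (∀ i → w i ≋ comb (α i) vs) →
               Pointwise _≋_ (tabulate w) (map (λ α → comb α vs) (tabulate α))
      images {zero}  w α p = []
      images {suc k} w α p = p zero ∷ images (w ∘ suc) (α ∘ suc) (p ∘ suc)

    module _ (inverse : ∀ x → ¬ (x ≈ 0#) → ∃ λ y → x * y ≈ 1#) where

      -- Cramer's rule: if `f vs` is invertible and every exterior product of `f` with a coordinate
      -- vanishes on `v ∷ vs`, then solving each of these equations for `v i` exhibits `v` as a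
      -- combination of `vs`.
      independent-∷ : ∀ {m D} {vs : Vec (V D) m} {v} → Independent vs → ¬ Span vs v → Independent (v ∷ vs)
      independent-∷ {vs = vs} {v} ind v∉ all = ind (λ f F f≉0 → ¬¬-∀ (λ i → all (expand i f) (expand-alt i F)) (λ zeros →
        v∉ (inSpan f (proj₁ (inverse _ f≉0)) (proj₂ (inverse _ f≉0)) zeros)))
        where
        inSpan : ∀ f y → f vs * y ≈ 1# → (∀ i → expand i f (v ∷ vs) ≈ 0#) → Span vs v
        inSpan f y fy≈1 zeros = span-≋ (λ i → eq i) (span-* y (rest f vs))
          where
          -- The part of the expansion in which the coordinate is taken from a vector of `vs`
          -- instead of `v`; it lies in the span of `vs`.
          others : ∀ {m D} → Form D m → V D → Vec (V D) m → V D
          others {zero}  f v [] _ = 0#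
          others {suc m} f v vs i = expand i (f ∘ (v ∷_)) vs
          rest : ∀ {m D} (f : Form D m) {v} vs → Span vs (others f v vs)
          rest f [] = span-0
          rest f vs@(_ ∷ _) = expand-span (f ∘ (_ ∷_)) vs
          expand-∷ : ∀ {m D} (f : Form D m) v vs i → expand i f (v ∷ vs) ≈ v i * f vs - others f v vs i
          expand-∷ f v [] i = solve 1 (λ x → x := x :- :0) refl _
          expand-∷ f v (_ ∷ _) i = refl
          eq : ∀ i → y * others f v vs i ≈ v i
          eq i = begin
            y * others f v vs i                            ≈⟨ solve 4 (λ y o v f → y :* o := v :* (f :* y) :- y :* (v :* f :- o)) refl y _ (v i) (f vs) ⟩
            v i * (f vs * y) - y * (v i * f vs - others f v vs i) ≈⟨ +-cong (*-congˡ fy≈1) (-‿cong (*-congˡ (trans (sym (expand-∷ f v vs i)) (zeros i)))) ⟩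
            v i * 1# - y * 0#                              ≈⟨ solve 2 (λ v y → v :* :1 :- y :* :0 := v) refl (v i) y ⟩
            v i                                            ∎

-- Ring homomorphisms, powers of σ and anisotropic norm forms

record IsHom {c ℓ c′ ℓ′} (A : CommutativeRing c ℓ) (B : CommutativeRing c′ ℓ′)
             (φ : CommutativeRing.Carrier A → CommutativeRing.Carrier B) : Set (c ⊔ ℓ ⊔ ℓ′) where
  private
    module A = CommutativeRing A
    module B = CommutativeRing B
  field
    ⟨cong⟩ : ∀ {a b} → a A.≈ b → φ a B.≈ φ b
    ⟨+⟩    : ∀ a b → φ (a A.+ b) B.≈ φ a B.+ φ b
    ⟨*⟩    : ∀ a b → φ (a A.* b) B.≈ φ a B.* φ b
    ⟨1⟩    : φ A.1# B.≈ B.1#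

  ⟨0⟩ : φ A.0# B.≈ B.0#
  ⟨0⟩ = B.trans (solve 1 (λ x → x := (x :+ x) :- x) B.refl (φ A.0#))
        (B.trans (B.+-congʳ (B.trans (B.sym (⟨+⟩ A.0# A.0#)) (⟨cong⟩ (A.+-identityʳ A.0#)))) (B.-‿inverseʳ _))
    where open RingSolver B

  ⟨-⟩ : ∀ a → φ (A.- a) B.≈ B.- φ a
  ⟨-⟩ a = B.trans (solve 2 (λ x y → y := (x :+ y) :- x) B.refl (φ a) (φ (A.- a)))
          (B.trans (B.+-congʳ (B.trans (B.sym (⟨+⟩ a (A.- a))) (B.trans (⟨cong⟩ (A.-‿inverseʳ a)) ⟨0⟩))) (B.+-identityˡ _))
    where open RingSolver B

module Galois {c ℓ} (S : CyclicSetup c ℓ) where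
  open CyclicSetup S hiding (zero)
  open Skew S using (normAux; Norm; InK)
  open RingSolver L
  open import Relation.Binary.Reasoning.Setoid setoid
  open import Algebra.Properties.AbelianGroup +-abelianGroup using (x∙y⁻¹≈ε⇒x≈y)

  σ-hom : IsHom L L σ
  σ-hom = record { ⟨cong⟩ = σ-cong ; ⟨+⟩ = σ-+ ; ⟨*⟩ = σ-* ; ⟨1⟩ = σ-1 }

  σ^ : ℕ → Carrier → Carrier
  σ^ k = iter k σ

  σ^-hom : ∀ k → IsHom L L (σ^ k)
  σ^-hom zero    = record { ⟨cong⟩ = id ; ⟨+⟩ = λ _ _ → refl ; ⟨*⟩ = λ _ _ → refl ; ⟨1⟩ = refl }
  σ^-hom (suc k) = record
    { ⟨cong⟩ = σ-cong ∘ H.⟨cong⟩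
    ; ⟨+⟩ = λ a b → trans (σ-cong (H.⟨+⟩ a b)) (σ-+ _ _)
    ; ⟨*⟩ = λ a b → trans (σ-cong (H.⟨*⟩ a b)) (σ-* _ _)
    ; ⟨1⟩ = trans (σ-cong H.⟨1⟩) σ-1 }
    where module H = IsHom (σ^-hom k)

  iter-comm : ∀ {a} {A : Set a} k (f : A → A) x → iter k f (f x) ≡ f (iter k f x)
  iter-comm zero    f x = ≡.refl
  iter-comm (suc k) f x = ≡.cong f (iter-comm k f x)

  iter-+ : ∀ {a} {A : Set a} j k (f : A → A) x → iter (j ℕ.+ k) f x ≡ iter j f (iter k f x)
  iter-+ zero    k f x = ≡.refl
  iter-+ (suc j) k f x = ≡.cong f (iter-+ j k f x)

  σ-0 : σ 0# ≈ 0#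
  σ-0 = IsHom.⟨0⟩ σ-hom

  σ-neg : ∀ a → σ (- a) ≈ - σ a
  σ-neg = IsHom.⟨-⟩ σ-hom

  *-unit-cancel : ∀ {u a} → ¬ (u ≈ 0#) → u * a ≈ 0# → a ≈ 0#
  *-unit-cancel {u} {a} u≉0 ua≈0 with inverse u u≉0
  ... | y , uy≈1 = begin
    a             ≈⟨ *-identityˡ a ⟨
    1# * a        ≈⟨ *-congʳ uy≈1 ⟨
    u * y * a     ≈⟨ solve 3 (λ u y a → u :* y :* a := y :* (u :* a)) refl u y a ⟩
    y * (u * a)   ≈⟨ trans (*-congˡ ua≈0) (zeroʳ y) ⟩
    0#            ∎

  normAux-cong : ∀ k {a b} → a ≈ b → normAux k a ≈ normAux k b
  normAux-cong zero    p = refl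
  normAux-cong (suc k) p = *-cong (IsHom.⟨cong⟩ (σ^-hom k) p) (normAux-cong k p)

  normAux-* : ∀ k a b → normAux k (a * b) ≈ normAux k a * normAux k b
  normAux-* zero    a b = sym (*-identityˡ 1#)
  normAux-* (suc k) a b = trans (*-cong (IsHom.⟨*⟩ (σ^-hom k) a b) (normAux-* k a b))
    (solve 4 (λ a b x y → (a :* b) :* (x :* y) := (a :* x) :* (b :* y)) refl _ _ _ _)

  normAux-1 : ∀ k → normAux k 1# ≈ 1#
  normAux-1 zero    = refl
  normAux-1 (suc k) = trans (*-cong (IsHom.⟨1⟩ (σ^-hom k)) (normAux-1 k)) (*-identityˡ 1#)

  normAux-suc : ∀ k a → normAux (suc k) a ≈ normAux k (σ a) * a
  normAux-suc zero    a = *-comm _ _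
  normAux-suc (suc k) a = trans (*-cong (reflexive (≡.sym (iter-comm k σ a))) (normAux-suc k a)) (sym (*-assoc _ _ _))

  σ-normAux : ∀ k a → σ (normAux k a) ≈ normAux k (σ a)
  σ-normAux zero    a = σ-1
  σ-normAux (suc k) a = trans (σ-* _ _) (*-cong (reflexive (≡.sym (iter-comm k σ a))) (σ-normAux k a))

  Norm-K : ∀ a → InK (Norm a)
  Norm-K a = trans (σ-normAux n a) (shift n (σ^n≈id a))
    where
    shift : ∀ k → iter k σ a ≈ a → normAux k (σ a) ≈ normAux k a
    shift zero    _ = refl
    shift (suc k) p = trans (*-congʳ (trans (reflexive (iter-comm k σ a)) p)) (trans (*-comm _ _) (sym (normAux-suc k a)))

  -- `w` is a factor of its own norm, the one belonging to the zeroth power of `σ`.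
  Norm-kills : ∀ {w z} → w * z ≈ 0# → Norm w * z ≈ 0#
  Norm-kills {w} {z} p with n | 2≤n
  ... | suc k | _ = trans (*-congʳ (normAux-suc k w)) (trans (*-assoc _ _ _) (trans (*-congˡ p) (zeroʳ _)))

  Norm-anisotropic : ∀ {w} → Norm w ≈ 0# → ¬ ¬ (w ≈ 0#)
  Norm-anisotropic {w} p w≉0 with inverse w w≉0
  ... | y , wy≈1 = 1≉0 (begin
    1#               ≈⟨ normAux-1 n ⟨
    Norm 1#          ≈⟨ normAux-cong n wy≈1 ⟨
    Norm (w * y)     ≈⟨ normAux-* n w y ⟩
    Norm w * Norm y  ≈⟨ *-congʳ p ⟩
    0# * Norm y      ≈⟨ zeroˡ _ ⟩
    0#               ∎)

  private
    θ = proj₁ (σ-order 1 (s≤s z≤n) 2≤n)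

  -- `θ` is moved by `σ`, so applying `σ` to `a + θ * b = 0` and subtracting isolates `b`. The norm
  -- of `a + θ * b` thus fuses two elements of K into one that vanishes only if, up to double
  -- negation, both do.
  form-anisotropic : ∀ {a b} → InK a → InK b → Norm (a + θ * b) ≈ 0# → ¬ ¬ (a ≈ 0# × b ≈ 0#)
  form-anisotropic {a} {b} a∈K b∈K p k = Norm-anisotropic p λ w≈0 →
    let b≈0 = *-unit-cancel (proj₂ (σ-order 1 (s≤s z≤n) 2≤n) ∘ x∙y⁻¹≈ε⇒x≈y _ _) (begin
          (σ θ - θ) * b                     ≈⟨ solve 4 (λ s t a b → (s :- t) :* b := (a :+ s :* b) :- (a :+ t :* b)) refl (σ θ) θ a b ⟩
          (a + σ θ * b) - (a + θ * b)       ≈⟨ +-congʳ (+-cong a∈K (*-congˡ b∈K)) ⟨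
          (σ a + σ θ * σ b) - (a + θ * b)   ≈⟨ +-congʳ (trans (σ-+ _ _) (+-congˡ (σ-* _ _))) ⟨
          σ (a + θ * b) - (a + θ * b)       ≈⟨ +-cong (trans (σ-cong w≈0) σ-0) (-‿cong w≈0) ⟩
          0# - 0#                           ≈⟨ -‿inverseʳ 0# ⟩
          0#                                ∎)
    in k ((begin
      a                     ≈⟨ solve 3 (λ a t b → a := (a :+ t :* b) :- t :* b) refl a θ b ⟩
      (a + θ * b) - θ * b   ≈⟨ +-cong w≈0 (-‿cong (trans (*-congˡ b≈0) (zeroʳ θ))) ⟩
      0# - 0#               ≈⟨ -‿inverseʳ 0# ⟩
      0#                    ∎) , b≈0)

  -- If not all φ i vanish then they generate the unit ideal, although no
  -- particular φ i need be known to be invertible.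
  record Certificate {i} {I : Set i} (φ : I → Carrier) : Set (c ⊔ ℓ ⊔ i) where
    field
      value       : Carrier
      rational    : InK value
      kills       : ∀ {z} → (∀ i → φ i * z ≈ 0#) → value * z ≈ 0#
      anisotropic : value ≈ 0# → ∀ i → ¬ ¬ (φ i ≈ 0#)

  open Certificate

  -- Folding with the binary form requires every intermediate value to lie in K, which is why a norm
  -- is taken at each stage.
  certificate-Fin : ∀ {N} (φ : Fin N → Carrier) → (∀ i → InK (φ i)) → Certificate φ
  certificate-Fin {zero} φ _ = record { value = 0# ; rational = σ-0 ; kills = λ _ → zeroˡ _ ; anisotropic = λ _ () }
  certificate-Fin {suc N} φ K = record
    { value = Norm (φ zero + θ * value rec)
    ; rational = Norm-K _
    ; kills = λ h → Norm-kills (trans (solve 4 (λ a t b z → (a :+ t :* b) :* z := a :* z :+ t :* (b :* z)) refl _ θ _ _)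
                (trans (+-cong (h zero) (trans (*-congˡ (kills rec (h ∘ suc))) (zeroʳ θ))) (+-identityʳ 0#)))
    ; anisotropic = λ p → λ
        { zero k → form-anisotropic (K zero) (rational rec) p (k ∘ proj₁)
        ; (suc i) k → form-anisotropic (K zero) (rational rec) p (λ q → anisotropic rec (proj₂ q) i k) } }
    where rec = certificate-Fin (φ ∘ suc) (K ∘ suc)

  -- Tuples are treated one coordinate at a time; at the bottom the norm moves an arbitrary value of
  -- `φ` into K.
  certificate : ∀ {N} r (φ : Vec (Fin N) r → Carrier) → Certificate φ
  certificate zero φ = record
    { value = Norm (φ [])
    ; rational = Norm-K _
    ; kills = λ h → Norm-kills (h [])
    ; anisotropic = λ { p [] → Norm-anisotropic p } }
  certificate (suc r) φ = record
    { value = value C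
    ; rational = rational C
    ; kills = λ h → kills C (λ i → kills (rec i) (λ is → h (i ∷ is)))
    ; anisotropic = λ { p (i ∷ is) k → anisotropic C p i (λ q → anisotropic (rec i) q is k) } }
    where
    rec : ∀ i → Certificate (φ ∘ (i ∷_))
    rec i = certificate r (φ ∘ (i ∷_))
    C = certificate-Fin (λ i → value (rec i)) (λ i → rational (rec i))

  -- The value of the certificate is nonzero, hence invertible. This recovers an equality although
  -- no index with nonzero `φ` is known.
  common-annihilator : ∀ {N} r (φ : Vec (Fin N) r → Carrier) → ¬ (∀ is → ¬ ¬ (φ is ≈ 0#)) →
                       ∀ {z} → (∀ is → φ is * z ≈ 0#) → z ≈ 0#
  common-annihilator r φ nonzero h = *-unit-cancel (nonzero ∘ anisotropic C) (kills C h)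
    where C = certificate r φ

-- Skew and commutative polynomials and their action on vectors

module Polynomials {c ℓ} (S : CyclicSetup c ℓ) where
  open CyclicSetup S hiding (zero)
  open Skew S using (Poly; coeff; _⊕_; mulWith; MonicDeg; lift) renaming (_≋_ to _≋ₚ_)
  open Galois S
  open Vectors L
  open Spans L
  open RingSolver L
  open import Relation.Binary.Reasoning.Setoid setoid

  VanishFrom : ℕ → Poly → Set ℓ
  VanishFrom k p = ∀ i → k ℕ.≤ i → coeff p i ≈ 0#

  coeff-⊕ : ∀ p q i → coeff (p ⊕ q) i ≈ coeff p i + coeff q i
  coeff-⊕ []      q       i       = sym (+-identityˡ _)
  coeff-⊕ (a ∷ p) []      i       = sym (+-identityʳ _)
  coeff-⊕ (a ∷ p) (b ∷ q) zero    = refl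
  coeff-⊕ (a ∷ p) (b ∷ q) (suc i) = coeff-⊕ p q i

  coeff-map : ∀ {f : Carrier → Carrier} → f 0# ≈ 0# → ∀ p i → coeff (mapₗ f p) i ≈ f (coeff p i)
  coeff-map f0 []      i       = sym f0
  coeff-map f0 (a ∷ p) zero    = refl
  coeff-map f0 (a ∷ p) (suc i) = coeff-map f0 p i

  coeff-scale : ∀ a p i → coeff (mapₗ (a *_) p) i ≈ a * coeff p i
  coeff-scale a = coeff-map (zeroʳ a)

  monomial : ℕ → Carrier → Poly
  monomial k a = replicate k 0# ++ₗ a ∷ []

  coeff-monomial : ∀ k a → coeff (monomial k a) k ≡ a
  coeff-monomial zero    a = ≡.refl
  coeff-monomial (suc k) a = coeff-monomial k a

  coeff-monomial-≢ : ∀ k a {i} → ¬ i ≡ k → coeff (monomial k a) i ≈ 0#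
  coeff-monomial-≢ zero    a {zero}  p = ⊥-elim (p ≡.refl)
  coeff-monomial-≢ zero    a {suc i} p = refl
  coeff-monomial-≢ (suc k) a {zero}  p = refl
  coeff-monomial-≢ (suc k) a {suc i} p = coeff-monomial-≢ k a (p ∘ ≡.cong suc)

  cancel-top : ∀ {k p a} → coeff p k + a ≈ 0# → (∀ i → k ℕ.< i → coeff p i ≈ 0#) → VanishFrom k (p ⊕ monomial k a)
  cancel-top {k} {p} {a} top above i k≤i with ℕ.m≤n⇒m<n∨m≡n k≤i
  ... | inj₁ k<i    = trans (coeff-⊕ p _ i) (trans (+-cong (above i k<i) (coeff-monomial-≢ k a (ℕ.<⇒≢ k<i ∘ ≡.sym))) (+-identityʳ 0#))
  ... | inj₂ ≡.refl = trans (coeff-⊕ p _ k) (trans (+-congˡ (reflexive (coeff-monomial k a))) top)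

  module _ (τ : Carrier → Carrier) where

    coeff-mul-zero : ∀ a p q → coeff (mulWith τ (a ∷ p) q) 0 ≈ a * coeff q 0
    coeff-mul-zero a p q = trans (coeff-⊕ (mapₗ (a *_) q) _ 0) (trans (+-identityʳ _) (coeff-scale a q 0))

    coeff-mul-suc : ∀ a p q i → coeff (mulWith τ (a ∷ p) q) (suc i) ≈ a * coeff q (suc i) + coeff (mulWith τ p (mapₗ τ q)) i
    coeff-mul-suc a p q i = trans (coeff-⊕ (mapₗ (a *_) q) _ (suc i)) (+-congʳ (coeff-scale a q (suc i)))

    mul-zeroˡ : ∀ p q → (∀ i → coeff p i ≈ 0#) → ∀ i → coeff (mulWith τ p q) i ≈ 0#
    mul-zeroˡ []      q z i = refl
    mul-zeroˡ (a ∷ p) q z zero = trans (coeff-mul-zero a p q) (trans (*-congʳ (z 0)) (zeroˡ _))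
    mul-zeroˡ (a ∷ p) q z (suc i) = trans (coeff-mul-suc a p q i)
      (trans (+-cong (trans (*-congʳ (z 0)) (zeroˡ _)) (mul-zeroˡ p _ (z ∘ suc) i)) (+-identityʳ 0#))

    module _ (τ-cong : ∀ {a b} → a ≈ b → τ a ≈ τ b) (τ-0 : τ 0# ≈ 0#) (τ-1 : τ 1# ≈ 1#) where

      monic-map : ∀ {f e} → MonicDeg f e → MonicDeg (mapₗ τ f) e
      monic-map {f} {e} (top , above) = trans (coeff-map τ-0 f e) (trans (τ-cong top) τ-1) ,
        λ i e<i → trans (coeff-map τ-0 f i) (trans (τ-cong (above i e<i)) τ-0)

      -- The constant coefficient of the left factor contributes nothing beyond degree `e`, so
      -- quotients can be shortened from the bottom.
      above-degree : ∀ {f e} → MonicDeg f e → ∀ a q {j} → e ℕ.≤ j →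
                     coeff (mulWith τ q (mapₗ τ f)) j ≈ coeff (mulWith τ (a ∷ q) f) (suc j)
      above-degree {f} (_ , above) a q {j} e≤j = sym (trans (coeff-mul-suc a q f j)
        (trans (+-congʳ (trans (*-congˡ (above (suc j) (s≤s e≤j))) (zeroʳ a))) (+-identityˡ _)))

      quotient-degree : ∀ k {f e} → MonicDeg f e → ∀ q → VanishFrom (e ℕ.+ k) (mulWith τ q f) → VanishFrom k q
      quotient-degree k M [] z i k≤i = refl
      quotient-degree (suc k) {f} {e} M (a ∷ q) z (suc i) (s≤s k≤i) =
        quotient-degree k (monic-map {f} M) q (λ j e+k≤j → trans (above-degree {f} M a q (ℕ.m+n≤o⇒m≤o e e+k≤j))
          (z (suc j) (ℕ.≤-trans (ℕ.≤-reflexive (ℕ.+-suc e k)) (s≤s e+k≤j)))) i k≤i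
      -- The tail must be known to vanish before `a` can be read off in degree `e`.
      quotient-degree zero {f} {e} M@(top , _) (a ∷ q) z =
        λ { zero _ → trans (sym (leading e top)) (z e (ℕ.≤-reflexive (ℕ.+-identityʳ e)))
          ; (suc i) _ → q≋0 i }
        where
        q≋0 : ∀ i → coeff q i ≈ 0#
        q≋0 i = quotient-degree zero (monic-map {f} M) q (λ j e+0≤j → trans (above-degree {f} M a q (ℕ.m+n≤o⇒m≤o e e+0≤j))
          (z (suc j) (ℕ.m≤n⇒m≤1+n e+0≤j))) i z≤n
        leading : ∀ e → coeff f e ≈ 1# → coeff (mulWith τ (a ∷ q) f) e ≈ a
        leading zero top = trans (coeff-mul-zero a q f) (trans (*-congˡ top) (*-identityʳ a))
        leading (suc e) top = trans (coeff-mul-suc a q f e)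
          (trans (+-cong (trans (*-congˡ top) (*-identityʳ a)) (mul-zeroˡ q _ q≋0 e)) (+-identityʳ a))

      -- `P` is a set of coefficients that the algorithm preserves: taken as K it keeps quotients
      -- and remainders over K, taken as everything it serves right division in R.
      record Division (P : Carrier → Set ℓ) (p f : Poly) (e : ℕ) : Set (c ⊔ ℓ) where
        field
          quotient  : Poly
          remainder : Poly
          division  : p ≋ₚ (mulWith τ quotient f ⊕ remainder)
          small     : VanishFrom e remainder
          quotient∈  : ∀ i → P (coeff quotient i)
          remainder∈ : ∀ i → P (coeff remainder i)

      module _ {P : Carrier → Set ℓ} (P-resp : ∀ {x y} → x ≈ y → P x → P y) (P-0 : P 0#) (P-τ : ∀ {x} → P x → P (τ x))
               (P-sub : ∀ {x y z} → P x → P y → P z → P (x - y * z)) where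

        -- With p = a + p' x and x f = τ(f) x, division of p' by τ(f) leaves a + r' x of degree at
        -- most `e`, and subtracting `lead` times the monic `f` removes the top. No coefficient is
        -- tested for zero.
        divide : ∀ p {f e} → MonicDeg f e → (∀ i → P (coeff p i)) → (∀ i → P (coeff f i)) → Division P p f e
        divide [] M Pp Pf = record
          { quotient = [] ; remainder = [] ; division = λ _ → refl ; small = λ _ _ → refl
          ; quotient∈ = λ _ → P-0 ; remainder∈ = λ _ → P-0 }
        divide (a ∷ p) {f} {e} M@(top , above) Pp Pf = record
          { quotient = lead ∷ D.quotient
          ; remainder = r
          ; division = λ
              { zero → begin
                  a
                    ≈⟨ solve 2 (λ a x → a := x :+ (a :- x)) refl a (lead * coeff f 0) ⟩
                  lead * coeff f 0 + (a - lead * coeff f 0)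
                    ≈⟨ +-cong (coeff-mul-zero lead D.quotient f) (coeff-r 0) ⟨
                  coeff (mulWith τ (lead ∷ D.quotient) f) 0 + coeff r 0
                    ≈⟨ coeff-⊕ (mulWith τ (lead ∷ D.quotient) f) r 0 ⟨
                  coeff (mulWith τ (lead ∷ D.quotient) f ⊕ r) 0 ∎
              ; (suc i) → begin
                  coeff p i
                    ≈⟨ trans (D.division i) (coeff-⊕ (mulWith τ D.quotient (mapₗ τ f)) D.remainder i) ⟩
                  coeff (mulWith τ D.quotient (mapₗ τ f)) i + coeff D.remainder i
                    ≈⟨ solve 3 (λ x r y → x :+ r := (y :+ x) :+ (r :- y)) refl _ _ (lead * coeff f (suc i)) ⟩
                  (lead * coeff f (suc i) + coeff (mulWith τ D.quotient (mapₗ τ f)) i) + (coeff D.remainder i - lead * coeff f (suc i))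
                    ≈⟨ +-cong (coeff-mul-suc lead D.quotient f i) (coeff-r (suc i)) ⟨
                  coeff (mulWith τ (lead ∷ D.quotient) f) (suc i) + coeff r (suc i)
                    ≈⟨ coeff-⊕ (mulWith τ (lead ∷ D.quotient) f) r (suc i) ⟨
                  coeff (mulWith τ (lead ∷ D.quotient) f ⊕ r) (suc i) ∎ }
          ; small = small
          ; quotient∈ = λ { zero → Pa∷r e ; (suc i) → D.quotient∈ i }
          ; remainder∈ = λ i → P-resp (sym (coeff-r i)) (P-sub (Pa∷r i) (Pa∷r e) (Pf i)) }
          where
          module D = Division (divide p {mapₗ τ f} {e} (monic-map {f} M) (Pp ∘ suc) (λ i → P-resp (sym (coeff-map τ-0 f i)) (P-τ (Pf i))))
          lead = coeff (a ∷ D.remainder) e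
          r = (a ∷ D.remainder) ⊕ mapₗ (λ x → - (lead * x)) f
          Pa∷r : ∀ i → P (coeff (a ∷ D.remainder) i)
          Pa∷r zero = Pp 0
          Pa∷r (suc i) = D.remainder∈ i
          coeff-r : ∀ i → coeff r i ≈ coeff (a ∷ D.remainder) i - lead * coeff f i
          coeff-r i = trans (coeff-⊕ (a ∷ D.remainder) (mapₗ (λ x → - (lead * x)) f) i)
            (+-congˡ (coeff-map {f = λ x → - (lead * x)} (solve 1 (λ x → :- (x :* :0) := :0) refl lead) f i))
          small : VanishFrom e r
          small i e≤i with ℕ.m≤n⇒m<n∨m≡n e≤i
          ... | inj₂ ≡.refl = trans (coeff-r i) (trans (+-congˡ (-‿cong (trans (*-congˡ top) (*-identityʳ _)))) (-‿inverseʳ _))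
          small (suc i) _ | inj₁ (s≤s e≤i) = trans (coeff-r (suc i))
            (trans (+-cong (D.small i e≤i) (-‿cong (trans (*-congˡ (above (suc i) (s≤s e≤i))) (zeroʳ _)))) (-‿inverseʳ 0#))

  ev : ∀ {D} → (V D → V D) → Poly → V D → V D
  ev X []      v = 𝟎
  ev X (a ∷ p) v = a ⊡ v ⊞ ev X p (X v)

  module Eval {D τ} {X : V D → V D} (XS : IsSemilinear τ X) where
    private module X = IsSemilinear XS

    ev-cong : ∀ p {v w} → v ≋ w → ev X p v ≋ ev X p w
    ev-cong []      q i = refl
    ev-cong (a ∷ p) q i = +-cong (*-congˡ (q i)) (ev-cong p (X.⟨cong⟩ q) i)

    ev-zero : ∀ p {v} → (∀ i → coeff p i ≈ 0#) → ev X p v ≋ 𝟎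
    ev-zero []      z i = refl
    ev-zero (a ∷ p) z i = trans (+-cong (trans (*-congʳ (z 0)) (zeroˡ _)) (ev-zero p (z ∘ suc) i)) (+-identityʳ 0#)

    ev-≋ : ∀ p q {v} → p ≋ₚ q → ev X p v ≋ ev X q v
    ev-≋ []      q       h i = sym (ev-zero q (λ j → sym (h j)) i)
    ev-≋ (a ∷ p) []      h i = ev-zero (a ∷ p) h i
    ev-≋ (a ∷ p) (b ∷ q) h i = +-cong (*-congʳ (h 0)) (ev-≋ p q (h ∘ suc) i)

    ev-⊕ : ∀ p q v → ev X (p ⊕ q) v ≋ ev X p v ⊞ ev X q v
    ev-⊕ []      q       v i = sym (+-identityˡ _)
    ev-⊕ (a ∷ p) []      v i = sym (+-identityʳ _)
    ev-⊕ (a ∷ p) (b ∷ q) v i = trans (+-congˡ (ev-⊕ p q (X v) i))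
      (solve 5 (λ a b v x y → (a :+ b) :* v :+ (x :+ y) := (a :* v :+ x) :+ (b :* v :+ y)) refl a b (v i) _ _)

    ev-scale : ∀ a p v → ev X (mapₗ (a *_) p) v ≋ a ⊡ ev X p v
    ev-scale a []      v i = sym (zeroʳ a)
    ev-scale a (b ∷ p) v i = trans (+-congˡ (ev-scale a p (X v) i))
      (solve 4 (λ a b v x → (a :* b) :* v :+ a :* x := a :* (b :* v :+ x)) refl a b (v i) _)

    ev-shift : ∀ k p v → ev X (replicate k 0# ++ₗ p) v ≋ ev X p (iter k X v)
    ev-shift zero    p v i = refl
    ev-shift (suc k) p v i = trans (+-cong (zeroˡ _) (ev-shift k p (X v) i))
      (trans (+-identityˡ _) (reflexive (≡.cong (λ w → ev X p w i) (iter-comm k X v))))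

    ev-monomial : ∀ k a v → ev X (monomial k a) v ≋ a ⊡ iter k X v
    ev-monomial k a v i = trans (ev-shift k (a ∷ []) v i) (+-identityʳ _)

    -- The common mechanism behind all exchanges of operators below: the instances are `x` itself,
    -- the Galois action `Σ`, projections to components and conjugation by powers of `σ`.
    ev-commute : ∀ {E ρ} {X′ : V E → V E} {t : V D → V E} → IsSemilinear ρ t →
                 (∀ {v w} → v ≋ w → X′ v ≋ X′ w) → (∀ v → t (X v) ≋ X′ (t v)) →
                 ∀ p v → t (ev X p v) ≋ ev X′ (mapₗ ρ p) (t v)
    ev-commute T X′-cong comm [] v i = semilinear-𝟎 T i
    ev-commute {ρ = ρ} {X′} {t} T X′-cong comm (a ∷ p) v i = begin
      t (a ⊡ v ⊞ ev X p (X v)) i                          ≈⟨ ⟨+⟩ _ _ i ⟩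
      t (a ⊡ v) i + t (ev X p (X v)) i                    ≈⟨ +-cong (⟨*⟩ a v i) (ev-commute T X′-cong comm p (X v) i) ⟩
      ρ a * t v i + ev X′ (mapₗ ρ p) (t (X v)) i          ≈⟨ +-congˡ (cong′ (mapₗ ρ p) (comm v) i) ⟩
      ρ a * t v i + ev X′ (mapₗ ρ p) (X′ (t v)) i         ∎
      where
      open IsSemilinear T
      cong′ : ∀ q {v w} → v ≋ w → ev X′ q v ≋ ev X′ q w
      cong′ []      h i = refl
      cong′ (b ∷ q) h i = +-cong (*-congˡ (h i)) (cong′ q (X′-cong h) i)

    -- The vectors become a left module because moving `X` past `q` twists the coefficients of `q`
    -- exactly as the multiplication does.
    ev-mul : ∀ p q v → ev X (mulWith τ p q) v ≋ ev X p (ev X q v)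
    ev-mul []      q v i = refl
    ev-mul (a ∷ p) q v i = begin
      ev X (mapₗ (a *_) q ⊕ (0# ∷ mulWith τ p (mapₗ τ q))) v i
        ≈⟨ ev-⊕ (mapₗ (a *_) q) _ v i ⟩
      ev X (mapₗ (a *_) q) v i + (0# * v i + ev X (mulWith τ p (mapₗ τ q)) (X v) i)
        ≈⟨ +-cong (ev-scale a q v i) (trans (+-congʳ (zeroˡ _)) (+-identityˡ _)) ⟩
      a * ev X q v i + ev X (mulWith τ p (mapₗ τ q)) (X v) i
        ≈⟨ +-congˡ (ev-mul p (mapₗ τ q) (X v) i) ⟩
      a * ev X q v i + ev X p (ev X (mapₗ τ q) (X v)) i
        ≈⟨ +-congˡ (ev-cong p (ev-commute XS X.⟨cong⟩ (λ _ _ → refl) q v) i) ⟨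
      a * ev X q v i + ev X p (X (ev X q v)) i ∎

  ev-lift : ∀ {D τ} {X : V D → V D} → IsSemilinear τ X → ∀ F v → ev X (lift F) v ≋ ev (iter n X) F v
  ev-lift XS []      v i = refl
  ev-lift {X = X} XS (a ∷ F) v i = +-congˡ (begin
    ev X (replicate (n ℕ.∸ 1) 0# ++ₗ lift F) (X v) i  ≈⟨ Eval.ev-shift XS (n ℕ.∸ 1) (lift F) (X v) i ⟩
    ev X (lift F) (iter (n ℕ.∸ 1) X (X v)) i          ≈⟨ reflexive (≡.cong (λ w → ev X (lift F) w i) n-1) ⟩
    ev X (lift F) (iter n X v) i                      ≈⟨ ev-lift XS F (iter n X v) i ⟩
    ev (iter n X) F (iter n X v) i                    ∎)
    where
    n-1 : iter (n ℕ.∸ 1) X (X v) ≡ iter n X v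
    n-1 with n | 2≤n
    ... | suc k | _ = iter-comm k X v

  coeff-shift : ∀ k p i → coeff (replicate k 0# ++ₗ p) (k ℕ.+ i) ≡ coeff p i
  coeff-shift zero    p i = ≡.refl
  coeff-shift (suc k) p i = coeff-shift k p i

  coeff-shift-< : ∀ k p {i} → i ℕ.< k → coeff (replicate k 0# ++ₗ p) i ≡ 0#
  coeff-shift-< (suc k) p {zero}  _ = ≡.refl
  coeff-shift-< (suc k) p {suc i} (s≤s i<k) = coeff-shift-< k p i<k

  coeff-lift-n+ : ∀ a F i → coeff (lift (a ∷ F)) (n ℕ.+ i) ≡ coeff (lift F) i
  coeff-lift-n+ a F i with n | 2≤n | lift F
  ... | suc k | _ | q = coeff-shift k q i

  coeff-lift-< : ∀ a F {i} → suc i ℕ.< n → coeff (lift (a ∷ F)) (suc i) ≡ 0#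
  coeff-lift-< a F {i} i<n with n | lift F
  coeff-lift-< a F {i} (s≤s i<k) | suc k | q = coeff-shift-< k q i<k

  coeff-lift : ∀ F i → coeff (lift F) (i ℕ.* n) ≡ coeff F i
  coeff-lift []      i       = ≡.refl
  coeff-lift (a ∷ F) zero    = ≡.refl
  coeff-lift (a ∷ F) (suc i) = ≡.trans (coeff-lift-n+ a F (i ℕ.* n)) (coeff-lift F i)

  lift-vanish : ∀ k F → VanishFrom k F → VanishFrom (k ℕ.* n) (lift F)
  lift-vanish k [] z i _ = refl
  lift-vanish k (a ∷ F) z i k≤i with n ℕ.≤? i
  ... | yes n≤i = ≡.subst (λ i → coeff (lift (a ∷ F)) i ≈ 0#) (ℕ.m+[n∸m]≡n n≤i)
        (trans (reflexive (coeff-lift-n+ a F (i ℕ.∸ n))) (lift-vanish (ℕ.pred k) F (tailVanish k z) (i ℕ.∸ n) (bound k k≤i)))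
    where
    tailVanish : ∀ k → VanishFrom k (a ∷ F) → VanishFrom (ℕ.pred k) F
    tailVanish zero z i _ = z (suc i) z≤n
    tailVanish (suc k) z i k≤i = z (suc i) (s≤s k≤i)
    bound : ∀ k → k ℕ.* n ℕ.≤ i → ℕ.pred k ℕ.* n ℕ.≤ i ℕ.∸ n
    bound zero    _ = z≤n
    bound (suc k) p = ℕ.≤-trans (ℕ.≤-reflexive (≡.sym (ℕ.m+n∸m≡n n (k ℕ.* n)))) (ℕ.∸-monoˡ-≤ n p)
  lift-vanish k (a ∷ F) z zero k≤i | no _ = z 0 (k≡0 k k≤i)
    where
    k≡0 : ∀ k → k ℕ.* n ℕ.≤ 0 → k ℕ.≤ 0
    k≡0 zero _ = z≤n
    k≡0 (suc k) p = ⊥-elim (ℕ.<⇒≱ 2≤n (ℕ.≤-trans (ℕ.m+n≤o⇒m≤o n p) z≤n))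
  lift-vanish k (a ∷ F) z (suc i) k≤i | no n≰i = reflexive (coeff-lift-< a F (ℕ.≰⇒> n≰i))

  lift-monic : ∀ {F s} → MonicDeg F s → MonicDeg (lift F) (s ℕ.* n)
  lift-monic {F} {s} (top , above) = trans (reflexive (coeff-lift F s)) top , higher
    where
    higher : ∀ i → s ℕ.* n ℕ.< i → coeff (lift F) i ≈ 0#
    higher = go F s above
      where
      go : ∀ F s → (∀ i → s ℕ.< i → coeff F i ≈ 0#) → ∀ i → s ℕ.* n ℕ.< i → coeff (lift F) i ≈ 0#
      go [] s above i _ = refl
      go (a ∷ F) s above i s<i with n ℕ.≤? i
      go (a ∷ F) zero above i s<i | yes n≤i = ≡.subst (λ i → coeff (lift (a ∷ F)) i ≈ 0#) (ℕ.m+[n∸m]≡n n≤i)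
        (trans (reflexive (coeff-lift-n+ a F (i ℕ.∸ n))) (lift-vanish 0 F (λ j _ → above (suc j) (s≤s z≤n)) _ z≤n))
      go (a ∷ F) (suc s) above i s<i | yes n≤i = ≡.subst (λ i → coeff (lift (a ∷ F)) i ≈ 0#) (ℕ.m+[n∸m]≡n n≤i)
        (trans (reflexive (coeff-lift-n+ a F (i ℕ.∸ n))) (go F s (λ j s<j → above (suc j) (s≤s s<j)) (i ℕ.∸ n)
          (ℕ.≤-trans (ℕ.≤-reflexive (≡.sym (≡.trans (≡.cong (ℕ._∸ n) (≡.sym (ℕ.+-suc n (s ℕ.* n)))) (ℕ.m+n∸m≡n n (suc (s ℕ.* n)))))) (ℕ.∸-monoˡ-≤ n s<i))))
      go (a ∷ F) s above (suc i) s<i | no n≰i = reflexive (coeff-lift-< a F (ℕ.≰⇒> n≰i))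

  lift-≋0 : ∀ F → (∀ i → coeff (lift F) i ≈ 0#) → ∀ i → coeff F i ≈ 0#
  lift-≋0 F z i = trans (reflexive (≡.sym (coeff-lift F i))) (z (i ℕ.* n))

-- Members of least degree, up to double negation

module LeastDegree {c ℓ} (S : CyclicSetup c ℓ) where
  open CyclicSetup S hiding (zero)
  open Skew S using (Poly; coeff; MonicDeg)
  open Polynomials S

  -- As equality is undecidable, minimality only says that a member of smaller
  -- degree is not nonzero.
  record Least {j} (J : Poly → Set j) (e : ℕ) : Set (c ⊔ ℓ ⊔ j) where
    field
      poly   : Poly
      monic  : MonicDeg poly e
      member : J poly
      least  : ∀ r → J r → VanishFrom e r → ¬ ¬ (∀ i → coeff r i ≈ 0#)

  -- Descent: a nonzero member of smaller degree could be made monic and would start the search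
  -- again below. Which of its coefficients is the top one is known only up to double negation.
  ¬¬-least : ∀ {j} {J : Poly → Set j} → (∀ a {p} → J p → J (mapₗ (a *_) p)) →
             ∀ e {p} → MonicDeg p e → J p → ¬ ¬ (∃ λ e′ → e′ ℕ.≤ e × Least J e′)
  ¬¬-least {J = J} J-scale e {p} M Jp k = <-rec (λ e → ∀ p → MonicDeg p e → J p → ¬ (∀ e′ → e′ ℕ.≤ e → ¬ Least J e′))
    (λ e below p M Jp none → none e ℕ.≤-refl record
      { poly = p ; monic = M ; member = Jp
      ; least = λ r Jr z → descend e r Jr z (λ e′ e′<e q N Jq → below e′<e q N Jq (λ e″ e″≤e′ → none e″ (ℕ.≤-trans e″≤e′ (ℕ.<⇒≤ e′<e)))) })
    e p M Jp (λ e′ e′≤e L → k (e′ , e′≤e , L))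
    where
    descend : ∀ e r → J r → VanishFrom e r → (∀ e′ → e′ ℕ.< e → ∀ q → MonicDeg q e′ → ¬ J q) → ¬ ¬ (∀ i → coeff r i ≈ 0#)
    descend zero    r Jr z none k = k (λ i → z i z≤n)
    descend (suc e) r Jr z none k = ¬¬-excluded-middle λ
      { (yes top≈0) → descend e r Jr (lower top≈0) (λ e′ e′<e → none e′ (ℕ.m<n⇒m<1+n e′<e)) k
      ; (no top≉0) → none e ℕ.≤-refl (mapₗ (proj₁ (inverse _ top≉0) *_) r)
          ( trans (coeff-scale _ r e) (trans (*-comm _ _) (proj₂ (inverse _ top≉0)))
          , λ i e<i → trans (coeff-scale _ r i) (trans (*-congˡ (z i e<i)) (zeroʳ _)))
          (J-scale _ Jr) }
      where
      lower : coeff r e ≈ 0# → VanishFrom e r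
      lower top≈0 i e≤i with ℕ.m≤n⇒m<n∨m≡n e≤i
      ... | inj₁ e<i    = z i e<i
      ... | inj₂ ≡.refl = top≈0

-- Bases of cyclic blocks defined over K

module Blocks {c ℓ} (A : CommutativeRing c ℓ) where
  open Vectors A

  -- The highest index leads, since a vector b j - t b (j + 1) is cleaned by the vector in front of
  -- it.
  descending : ∀ {D} → (ℕ → V D) → ∀ j → Vec (V D) j
  descending b zero    = []
  descending b (suc j) = b j ∷ descending b j

  concatBlocks : ∀ {D r s} → Vec (Vec (V D) s) r → Vec (V D) (r ℕ.* s)
  concatBlocks []       = []
  concatBlocks (B ∷ Bs) = B ++ concatBlocks Bs

-- A negative substitute for irreducibility over K: it can be derived in both parts of the theorem
-- and can be contradicted under double negations.
NoProperFactor : ∀ {c ℓ} (S : CyclicSetup c ℓ) → Skew.Poly S → ℕ → Set (c ⊔ ℓ)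
NoProperFactor S F s = ∀ p q e → KPoly p → KPoly q → MonicDeg p e → 0 ℕ.< e → e ℕ.< s → ¬ (F ≋ (q ⊗ p))
  where open Skew S

module RationalBases {c ℓ} (S : CyclicSetup c ℓ) where
  open CyclicSetup S hiding (zero)
  open Skew S using (Poly; coeff; KPoly; MonicDeg; InK; _⊗_; _⊕_)
  open Vectors L
  open Spans L
  open Polynomials S
  open Galois S
  open Blocks L
  open LeastDegree S
  open RingSolver L
  open import Relation.Binary.Reasoning.Setoid setoid
  open import Algebra.Properties.AbelianGroup +-abelianGroup using (x∙y⁻¹≈ε⇒x≈y)
  open import Algebra.Properties.Ring ring using (-1*x≈-x)

  -- The vectors `u` are fixed by the Galois action `Σ` and stand for a K-form of the space, which
  -- `F` turns into a vector space over the field K[y]/F; this is why it decomposes into blocks of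
  -- length s.
  module RationalBasis
    {F : Poly} {s : ℕ} (F∈K : KPoly F) (F-monic : MonicDeg F s) (0<s : 0 ℕ.< s) (noFactor : NoProperFactor S F s)
    {D : ℕ} {Z Σ : V D → V D} (Z-linear : IsLinear Z) (Σ-semilinear : IsSemilinear σ Σ) (ΣZ : ∀ v → Σ (Z v) ≋ Z (Σ v))
    {N : ℕ} (u : Fin N → V D) (Σu : ∀ a → Σ (u a) ≋ u a) (Fu : ∀ a → ev Z F (u a) ≋ 𝟎)
    (spanning : ∀ {m} (vs : Vec (V D) m) → (∀ a → Span vs (u a)) → ∀ i → Span vs (e i))
    where

    private
      ZS = linear⇒semilinear Z-linear
      module Z = IsLinear Z-linear
      module Σ = IsSemilinear Σ-semilinear
      module E = Eval ZS

    Z^_·u_ : ℕ → Fin N → V D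
    Z^ j ·u a = iter j Z (u a)

    block : Fin N → ∀ j → Vec (V D) j
    block a = descending (λ j → Z^ j ·u a)

    blocks : ∀ {r} → Vec (Fin N) r → Vec (V D) (r ℕ.* s)
    blocks T = concatBlocks (Data.Vec.map (λ a → block a s) T)
      where import Data.Vec

    private
      ΣZ^ : ∀ j a → Σ (Z^ j ·u a) ≋ Z^ j ·u a
      ΣZ^ zero    a i = Σu a i
      ΣZ^ (suc j) a i = trans (ΣZ _ i) (Z.⟨cong⟩ (ΣZ^ j a) i)

      descending-all : ∀ {p} {P : V D → Set p} {b} → (∀ i → P (b i)) → ∀ j → Allᵥ P (descending b j)
      descending-all h zero    = []
      descending-all h (suc j) = h j ∷ descending-all h j

      span-self : ∀ {m} (vs : Vec (V D) m) → Allᵥ (Span vs) vs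
      span-self []       = []
      span-self (v ∷ vs) = span-head v ∷ VecAll.map (span-tail v) (span-self vs)

      span-++ˡ : ∀ {m m′} {vs : Vec (V D) m} (ws : Vec (V D) m′) {v} → Span vs v → Span (vs ++ ws) v
      span-++ˡ {vs = vs} ws = span-trans (go vs)
        where
        go : ∀ {m} (vs : Vec (V D) m) → Allᵥ (Span (vs ++ ws)) vs
        go []       = []
        go (v ∷ vs) = span-head v ∷ VecAll.map (span-tail v) (go vs)

      span-++ʳ : ∀ {m m′} (ws : Vec (V D) m′) {vs : Vec (V D) m} {v} → Span vs v → Span (ws ++ vs) v
      span-++ʳ []       h = h
      span-++ʳ (w ∷ ws) h = span-tail w (span-++ʳ ws h)

      span-neg : ∀ {m} {vs : Vec (V D) m} {v} → Span vs v → Span vs (λ i → - v i)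
      span-neg h = span-≋ (λ i → -1*x≈-x _) (span-* (- 1#) h)

      descending∋ : ∀ a {i} j → i ℕ.< j → Span (block a j) (Z^ i ·u a)
      descending∋ a (suc j) (s≤s i≤j) with ℕ.m≤n⇒m<n∨m≡n i≤j
      ... | inj₁ i<j    = span-tail _ (descending∋ a j i<j)
      ... | inj₂ ≡.refl = span-head _

      ev-span : ∀ {m} {vs : Vec (V D) m} j q {v} → VanishFrom j q → (∀ i → i ℕ.< j → Span vs (iter i Z v)) → Span vs (ev Z q v)
      ev-span j       []      z h = span-0
      ev-span zero    (a ∷ q) z h = span-≋ (λ i → sym (E.ev-zero (a ∷ q) (λ j → z j z≤n) i)) span-0
      ev-span {vs = vs} (suc j) (a ∷ q) {v} z h = span-+ (span-* a (h 0 (s≤s z≤n)))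
        (ev-span j q (λ i j≤i → z (suc i) (s≤s j≤i)) (λ i i<j → ≡.subst (Span vs) (≡.sym (iter-comm i Z v)) (h (suc i) (s≤s i<j))))

      Z^s : ∀ a → Span (block a s) (Z^ s ·u a)
      Z^s a = span-≋ (λ i → begin
          - ev Z r (u a) i                                 ≈⟨ -‿cong (E.ev-⊕ F _ (u a) i) ⟩
          - (ev Z F (u a) i + ev Z (monomial s (- 1#)) (u a) i) ≈⟨ -‿cong (+-cong (Fu a i) (E.ev-monomial s (- 1#) (u a) i)) ⟩
          - (0# + - 1# * (Z^ s ·u a) i)                    ≈⟨ solve 1 (λ x → :- (:0 :+ (:- :1) :* x) := x) refl _ ⟩
          (Z^ s ·u a) i                                    ∎)
        (span-neg (ev-span s r r-small (λ i → descending∋ a s)))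
        where
        r = F ⊕ monomial s (- 1#)
        r-small : VanishFrom s r
        r-small = cancel-top {s} {F} (trans (+-congʳ (proj₁ F-monic)) (-‿inverseʳ 1#)) (proj₂ F-monic)

      Z-block : ∀ a → Allᵥ (λ v → Span (block a s) (Z v)) (block a s)
      Z-block a = go s ℕ.≤-refl
        where
        go : ∀ j → j ℕ.≤ s → Allᵥ (λ v → Span (block a s) (Z v)) (block a j)
        go zero    _ = []
        go (suc j) j<s = next (ℕ.m≤n⇒m<n∨m≡n j<s) ∷ go j (ℕ.<⇒≤ j<s)
          where
          next : suc j ℕ.< s ⊎ suc j ≡ s → Span (block a s) (Z^ suc j ·u a)
          next (inj₁ 1+j<s) = descending∋ a s 1+j<s
          next (inj₂ ≡.refl) = Z^s a

      Z-blocks : ∀ {r} (T : Vec (Fin N) r) → Allᵥ (λ v → Span (blocks T) (Z v)) (blocks T)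
      Z-blocks []      = []
      Z-blocks (a ∷ T) = ++⁺ (VecAll.map (span-++ˡ (blocks T)) (Z-block a)) (VecAll.map (span-++ʳ (block a s)) (Z-blocks T))

      Σ-blocks : ∀ {r} (T : Vec (Fin N) r) → Allᵥ (λ v → Span (blocks T) (Σ v)) (blocks T)
      Σ-blocks T = zipWith′ (fixed T) (span-self (blocks T))
        where
        fixed : ∀ {r} (T : Vec (Fin N) r) → Allᵥ (λ v → Σ v ≋ v) (blocks T)
        fixed []      = []
        fixed (a ∷ T) = ++⁺ (descending-all (λ j → ΣZ^ j a) s) (fixed T)
        zipWith′ : ∀ {m m′} {vs : Vec (V D) m} {ws : Vec (V D) m′} → Allᵥ (λ v → Σ v ≋ v) vs → Allᵥ (Span ws) vs → Allᵥ (λ v → Span ws (Σ v)) vs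
        zipWith′ [] [] = []
        zipWith′ (p ∷ ps) (h ∷ hs) = span-≋ (λ i → sym (p i)) h ∷ zipWith′ ps hs

      relation : ∀ {m} {vs : Vec (V D) m} a j {w} → Span (block a j ++ vs) w →
                 ∃ λ q → VanishFrom j q × Span vs (λ i → w i - ev Z q (u a) i)
      relation a zero    h = [] , (λ _ _ → refl) , span-≋ (λ i → solve 1 (λ x → x := x :- :0) refl _) h
      relation a (suc j) {w} h with span-split h
      ... | x , w′ , h′ , w≋ with relation a j h′
      ... | q , q-small , h″ = q ⊕ monomial j x
          , (λ i j<i → trans (coeff-⊕ q _ i) (trans (+-cong (q-small i (ℕ.<⇒≤ j<i)) (coeff-monomial-≢ j x (ℕ.<⇒≢ j<i ∘ ≡.sym))) (+-identityʳ 0#)))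
          , span-≋ (λ i → begin
              w′ i - ev Z q (u a) i
                ≈⟨ solve 3 (λ w q y → w :- q := (y :+ w) :- (q :+ y)) refl (w′ i) (ev Z q (u a) i) (x * (Z^ j ·u a) i) ⟩
              (x * (Z^ j ·u a) i + w′ i) - (ev Z q (u a) i + x * (Z^ j ·u a) i)
                ≈⟨ +-cong (w≋ i) (-‿cong (trans (E.ev-⊕ q (monomial j x) (u a) i) (+-congˡ (E.ev-monomial j x (u a) i)))) ⟨
              w i - ev Z (q ⊕ monomial j x) (u a) i ∎) h″

      -- The polynomials p with p(Z) u ∈ ⟨vs⟩ form an ideal defined over K, whose
      -- generator divides F.
      module Conductor {m} {vs : Vec (V D) m} (Z-stable : Allᵥ (λ v → Span vs (Z v)) vs) (Σ-stable : Allᵥ (λ v → Span vs (Σ v)) vs)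
                       {a} (u∉ : ¬ Span vs (u a)) where

        J : Poly → Set _
        J p = Span vs (ev Z p (u a))

        ev-stable : ∀ q {v} → Span vs v → Span vs (ev Z q v)
        ev-stable []      h = span-0
        ev-stable (b ∷ q) h = span-+ (span-* b h) (ev-stable q (span-image ZS Z-stable h))

        J-+ : ∀ {p q} → J p → J q → J (p ⊕ q)
        J-+ {p} {q} h h′ = span-≋ (λ i → sym (E.ev-⊕ p q (u a) i)) (span-+ h h′)

        J-scale : ∀ b {p} → J p → J (mapₗ (b *_) p)
        J-scale b {p} h = span-≋ (λ i → sym (E.ev-scale b p (u a) i)) (span-* b h)

        J-σ : ∀ {p} → J p → J (mapₗ σ p)
        J-σ {p} h = span-≋ (λ i → trans (E.ev-commute Σ-semilinear Z.⟨cong⟩ ΣZ p (u a) i) (E.ev-cong (mapₗ σ p) (Σu a) i))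
                           (span-image Σ-semilinear Σ-stable h)

        no-monic : ∀ j p → j ℕ.< s → MonicDeg p j → ¬ J p
        no-monic j p j<s M Jp = ¬¬-least J-scale j {p} M Jp λ (e , e≤j , L) → impossible e (ℕ.≤-<-trans e≤j j<s) L
          where
          impossible : ∀ e → e ℕ.< s → ¬ Least J e
          impossible zero _ L = u∉ (span-≋ (λ i → trans (E.ev-≋ poly (1# ∷ []) (λ { zero → proj₁ monic ; (suc i) → proj₂ monic (suc i) (s≤s z≤n) }) i)
              (trans (+-identityʳ _) (*-identityˡ _))) member)
            where open Least L
          -- The conjugate of the least member minus itself has lower degree, so up to double
          -- negation the least member lies over K. The remainder of `F` modulo it is again a member
          -- of lower degree, and a proper factor of `F` is left.
          impossible e@(suc _) e<s L = least r (J-+ {mapₗ σ poly} (J-σ {poly} member) (J-scale (- 1#) {poly} member)) r-small λ r≈0 →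
            let p∈K : KPoly poly
                p∈K i = x∙y⁻¹≈ε⇒x≈y _ _ (trans (sym (coeff-r i)) (r≈0 i))
                module Q = Division (divide id id refl refl {InK} (λ p q → trans (σ-cong (sym p)) (trans q p)) σ-0 id
                  (λ {x} {y} {z} x∈ y∈ z∈ → trans (σ-+ x _) (+-cong x∈ (trans (σ-neg _) (-‿cong (trans (σ-* y z) (*-cong y∈ z∈))))))
                  F {poly} {e} monic F∈K p∈K)
            in least Q.remainder
                 (span-≋ (λ i → begin
                     - ev Z Q.quotient (ev Z poly (u a)) i
                       ≈⟨ -‿cong (E.ev-mul Q.quotient poly (u a) i) ⟨
                     - ev Z (Q.quotient ⊗ poly) (u a) i
                       ≈⟨ solve 2 (λ x y → :- x := y :- (x :+ y)) refl _ (ev Z Q.remainder (u a) i) ⟩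
                     ev Z Q.remainder (u a) i - (ev Z (Q.quotient ⊗ poly) (u a) i + ev Z Q.remainder (u a) i)
                       ≈⟨ +-congˡ (-‿cong (trans (sym (E.ev-⊕ (Q.quotient ⊗ poly) Q.remainder (u a) i))
                            (trans (sym (E.ev-≋ F ((Q.quotient ⊗ poly) ⊕ Q.remainder) Q.division i)) (Fu a i)))) ⟩
                     ev Z Q.remainder (u a) i - 0#
                       ≈⟨ solve 1 (λ x → x :- :0 := x) refl _ ⟩
                     ev Z Q.remainder (u a) i ∎)
                   (span-neg (ev-stable Q.quotient member)))
                 Q.small
                 (λ rem≈0 → noFactor poly Q.quotient e p∈K Q.quotient∈ monic (s≤s z≤n) e<s
                   (λ i → trans (Q.division i) (trans (coeff-⊕ (Q.quotient ⊗ poly) _ i) (trans (+-congˡ (rem≈0 i)) (+-identityʳ _)))))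
            where
            open Least L
            r = mapₗ σ poly ⊕ mapₗ (- 1# *_) poly
            coeff-r : ∀ i → coeff r i ≈ σ (coeff poly i) - coeff poly i
            coeff-r i = trans (coeff-⊕ (mapₗ σ poly) _ i) (+-cong (coeff-map σ-0 poly i) (trans (coeff-scale (- 1#) poly i) (-1*x≈-x _)))
            r-small : VanishFrom e r
            r-small i e≤i with ℕ.m≤n⇒m<n∨m≡n e≤i
            ... | inj₁ e<i = trans (coeff-r i) (trans (+-cong (trans (σ-cong (proj₂ monic i e<i)) σ-0) (-‿cong (proj₂ monic i e<i))) (-‿inverseʳ 0#))
            ... | inj₂ ≡.refl = trans (coeff-r e) (trans (+-cong (trans (σ-cong (proj₁ monic)) σ-1) (-‿cong (proj₁ monic))) (-‿inverseʳ 1#))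

        -- A dependence would be a monic polynomial of degree j in `J`.
        new-direction : ∀ j → j ℕ.< s → ¬ Span (block a j ++ vs) (Z^ j ·u a)
        new-direction j j<s h with relation a j h
        ... | q , q-small , h′ = no-monic j p j<s
              ( trans (coeff-p j) (trans (+-cong (reflexive (coeff-monomial j 1#)) (-‿cong (q-small j ℕ.≤-refl))) (solve 0 (:1 :- :0 := :1) refl))
              , (λ i j<i → trans (coeff-p i) (trans (+-cong (coeff-monomial-≢ j 1# (ℕ.<⇒≢ j<i ∘ ≡.sym)) (-‿cong (q-small i (ℕ.<⇒≤ j<i)))) (-‿inverseʳ 0#))))
              (span-≋ (λ i → sym (begin
                 ev Z p (u a) i
                   ≈⟨ E.ev-⊕ (monomial j 1#) _ (u a) i ⟩
                 ev Z (monomial j 1#) (u a) i + ev Z (mapₗ (- 1# *_) q) (u a) i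
                   ≈⟨ +-cong (trans (E.ev-monomial j 1# (u a) i) (*-identityˡ _)) (trans (E.ev-scale (- 1#) q (u a) i) (-1*x≈-x _)) ⟩
                 (Z^ j ·u a) i - ev Z q (u a) i ∎)) h′)
          where
          p = monomial j 1# ⊕ mapₗ (- 1# *_) q
          coeff-p : ∀ i → coeff p i ≈ coeff (monomial j 1#) i - coeff q i
          coeff-p i = trans (coeff-⊕ (monomial j 1#) _ i) (+-congˡ (trans (coeff-scale (- 1#) q i) (-1*x≈-x _)))

        independent-block : Independent vs → ∀ j → j ℕ.≤ s → Independent (block a j ++ vs)
        independent-block ind zero    _   = ind
        independent-block ind (suc j) j<s = independent-∷ 1≉0 inverse (independent-block ind j (ℕ.<⇒≤ j<s)) (new-direction j j<s)

    -- If no block can be added to an independent tuple, then every `u a` lies, up to double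
    -- negation, in the span of the blocks at hand, and these are too few to span.
    rational-basis : ∀ r → r ℕ.* s ℕ.≤ D → ¬ (∀ (T : Vec (Fin N) r) → ¬ Independent (blocks T))
    rational-basis zero    _ none = none [] (independent-[] 1≉0)
    rational-basis (suc r) bound none = rational-basis r (ℕ.m+n≤o⇒n≤o s bound) λ T ind →
      ¬¬-∀ (λ a u∉ → none (a ∷ T) (Conductor.independent-block (Z-blocks T) (Σ-blocks T) {a} u∉ ind s ℕ.≤-refl)) λ spans →
        too-few-to-span 1≉0 (blocks T) (ℕ.<-≤-trans (ℕ.m<n+m (r ℕ.* s) 0<s) bound) (spanning (blocks T) spans)

-- The determinant of 1 - t Z on cyclic blocks

module BlockDeterminant {c ℓ} (A : CommutativeRing c ℓ) (t : CommutativeRing.Carrier A) where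
  open CommutativeRing A hiding (zero)
  open Vectors A
  open Alternating A
  open Spans A
  open Blocks A
  open RingSolver A
  open import Algebra.Properties.Semiring.Exp semiring using (_^_)
  open import Relation.Binary.Reasoning.Setoid setoid

  -- In `descending` order the first coordinate belongs to the highest power, so this evaluates the
  -- reversal of the polynomial whose coefficients are listed.
  horner : ∀ {m} → V m → Carrier
  horner {zero}  γ = 0#
  horner {suc m} γ = γ zero + t * horner (γ ∘ suc)

  module _ {D} {b c : ℕ → V D} (c≋ : ∀ j → c j ≋ b j ⊞ (- t) ⊡ b (suc j)) where

    telescope : ∀ m {f : Form D (suc m)} → IsAlt f → f (b m ∷ descending c m) ≈ f (b m ∷ descending b m)
    telescope zero    F = refl
    telescope (suc m) {f} F = begin
      f (b (suc m) ∷ c m ∷ descending c m)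
        ≈⟨ HeadLinear.⟨cong⟩ (headLinear (partial F _)) _ (c≋ m) ⟩
      f (b (suc m) ∷ b m ⊞ (- t) ⊡ b (suc m) ∷ descending c m)
        ≈⟨ shear F (- t) (b (suc m)) (b m) _ ⟩
      f (b (suc m) ∷ b m ∷ descending c m)
        ≈⟨ telescope m (partial F _) ⟩
      f (b (suc m) ∷ b m ∷ descending b m) ∎

    -- Modulo the last m vectors b (j + 1) becomes a t-th part of b j, so the
    -- combination in front acts as the scalar horner γ times b m.
    comb-front : ∀ m {f : Form D (suc m)} → IsAlt f → ∀ γ →
                 f (comb γ (descending b (suc m)) ∷ descending c m) ≈ horner γ * f (descending b (suc m))
    comb-front zero {f} F γ = begin
      f (γ zero ⊡ b 0 ⊞ 𝟎 ∷ [])       ≈⟨ H.⟨+⟩ _ _ [] ⟩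
      f (γ zero ⊡ b 0 ∷ []) + f (𝟎 ∷ []) ≈⟨ +-cong (H.⟨*⟩ _ _ []) (H.⟨0⟩ []) ⟩
      γ zero * f (b 0 ∷ []) + 0#      ≈⟨ solve 3 (λ g t x → g :* x :+ :0 := (g :+ t :* :0) :* x) refl (γ zero) t _ ⟩
      (γ zero + t * 0#) * f (b 0 ∷ []) ∎
      where module H = HeadLinear (headLinear F)
    comb-front (suc m) {f} F γ = begin
      f (γ zero ⊡ b (suc m) ⊞ w ∷ c m ∷ descending c m)
        ≈⟨ trans (H.⟨+⟩ _ _ _) (+-congʳ (H.⟨*⟩ _ _ _)) ⟩
      γ zero * f (b (suc m) ∷ descending c (suc m)) + f (w ∷ c m ∷ descending c m)
        ≈⟨ +-cong (*-congˡ (telescope (suc m) F)) (swap F _ _ _) ⟩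
      γ zero * f bs + - f (c m ∷ w ∷ descending c m)
        ≈⟨ +-congˡ (-‿cong (comb-front m (partial F (c m)) (γ ∘ suc))) ⟩
      γ zero * f bs + - (horner (γ ∘ suc) * f (c m ∷ descending b (suc m)))
        ≈⟨ +-congˡ (-‿cong (*-congˡ flip)) ⟩
      γ zero * f bs + - (horner (γ ∘ suc) * ((- t) * f bs))
        ≈⟨ solve 4 (λ g t h x → g :* x :- h :* ((:- t) :* x) := (g :+ t :* h) :* x) refl (γ zero) t _ _ ⟩
      (γ zero + t * horner (γ ∘ suc)) * f bs ∎
      where
      module H = HeadLinear (headLinear F)
      w = comb (γ ∘ suc) (descending b (suc m))
      bs = descending b (suc (suc m))
      flip : f (c m ∷ descending b (suc m)) ≈ (- t) * f bs
      flip = begin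
        f (c m ∷ b m ∷ descending b m)
          ≈⟨ H.⟨cong⟩ _ (c≋ m) ⟩
        f (b m ⊞ (- t) ⊡ b (suc m) ∷ b m ∷ descending b m)
          ≈⟨ trans (H.⟨+⟩ _ _ _) (+-cong (repeat F _ _) (H.⟨*⟩ _ _ _)) ⟩
        0# + (- t) * f (b (suc m) ∷ b m ∷ descending b m)
          ≈⟨ +-identityˡ _ ⟩
        (- t) * f bs ∎

    -- Only the leading vector of the block refers to a power outside it; rewriting that power by a
    -- relation inside the block is what `γ` encodes.
    block-det : ∀ s .{{_ : ℕ.NonZero s}} {f : Form D s} → IsAlt f → ∀ γ → c (ℕ.pred s) ≋ comb γ (descending b s) →
                f (descending c s) ≈ horner γ * f (descending b s)
    block-det (suc m) F γ h = trans (HeadLinear.⟨cong⟩ (headLinear F) _ h) (comb-front m F γ)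

  -- Blocks are exchanged one at a time inside an arbitrary alternating form, so the identity holds
  -- for every tuple of candidates, independent or not.
  blocks-det : ∀ {D N} {b c : Fin N → ℕ → V D} → (∀ a j → c a j ≋ b a j ⊞ (- t) ⊡ b a (suc j)) →
               ∀ s .{{_ : ℕ.NonZero s}} γ → (∀ a → c a (ℕ.pred s) ≋ comb γ (descending (b a) s)) →
               ∀ {r} {f : Form D (r ℕ.* s)} → IsAlt f → ∀ (T : Vec (Fin N) r) →
               f (concatBlocks (map (λ a → descending (c a) s) T)) ≈
               horner γ ^ r * f (concatBlocks (map (λ a → descending (b a) s) T))
  blocks-det c≋ s γ h F [] = sym (*-identityˡ _)
  blocks-det {b = b} {c} c≋ s γ h {suc r} {f} F (a ∷ T) = begin
    f (descending (c a) s ++ cs)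
      ≈⟨ block-det (c≋ a) s (prefix-alt s F cs) γ (h a) ⟩
    horner γ * f (descending (b a) s ++ cs)
      ≈⟨ *-congˡ (blocks-det c≋ s γ h (suffix-alt F (descending (b a) s)) T) ⟩
    horner γ * (horner γ ^ r * f (descending (b a) s ++ bs))
      ≈⟨ *-assoc _ _ _ ⟨
    horner γ ^ suc r * f (descending (b a) s ++ bs) ∎
    where
    cs = concatBlocks (map (λ a → descending (c a) s) T)
    bs = concatBlocks (map (λ a → descending (b a) s) T)

-- Functoriality of determinants and block-diagonal maps

-- Determinants respect every graded relation compatible with the operations of
-- the Laplace expansion, e.g. ring homomorphisms and taking leading coefficients.
module DetRelation {c ℓ c′ ℓ′} (A : CommutativeRing c ℓ) (B : CommutativeRing c′ ℓ′)
  {r} (R : ℕ → CommutativeRing.Carrier A → CommutativeRing.Carrier B → Set r)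
  (R-1 : R 0 (CommutativeRing.1# A) (CommutativeRing.1# B))
  (R-* : ∀ {m a b x y} → R 1 a b → R m x y → R (suc m) (CommutativeRing._*_ A a x) (CommutativeRing._*_ B b y))
  (R-sub : ∀ {m a b x y} → R m a b → R m x y → R m (CommutativeRing._-_ A a x) (CommutativeRing._-_ B b y)) where

  private
    module A where
      open Vectors A public
      open Alternating A public
    module B where
      open Vectors B public
      open Alternating B public

  Related : ∀ {D} → A.V D → B.V D → Set r
  Related v w = ∀ i → R 1 (v i) (w i)

  expand-related : ∀ {D m k} i {f : A.Form D m} {g : B.Form D m} →
                   (∀ {vs ws} → Pointwise Related vs ws → R k (f vs) (g ws)) →
                   ∀ {vs ws} → Pointwise Related vs ws → R (suc k) (A.expand i f vs) (B.expand i g ws)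
  expand-related {m = zero}  i fg (p ∷ []) = R-* (p i) (fg [])
  expand-related {m = suc m} i fg (p ∷ ps) = R-sub (R-* (p i) (fg ps)) (expand-related i (λ qs → fg (p ∷ qs)) ps)

  det-related : ∀ {D vs ws} → Pointwise Related vs ws → R D (A.det {D} vs) (B.det {D} ws)
  det-related {zero}  [] = R-1
  det-related {suc D} ps = expand-related zero (λ qs → det-related (tails qs)) ps
    where
    tails : ∀ {m} {vs : Vec (A.V (suc D)) m} {ws : Vec (B.V (suc D)) m} → Pointwise Related vs ws → Pointwise Related (map A.tl vs) (map B.tl ws)
    tails []       = []
    tails (p ∷ ps) = (p ∘ suc) ∷ tails ps

module DetHom {c ℓ c′ ℓ′} {A : CommutativeRing c ℓ} {B : CommutativeRing c′ ℓ′} {φ} (H : IsHom A B φ) where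
  private
    module A = CommutativeRing A
    module B = CommutativeRing B
    module H = IsHom H
  open DetRelation A B (λ _ a b → φ a B.≈ b) H.⟨1⟩
    (λ p q → B.trans (H.⟨*⟩ _ _) (B.*-cong p q))
    (λ p q → B.trans (H.⟨+⟩ _ _) (B.+-cong p (B.trans (H.⟨-⟩ _) (B.-‿cong q))))

  det-hom : ∀ {D} (vs : Vec (Vectors.V A D) D) → φ (Alternating.det A vs) B.≈ Alternating.det B (map (φ ∘_) vs)
  det-hom vs = det-related (go vs)
    where
    go : ∀ {m D} (vs : Vec (Vectors.V A D) m) → Pointwise Related vs (map (φ ∘_) vs)
    go []       = []
    go (v ∷ vs) = (λ _ → B.refl) ∷ go vs

  sum-hom : ∀ {m} (v : Vectors.V A m) → φ (Vectors.sum A v) B.≈ Vectors.sum B (φ ∘ v)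
  sum-hom {zero}  v = H.⟨0⟩
  sum-hom {suc m} v = B.trans (H.⟨+⟩ _ _) (B.+-congˡ (sum-hom (v ∘ suc)))

module BlockDiagonal {c ℓ} (A : CommutativeRing c ℓ) where
  open CommutativeRing A hiding (zero)
  open Vectors A
  open Alternating A
  open import Relation.Binary.Reasoning.Setoid setoid

  inl : ∀ {d D} → V d → V (d ℕ.+ D)
  inl {d} v k = [ v , (λ _ → 0#) ] (splitAt d k)

  inr : ∀ {d D} → V D → V (d ℕ.+ D)
  inr {d} w k = [ (λ _ → 0#) , w ] (splitAt d k)

  inl-linear : ∀ {d D} → IsLinear (inl {d} {D})
  inl-linear {d} = record
    { ⟨cong⟩ = λ p k → go-cong p (splitAt d k)
    ; ⟨+⟩ = λ v w k → go-+ v w (splitAt d k)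
    ; ⟨*⟩ = λ a v k → go-* a v (splitAt d k) }
    where
    go-cong : ∀ {v w} → v ≋ w → ∀ x → [ v , _ ] x ≈ [ w , _ ] x
    go-cong p (inj₁ j) = p j
    go-cong p (inj₂ _) = refl
    go-+ : ∀ v w x → [ v ⊞ w , _ ] x ≈ [ v , _ ] x + [ w , _ ] x
    go-+ v w (inj₁ j) = refl
    go-+ v w (inj₂ _) = sym (+-identityʳ 0#)
    go-* : ∀ a v x → [ a ⊡ v , _ ] x ≈ a * [ v , _ ] x
    go-* a v (inj₁ j) = refl
    go-* a v (inj₂ _) = sym (zeroʳ a)

  inr-linear : ∀ {d D} → IsLinear (inr {d} {D})
  inr-linear {d} = record
    { ⟨cong⟩ = λ p k → go-cong p (splitAt d k)
    ; ⟨+⟩ = λ v w k → go-+ v w (splitAt d k)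
    ; ⟨*⟩ = λ a v k → go-* a v (splitAt d k) }
    where
    go-cong : ∀ {v w} → v ≋ w → ∀ x → [ _ , v ] x ≈ [ _ , w ] x
    go-cong p (inj₁ _) = refl
    go-cong p (inj₂ j) = p j
    go-+ : ∀ v w x → [ _ , v ⊞ w ] x ≈ [ _ , v ] x + [ _ , w ] x
    go-+ v w (inj₁ _) = sym (+-identityʳ 0#)
    go-+ v w (inj₂ j) = refl
    go-* : ∀ a v x → [ _ , a ⊡ v ] x ≈ a * [ _ , v ] x
    go-* a v (inj₁ _) = sym (zeroʳ a)
    go-* a v (inj₂ j) = refl

  std-+ : ∀ d D → Pointwise _≋_ (std (d ℕ.+ D)) (map inl (std d) ++ map (inr {d}) (std D))
  std-+ zero    D = go (std D)
    where
    go : ∀ {m} (vs : Vec (V D) m) → Pointwise _≋_ vs (map (inr {0}) vs)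
    go []       = []
    go (v ∷ vs) = (λ _ → refl) ∷ go vs
  std-+ (suc d) D = head ∷ tails (std d) (std D) (std-+ d D)
    where
    head : e zero ≋ inl (e {suc d} zero)
    head zero = refl
    head (suc k) with splitAt d k
    ... | inj₁ _ = refl
    ... | inj₂ _ = refl
    left : ∀ v → 0∷ inl {d} {D} v ≋ inl (0∷ v)
    left v zero = refl
    left v (suc k) with splitAt d k
    ... | inj₁ _ = refl
    ... | inj₂ _ = refl
    right : ∀ v → 0∷ inr {d} {D} v ≋ inr {suc d} v
    right v zero = refl
    right v (suc k) with splitAt d k
    ... | inj₁ _ = refl
    ... | inj₂ _ = refl
    tails : ∀ {k l} {us : Vec _ (k ℕ.+ l)} (vs : Vec (V d) k) (ws : Vec (V D) l) → Pointwise _≋_ us (map inl vs ++ map (inr {d}) ws) →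
            Pointwise _≋_ (map 0∷_ us) (map inl (map 0∷_ vs) ++ map (inr {suc d}) ws)
    tails []       []       []       = []
    tails []       (w ∷ ws) (p ∷ ps) = (λ k → trans (IsLinear.⟨cong⟩ 0∷-linear p k) (right w k)) ∷ tails [] ws ps
    tails (v ∷ vs) ws       (p ∷ ps) = (λ k → trans (IsLinear.⟨cong⟩ 0∷-linear p k) (left v k)) ∷ tails vs ws ps

  -- The left side is alternating in `vs` for fixed `ws` and conversely, so two applications of
  -- `alt-unique` reduce it to the standard basis.
  det-inl-inr : ∀ {d D} (vs : Vec (V d) d) (ws : Vec (V D) D) → det (map inl vs ++ map (inr {d}) ws) ≈ det vs * det ws
  det-inl-inr {d} {D} vs ws = begin
    det (map inl vs ++ map (inr {d}) ws)
      ≈⟨ alt-unique (pullback (inl-linear {d} {D}) (prefix-alt d (det-alt {d ℕ.+ D}) (map (inr {d}) ws))) vs ⟩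
    det vs * det (map inl (std d) ++ map (inr {d}) ws)
      ≈⟨ *-congˡ (alt-unique (pullback (inr-linear {d} {D}) (suffix-alt (det-alt {d ℕ.+ D}) (map inl (std d)))) ws) ⟩
    det vs * (det ws * det (map inl (std d) ++ map (inr {d}) (std D)))
      ≈⟨ *-congˡ (*-congˡ (trans (sym (alt-cong (det-alt {d ℕ.+ D}) (std-+ d D))) (det-std (d ℕ.+ D)))) ⟩
    det vs * (det ws * 1#)
      ≈⟨ *-congˡ (*-identityʳ _) ⟩
    det vs * det ws ∎

  flat : ∀ {n d} → (Fin n → V d) → V (n ℕ.* d)
  flat {d = d} m k = uncurry m (remQuot d k)

  unflat : ∀ {n d} → V (n ℕ.* d) → Fin n → V d
  unflat v i j = v (combine i j)

  blockwise : ∀ {n d} → (Fin n → V d → V d) → V (n ℕ.* d) → V (n ℕ.* d)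
  blockwise M v = flat (λ i → M i (unflat v i))

  blockwise-linear : ∀ {n d} (M : Fin n → V d → V d) → (∀ i → IsLinear (M i)) → IsLinear (blockwise M)
  blockwise-linear {n} {d} M T = record
    { ⟨cong⟩ = λ p k → IsLinear.⟨cong⟩ (T (block k)) (λ j → p (combine (block k) j)) _
    ; ⟨+⟩ = λ v w k → IsLinear.⟨+⟩ (T (block k)) (unflat v (block k)) (unflat w (block k)) _
    ; ⟨*⟩ = λ a v k → IsLinear.⟨*⟩ (T (block k)) a (unflat v (block k)) _ }
    where block = λ k → proj₁ (remQuot {n} d k)

  prod : ∀ {n} → V n → Carrier
  prod {zero}  x = 1#
  prod {suc n} x = x zero * prod (x ∘ suc)

  det-blockwise : ∀ {n d} (M : Fin n → V d → V d) → (∀ i → IsLinear (M i)) →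
                  det (map (blockwise M) (std (n ℕ.* d))) ≈ prod (λ i → det (map (M i) (std d)))
  det-blockwise {zero}  M T = refl
  det-blockwise {suc n} {d} M T = begin
    det (map (blockwise M) (std (d ℕ.+ n ℕ.* d)))
      ≈⟨ alt-cong (det-alt {d ℕ.+ n ℕ.* d}) (images (std d) (std (n ℕ.* d)) (std-+ d (n ℕ.* d))) ⟩
    det (map inl (map (M zero) (std d)) ++ map (inr {d}) (map (blockwise (M ∘ suc)) (std (n ℕ.* d))))
      ≈⟨ det-inl-inr (map (M zero) (std d)) _ ⟩
    det (map (M zero) (std d)) * det (map (blockwise (M ∘ suc)) (std (n ℕ.* d)))
      ≈⟨ *-congˡ (det-blockwise (M ∘ suc) (T ∘ suc)) ⟩
    det (map (M zero) (std d)) * prod (λ i → det (map (M (suc i)) (std d))) ∎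
    where
    M′ = blockwise M
    M-cong : ∀ {v w} → v ≋ w → M′ v ≋ M′ w
    M-cong = IsLinear.⟨cong⟩ (blockwise-linear M T)
    M-inl : ∀ v → M′ (inl v) ≋ inl (M zero v)
    M-inl v k with splitAt d k
    ... | inj₁ j = IsLinear.⟨cong⟩ (T zero) (λ j′ → reflexive (≡.cong [ v , _ ] (Fin.splitAt-↑ˡ d j′ (n ℕ.* d)))) j
    ... | inj₂ k′ = trans (IsLinear.⟨cong⟩ (T (suc i)) (λ j′ → reflexive (≡.cong [ v , _ ] (Fin.splitAt-↑ʳ d (n ℕ.* d) (combine i j′)))) j) (IsLinear.⟨0⟩ (T (suc i)) j)
      where i = proj₁ (remQuot {n} d k′)
            j = proj₂ (remQuot {n} d k′)
    M-inr : ∀ w → M′ (inr {d} w) ≋ inr {d} (blockwise (M ∘ suc) w)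
    M-inr w k with splitAt d k
    ... | inj₁ j = trans (IsLinear.⟨cong⟩ (T zero) (λ j′ → reflexive (≡.cong [ _ , w ] (Fin.splitAt-↑ˡ d j′ (n ℕ.* d)))) j) (IsLinear.⟨0⟩ (T zero) j)
    ... | inj₂ k′ = IsLinear.⟨cong⟩ (T (suc i)) (λ j′ → reflexive (≡.cong [ _ , w ] (Fin.splitAt-↑ʳ d (n ℕ.* d) (combine i j′)))) j
      where i = proj₁ (remQuot {n} d k′)
            j = proj₂ (remQuot {n} d k′)
    images : ∀ {k l} {us : Vec _ (k ℕ.+ l)} (vs : Vec (V d) k) (ws : Vec (V (n ℕ.* d)) l) → Pointwise _≋_ us (map inl vs ++ map (inr {d}) ws) →
             Pointwise _≋_ (map M′ us) (map inl (map (M zero) vs) ++ map (inr {d}) (map (blockwise (M ∘ suc)) ws))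
    images []       []       []       = []
    images []       (w ∷ ws) (p ∷ ps) = (λ k → trans (M-cong p k) (M-inr w k)) ∷ images [] ws ps
    images (v ∷ vs) ws       (p ∷ ps) = (λ k → trans (M-cong p k) (M-inl v k)) ∷ images vs ws ps

-- Independence of the powers of σ

-- Finitely many arguments suffice for the independence of the powers of σ: the
-- products of subsets of elements that separate σ ^ i from the other powers.
module Dedekind {c ℓ} (S : CyclicSetup c ℓ) where
  open CyclicSetup S hiding (zero)
  open Galois S
  open Vectors L
  open RingSolver L
  open import Relation.Binary.Reasoning.Setoid setoid
  open import Algebra.Properties.AbelianGroup +-abelianGroup using (x∙y⁻¹≈ε⇒x≈y)

  σ-injective : ∀ {a b} → σ a ≈ σ b → a ≈ b
  σ-injective {a} {b} p = trans (sym (σ^n≈id a)) (trans (rec n (ℕ.≤-trans (s≤s z≤n) 2≤n)) (σ^n≈id b))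
    where
    rec : ∀ k → 0 ℕ.< k → σ^ k a ≈ σ^ k b
    rec (suc k) _ = trans (reflexive (≡.sym (iter-comm k σ a))) (trans (IsHom.⟨cong⟩ (σ^-hom k) p) (reflexive (iter-comm k σ b)))

  σ^-injective : ∀ k {a b} → σ^ k a ≈ σ^ k b → a ≈ b
  σ^-injective zero    p = p
  σ^-injective (suc k) p = σ^-injective k (σ-injective p)

  distinct : ∀ i k → i ℕ.< k → k ℕ.< n → ∃ λ a → ¬ (σ^ i a ≈ σ^ k a)
  distinct i k i<k k<n with σ-order (k ℕ.∸ i) (ℕ.m<n⇒0<n∸m i<k) (ℕ.≤-<-trans (ℕ.m∸n≤m k i) k<n)
  ... | a , σa≉a = a , λ p → σa≉a (σ^-injective i (trans
    (reflexive (≡.trans (≡.sym (iter-+ i (k ℕ.∸ i) σ a)) (≡.cong (λ j → σ^ j a) (ℕ.m+[n∸m]≡n (ℕ.<⇒≤ i<k))))) (sym p)))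

  separate : ∀ (i k : Fin n) → ¬ i ≡ k → ∃ λ a → ¬ (σ^ (toℕ i) a - σ^ (toℕ k) a ≈ 0#)
  separate i k i≢k with ℕ.<-cmp (toℕ i) (toℕ k)
  ... | tri< i<k _ _ = let (a , h) = distinct (toℕ i) (toℕ k) i<k (Fin.toℕ<n k) in a , h ∘ x∙y⁻¹≈ε⇒x≈y _ _
  ... | tri≈ _ i≡k _ = ⊥-elim (i≢k (Fin.toℕ-injective i≡k))
  ... | tri> _ _ k<i = let (a , h) = distinct (toℕ k) (toℕ i) k<i (Fin.toℕ<n i) in a , h ∘ sym ∘ x∙y⁻¹≈ε⇒x≈y _ _

  subsetProducts : ∀ {m} → (Fin m → Carrier) → List Carrier
  subsetProducts {zero}  θ = 1# ∷ []
  subsetProducts {suc m} θ = subsetProducts (θ ∘ suc) ++ₗ mapₗ (θ zero *_) (subsetProducts (θ ∘ suc))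

  conjugates : Carrier → V n
  conjugates a i = σ^ (toℕ i) a

  module _ {w} {W : V n → Set w} (W-≋ : ∀ {v v′} → v ≋ v′ → W v → W v′)
           (W-+ : ∀ {v v′} → W v → W v′ → W (v ⊞ v′)) (W-* : ∀ a {v} → W v → W (a ⊡ v)) where

    -- As a function of `i` this vanishes at every `k x`. When `k` lists all indices but one and the
    -- `θ x` separate that one from the others, it is a coordinate vector up to a unit.
    factors : ∀ {m} → (Fin m → Fin n) → (Fin m → Carrier) → V n
    factors {zero}  k θ i = 1#
    factors {suc m} k θ i = (σ^ (toℕ i) (θ zero) - σ^ (toℕ (k zero)) (θ zero)) * factors (k ∘ suc) (θ ∘ suc) i

    -- When the factor of `θ zero` is multiplied out, one summand absorbs `θ zero` into `b` and the
    -- other is a scalar multiple; hence precisely the products of subsets occur.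
    eliminate : ∀ {m} (k : Fin m → Fin n) (θ : Fin m → Carrier) b →
                ListAll.All (λ a → W (conjugates (a * b))) (subsetProducts θ) →
                W (λ i → factors k θ i * conjugates b i)
    eliminate {zero}  k θ b (h ∷ []) = W-≋ (λ i → trans (IsHom.⟨*⟩ (σ^-hom (toℕ i)) 1# b) (*-congʳ (IsHom.⟨1⟩ (σ^-hom (toℕ i))))) h
    eliminate {suc m} k θ b h = W-≋ eq (W-+ (eliminate (k ∘ suc) (θ ∘ suc) (θ zero * b) with-θ)
                                              (W-* (- σ^ (toℕ (k zero)) (θ zero)) (eliminate (k ∘ suc) (θ ∘ suc) b without-θ)))
      where
      Ps = subsetProducts (θ ∘ suc)
      without-θ : ListAll.All (λ a → W (conjugates (a * b))) Ps
      without-θ = ListAll.++⁻ˡ Ps h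
      with-θ : ListAll.All (λ a → W (conjugates (a * (θ zero * b)))) Ps
      with-θ = ListAll.map (λ {a} → W-≋ (λ i → IsHom.⟨cong⟩ (σ^-hom (toℕ i))
        (solve 3 (λ t a b → (t :* a) :* b := a :* (t :* b)) refl (θ zero) a b))) (ListAll.map⁻ (ListAll.++⁻ʳ Ps h))
      eq : ∀ i → factors (k ∘ suc) (θ ∘ suc) i * conjugates (θ zero * b) i
                 + (- σ^ (toℕ (k zero)) (θ zero)) * (factors (k ∘ suc) (θ ∘ suc) i * conjugates b i)
                 ≈ factors k θ i * conjugates b i
      eq i = trans (+-congʳ (*-congˡ (IsHom.⟨*⟩ (σ^-hom (toℕ i)) (θ zero) b)))
        (solve 4 (λ f x y b → f :* (x :* b) :+ (:- y) :* (f :* b) := ((x :- y) :* f) :* b) refl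
           (factors (k ∘ suc) (θ ∘ suc) i) (σ^ (toℕ i) (θ zero)) (σ^ (toℕ (k zero)) (θ zero)) (σ^ (toℕ i) b))

    factors-0 : ∀ {m} (k : Fin m → Fin n) θ x → factors k θ (k x) ≈ 0#
    factors-0 k θ zero    = trans (*-congʳ (-‿inverseʳ _)) (zeroˡ _)
    factors-0 k θ (suc x) = trans (*-congˡ (factors-0 (k ∘ suc) (θ ∘ suc) x)) (zeroʳ _)

    factors-≉0 : ∀ {m} (k : Fin m → Fin n) θ i → (∀ x → ¬ (σ^ (toℕ i) (θ x) - σ^ (toℕ (k x)) (θ x) ≈ 0#)) → ¬ (factors k θ i ≈ 0#)
    factors-≉0 {zero}  k θ i h p = 1≉0 p
    factors-≉0 {suc m} k θ i h p = factors-≉0 (k ∘ suc) (θ ∘ suc) i (h ∘ suc) (*-unit-cancel (h zero) p)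

  e-≡ : ∀ {D} (i : Fin D) → e i i ≈ 1#
  e-≡ zero    = refl
  e-≡ (suc i) = e-≡ i

  e-≢ : ∀ {D} (i j : Fin D) → ¬ i ≡ j → e i j ≈ 0#
  e-≢ zero    zero    p = ⊥-elim (p ≡.refl)
  e-≢ zero    (suc j) p = refl
  e-≢ (suc i) zero    p = refl
  e-≢ (suc i) (suc j) p = e-≢ i j (p ∘ ≡.cong suc)

  private
    others : ∀ {m} → m ≡ n → Fin m → Fin (ℕ.pred m) → Fin m
    others {suc m} _ i x = punchIn i x

    others-≢ : ∀ {m} (eq : m ≡ n) i x → ¬ i ≡ others eq i x
    others-≢ {suc m} _ i x p = Fin.punchInᵢ≢i i x (≡.sym p)

    others-all : ∀ {m} (eq : m ≡ n) i k → ¬ i ≡ k → ∃ λ x → others eq i x ≡ k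
    others-all {suc m} _ i k p = punchOut p , Fin.punchIn-punchOut p

    separators : Fin n → Fin (ℕ.pred n) → Carrier
    separators i x = proj₁ (separate i (others ≡.refl i x) (others-≢ ≡.refl i x))

  arguments : List Carrier
  arguments = List.concat (List.tabulate (λ i → subsetProducts (separators i)))

  -- A finite version of the isomorphism of L ⊗ L with Lⁿ: the elements 1 ⊗ a with `a` in
  -- `arguments` already span over the left factor.
  conjugates-span : ∀ {w} {W : V n → Set w} → (∀ {v v′} → v ≋ v′ → W v → W v′) →
                    (∀ {v v′} → W v → W v′ → W (v ⊞ v′)) → (∀ a {v} → W v → W (a ⊡ v)) →
                    ListAll.All (λ a → W (conjugates a)) arguments → ∀ i → W (e i)
  conjugates-span {W = W} W-≋ W-+ W-* h i = W-≋ eq (W-* y (eliminate W-≋ W-+ W-* (others ≡.refl i) (separators i) 1# (ListAll.map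
      (λ {a} → W-≋ (λ j → IsHom.⟨cong⟩ (σ^-hom (toℕ j)) (sym (*-identityʳ a)))) (ListAll.tabulate⁻ (ListAll.concat⁻ h) i))))
    where
    f = factors W-≋ W-+ W-* (others ≡.refl i) (separators i)
    unit = inverse (f i) (factors-≉0 W-≋ W-+ W-* (others ≡.refl i) (separators i) i
      (λ x → proj₂ (separate i (others ≡.refl i x) (others-≢ ≡.refl i x))))
    y = proj₁ unit
    eq : ∀ j → y * (f j * conjugates 1# j) ≈ e i j
    eq j with i Fin.≟ j
    ... | yes ≡.refl = begin
      y * (f i * conjugates 1# i)   ≈⟨ *-congˡ (trans (*-congˡ (IsHom.⟨1⟩ (σ^-hom (toℕ i)))) (*-identityʳ _)) ⟩
      y * f i                       ≈⟨ trans (*-comm _ _) (proj₂ unit) ⟩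
      1#                            ≈⟨ e-≡ i ⟨
      e i i                         ∎
    ... | no i≢j with others-all ≡.refl i j i≢j
    ...   | x , ≡.refl = begin
      y * (f j * conjugates 1# j)   ≈⟨ *-congˡ (trans (*-congʳ (factors-0 W-≋ W-+ W-* (others ≡.refl i) (separators i) x)) (zeroˡ _)) ⟩
      y * 0#                        ≈⟨ zeroʳ y ⟩
      0#                            ≈⟨ e-≢ i j i≢j ⟨
      e i j                         ∎

-- Scalar extension of the module to L ⊗ M

-- Extension of scalars along K → L of a space with an operator, where
-- L ⊗ L is identified with L ⁿ through the powers of σ.
module ScalarExtension {c ℓ} (S : CyclicSetup c ℓ) {d : ℕ} (cols : Fin d → Vectors.V (CyclicSetup.L S) d) where
  open CyclicSetup S hiding (zero)
  open Vectors L
  open Skew S using (KPoly)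
  open Galois S
  open Dedekind S
  open Spans L
  open Polynomials S
  open BlockDiagonal L using (blockwise; blockwise-linear)
  open RingSolver L
  open import Relation.Binary.Reasoning.Setoid setoid

  flat : (Fin n → V d) → V (n ℕ.* d)
  flat = BlockDiagonal.flat L {n} {d}

  unflat : V (n ℕ.* d) → Fin n → V d
  unflat = BlockDiagonal.unflat L {n} {d}

  twist : Fin n → V d → V d
  twist i = app (λ j k → σ^ (toℕ i) (cols j k))

  Z : V (n ℕ.* d) → V (n ℕ.* d)
  Z = blockwise twist

  previous : ∀ {m} → Fin m → Fin m
  previous {suc m} zero    = fromℕ m
  previous {suc m} (suc i) = inject₁ i

  -- This is `σ` on the left factor of L ⊗ M, where l ⊗ w has l σⁱ(w) as its i-th component; it
  -- fixes 1 ⊗ w, which is `ι w`.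
  Σ : V (n ℕ.* d) → V (n ℕ.* d)
  Σ v = flat (λ i k → σ (unflat v (previous i) k))

  ι : V d → V (n ℕ.* d)
  ι w = flat (λ i k → σ^ (toℕ i) (w k))

  Z-linear : IsLinear Z
  Z-linear = blockwise-linear twist (λ i → app-linear (λ j k → σ^ (toℕ i) (cols j k)))

  Σ-semilinear : IsSemilinear σ Σ
  Σ-semilinear = record
    { ⟨cong⟩ = λ p k → σ-cong (p (source k)) ; ⟨+⟩ = λ v w k → σ-+ (v (source k)) (w (source k)) ; ⟨*⟩ = λ a v k → σ-* a (v (source k)) }
    where source = λ k → combine (previous (proj₁ (remQuot {n} d k))) (proj₂ (remQuot {n} d k))

  unflat-flat : ∀ (m : Fin n → V d) i j → unflat (flat m) i j ≡ m i j
  unflat-flat m i j = ≡.cong (uncurry m) (Fin.remQuot-combine i j)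

  flat-unflat : ∀ v k → flat (unflat v) k ≡ v k
  flat-unflat v k = ≡.cong v (Fin.combine-remQuot {n} d k)

  -- At index zero the predecessor is the last power, and the hypothesis on the m-th power closes
  -- the cycle.
  σ^-previous : ∀ {m} (i : Fin m) → (∀ a → σ^ m a ≈ a) → ∀ a → σ (σ^ (toℕ (previous i)) a) ≈ σ^ (toℕ i) a
  σ^-previous {suc m} zero    h a = trans (reflexive (≡.cong (λ k → σ (σ^ k a)) (Fin.toℕ-fromℕ m))) (h a)
  σ^-previous {suc m} (suc i) h a = reflexive (≡.cong (λ k → σ (σ^ k a)) (Fin.toℕ-inject₁ i))

  app-hom : ∀ {φ} → IsHom L L φ → ∀ (f : Fin d → V d) v → (λ k → φ (app f v k)) ≋ app (λ j k → φ (f j k)) (φ ∘ v)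
  app-hom H f v k = trans (DetHom.sum-hom H (λ j → v j * f j k)) (sum-cong-≋ (λ j → IsHom.⟨*⟩ H (v j) (f j k)))

  ΣZ : ∀ v → Σ (Z v) ≋ Z (Σ v)
  ΣZ v k = block (proj₁ (remQuot {n} d k)) (proj₂ (remQuot {n} d k))
    where
    block : ∀ i j → σ (unflat (Z v) (previous i) j) ≈ twist i (unflat (Σ v) i) j
    block i j = begin
      σ (unflat (Z v) (previous i) j)
        ≡⟨ ≡.cong σ (unflat-flat (λ i → twist i (unflat v i)) (previous i) j) ⟩
      σ (twist (previous i) (unflat v (previous i)) j)
        ≈⟨ app-hom σ-hom (λ j k → σ^ (toℕ (previous i)) (cols j k)) _ j ⟩
      app (λ j k → σ (σ^ (toℕ (previous i)) (cols j k))) (λ j → σ (unflat v (previous i) j)) j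
        ≈⟨ sum-cong-≋ (λ j′ → *-cong (reflexive (≡.sym (unflat-flat (λ i k → σ (unflat v (previous i) k)) i j′))) (σ^-previous i σ^n≈id _)) ⟩
      twist i (unflat (Σ v) i) j ∎

  Σι : ∀ w → Σ (ι w) ≋ ι w
  Σι w k = block (proj₁ (remQuot {n} d k)) (proj₂ (remQuot {n} d k))
    where
    block : ∀ i j → σ (unflat (ι w) (previous i) j) ≈ σ^ (toℕ i) (w j)
    block i j = trans (reflexive (≡.cong σ (unflat-flat (λ i k → σ^ (toℕ i) (w k)) (previous i) j))) (σ^-previous i σ^n≈id (w j))

  -- The i-th component is the i-th conjugate of the relation for `w`, and conjugation fixes the
  -- coefficients of `F`.
  ev-ι : ∀ {F} → KPoly F → (∀ w → ev (app cols) F w ≋ 𝟎) → ∀ w → ev Z F (ι w) ≋ 𝟎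
  ev-ι {F} F∈K FY w k = begin
    ev Z F (ι w) k
      ≡⟨ flat-unflat (ev Z F (ι w)) k ⟨
    flat (unflat (ev Z F (ι w))) k
      ≈⟨ block (proj₁ (remQuot {n} d k)) (proj₂ (remQuot {n} d k)) ⟩
    0# ∎
    where
    block : ∀ i j → unflat (ev Z F (ι w)) i j ≈ 0#
    block i j = begin
      unflat (ev Z F (ι w)) i j
        ≈⟨ Eval.ev-commute (linear⇒semilinear Z-linear) {t = λ v → unflat v i}
             (record { ⟨cong⟩ = λ p k → p (combine i k) ; ⟨+⟩ = λ _ _ _ → refl ; ⟨*⟩ = λ _ _ _ → refl })
             (IsLinear.⟨cong⟩ (app-linear twisted)) (λ v k → reflexive (unflat-flat (λ i → twist i (unflat v i)) i k)) F (ι w) j ⟩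
      ev (twist i) (mapₗ id F) (unflat (ι w) i) j
        ≈⟨ T.ev-≋ (mapₗ id F) (mapₗ (σ^ (toℕ i)) F) (λ k → trans (coeff-map refl F k)
             (trans (sym (fixed (toℕ i) (F∈K k))) (sym (coeff-map (IsHom.⟨0⟩ (σ^-hom (toℕ i))) F k)))) j ⟩
      ev (twist i) (mapₗ (σ^ (toℕ i)) F) (unflat (ι w) i) j
        ≈⟨ T.ev-cong (mapₗ (σ^ (toℕ i)) F) (λ k → reflexive (unflat-flat (λ i k → σ^ (toℕ i) (w k)) i k)) j ⟩
      ev (twist i) (mapₗ (σ^ (toℕ i)) F) (σ^ (toℕ i) ∘ w) j
        ≈⟨ Eval.ev-commute (linear⇒semilinear (app-linear cols)) {t = σ^ (toℕ i) ∘_}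
             (record { ⟨cong⟩ = λ p k → IsHom.⟨cong⟩ H (p k) ; ⟨+⟩ = λ _ _ k → IsHom.⟨+⟩ H _ _ ; ⟨*⟩ = λ _ _ k → IsHom.⟨*⟩ H _ _ })
             (IsLinear.⟨cong⟩ (app-linear twisted)) (λ v → app-hom H cols v) F w j ⟨
      σ^ (toℕ i) (ev (app cols) F w j)
        ≈⟨ trans (IsHom.⟨cong⟩ H (FY w j)) (IsHom.⟨0⟩ H) ⟩
      0# ∎
      where
      H = σ^-hom (toℕ i)
      twisted = λ j k → σ^ (toℕ i) (cols j k)
      module T = Eval (linear⇒semilinear (app-linear twisted))
      fixed : ∀ m {a} → σ a ≈ a → σ^ m a ≈ a
      fixed zero    p = refl
      fixed (suc m) p = trans (σ-cong (fixed m p)) p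

  N : ℕ
  N = length arguments ℕ.* d

  -- No K-basis of M is at hand; these finitely many vectors are chosen so that their images under
  -- `ι` span over L.
  generator : Fin N → V d
  generator a = lookup arguments (proj₁ (remQuot {length arguments} d a)) ⊡ e (proj₂ (remQuot {length arguments} d a))

  private
    lookup⇒All : ∀ {a p} {A : Set a} {P : A → Set p} (xs : List A) → (∀ i → P (lookup xs i)) → ListAll.All P xs
    lookup⇒All []       h = []
    lookup⇒All (x ∷ xs) h = h zero ∷ lookup⇒All xs (h ∘ suc)

  σ^-e : ∀ m {D} (j : Fin D) k → σ^ m (e j k) ≈ e j k
  σ^-e m zero    zero    = IsHom.⟨1⟩ (σ^-hom m)
  σ^-e m zero    (suc k) = IsHom.⟨0⟩ (σ^-hom m)
  σ^-e m (suc j) zero    = IsHom.⟨0⟩ (σ^-hom m)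
  σ^-e m (suc j) (suc k) = σ^-e m j k

  spanning : ∀ {m} (vs : Vec (V (n ℕ.* d)) m) → (∀ a → Span vs (ι (generator a))) → ∀ v → Span vs v
  spanning vs h v = span-≋ (λ k → trans (∑C k) (reflexive (flat-unflat v k))) (span-∑ (λ j → anyC j (λ i → unflat v i j)))
    where
    -- `C j c` is the tensor of `c`, seen in Lⁿ, with the j-th basis vector of M; for the conjugates
    -- of `a` it is `ι` of a multiple of that basis vector.
    C : Fin d → V n → V (n ℕ.* d)
    C j c = flat (λ i → c i ⊡ e j)
    span-∑ : ∀ {m} {w : Fin m → V (n ℕ.* d)} → (∀ j → Span vs (w j)) → Span vs (λ k → sum (λ j → w j k))
    span-∑ {zero}  h = span-0
    span-∑ {suc m} h = span-+ (h zero) (span-∑ (h ∘ suc))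
    onC : ∀ j → ListAll.All (λ a → Span vs (C j (conjugates a))) arguments
    onC j = lookup⇒All arguments λ x → span-≋
      (λ k → trans (reflexive (≡.cong (λ y → ι (lookup arguments (proj₁ y) ⊡ e (proj₂ y)) k) (Fin.remQuot-combine x j)))
        (trans (IsHom.⟨*⟩ (σ^-hom (toℕ (proj₁ (remQuot {n} d k)))) _ _) (*-congˡ (σ^-e (toℕ (proj₁ (remQuot {n} d k))) j _))))
      (h (combine x j))
    stdC : ∀ j i → Span vs (C j (e i))
    stdC j = conjugates-span {W = λ c → Span vs (C j c)}
      (λ p → span-≋ (λ k → *-congʳ (p (proj₁ (remQuot {n} d k)))))
      (λ p q → span-≋ (λ k → sym (distribʳ _ _ _)) (span-+ p q))
      (λ a p → span-≋ (λ k → sym (*-assoc _ _ _)) (span-* a p)) (onC j)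
    anyC : ∀ j c → Span vs (C j c)
    anyC j c = span-≋ (λ k → begin
        sum (λ i → c i * C j (e i) k)           ≈⟨ sum-cong-≋ (λ i → sym (*-assoc (c i) _ _)) ⟩
        sum (λ i → (c i * e i (proj₁ (remQuot {n} d k))) * e j (proj₂ (remQuot {n} d k))) ≈⟨ *-distribʳ-sum _ (λ i → c i * e i (proj₁ (remQuot {n} d k))) ⟨
        sum (λ i → c i * e i (proj₁ (remQuot {n} d k))) * e j (proj₂ (remQuot {n} d k)) ≈⟨ *-congʳ (∑-e c _) ⟨
        C j c k ∎)
      (span-∑ (λ i → span-* (c i) (stdC j i)))
      where open import Algebra.Properties.Semiring.Sum semiring using (*-distribʳ-sum)
    ∑C : ∀ k → sum (λ j → C j (λ i → unflat v i j) k) ≈ flat (unflat v) k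
    ∑C k = sym (∑-e (unflat v (proj₁ (remQuot {n} d k))) (proj₂ (remQuot {n} d k)))

-- The module R / R g and the determinant of xⁿ

-- The left R-module R / R g for g monic of degree 1 + d′, with L-basis
-- 1, x, …, x ^ d′, on which x acts as a σ-semilinear companion operator.
module Companion {c ℓ} (S : CyclicSetup c ℓ) (g : Skew.Poly S) (d′ : ℕ) (g-monic : Skew.MonicDeg S g (suc d′)) where
  open CyclicSetup S hiding (zero)
  open Skew S using (Poly; coeff; KPoly; _⊕_; _·_; pow; normAux; Norm)
  open Galois S
  open Vectors L
  open Alternating L
  open Spans L
  open Polynomials S
  open RingSolver L
  open import Relation.Binary.Reasoning.Setoid setoid

  private
    d = suc d′

  top : V d → Carrier
  top w = w (fromℕ d′)

  shift : V d → V d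
  shift w zero    = 0#
  shift w (suc i) = w (inject₁ i)

  -- Reduction of the d-th power of x modulo the left ideal of `g`, for coordinates to which `σ` has
  -- already been applied.
  C : V d → V d
  C w i = shift w i - top w * coeff g (toℕ i)

  C-linear : IsLinear C
  C-linear = record
    { ⟨cong⟩ = λ p i → +-cong (shift-cong p i) (-‿cong (*-congʳ (p _)))
    ; ⟨+⟩ = λ v w i → trans (+-congʳ (shift-+ v w i))
        (solve 5 (λ a b x y g → (a :+ b) :- (x :+ y) :* g := (a :- x :* g) :+ (b :- y :* g)) refl (shift v i) (shift w i) (top v) (top w) _)
    ; ⟨*⟩ = λ a v i → trans (+-congʳ (shift-* a v i))
        (solve 4 (λ a b x g → a :* b :- (a :* x) :* g := a :* (b :- x :* g)) refl a (shift v i) (top v) _) }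
    where
    shift-cong : ∀ {v w} → v ≋ w → shift v ≋ shift w
    shift-cong p zero    = refl
    shift-cong p (suc i) = p (inject₁ i)
    shift-+ : ∀ v w → shift (v ⊞ w) ≋ shift v ⊞ shift w
    shift-+ v w zero    = sym (+-identityʳ 0#)
    shift-+ v w (suc i) = refl
    shift-* : ∀ a v → shift (a ⊡ v) ≋ a ⊡ shift v
    shift-* a v zero    = sym (zeroʳ a)
    shift-* a v (suc i) = refl

  x : V d → V d
  x v = C (σ ∘ v)

  x-semilinear : IsSemilinear σ x
  x-semilinear = record
    { ⟨cong⟩ = λ p → C.⟨cong⟩ (λ i → σ-cong (p i))
    ; ⟨+⟩ = λ v w i → trans (C.⟨cong⟩ (λ i → σ-+ (v i) (w i)) i) (C.⟨+⟩ (σ ∘ v) (σ ∘ w) i)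
    ; ⟨*⟩ = λ a v i → trans (C.⟨cong⟩ (λ i → σ-* a (v i)) i) (C.⟨*⟩ (σ a) (σ ∘ v) i) }
    where module C = IsLinear C-linear

  private
    module x = IsSemilinear x-semilinear
    module E = Eval x-semilinear

  iter-semilinear : ∀ k → IsSemilinear (σ^ k) (iter k x)
  iter-semilinear zero = record { ⟨cong⟩ = id ; ⟨+⟩ = λ _ _ _ → refl ; ⟨*⟩ = λ _ _ _ → refl }
  iter-semilinear (suc k) = record
    { ⟨cong⟩ = x.⟨cong⟩ ∘ I.⟨cong⟩
    ; ⟨+⟩ = λ v w i → trans (x.⟨cong⟩ (I.⟨+⟩ v w) i) (x.⟨+⟩ _ _ i)
    ; ⟨*⟩ = λ a v i → trans (x.⟨cong⟩ (I.⟨*⟩ a v) i) (x.⟨*⟩ _ _ i) }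
    where module I = IsSemilinear (iter-semilinear k)

  Y : V d → V d
  Y = iter n x

  Y-linear : IsLinear Y
  Y-linear = record { ⟨cong⟩ = I.⟨cong⟩ ; ⟨+⟩ = I.⟨+⟩ ; ⟨*⟩ = λ a v i → trans (I.⟨*⟩ a v i) (*-congʳ (σ^n≈id a)) }
    where module I = IsSemilinear (iter-semilinear n)

  toV : Poly → V d
  toV p i = coeff p (toℕ i)

  fromV : ∀ {m} → V m → Poly
  fromV v = List.tabulate v

  coeff-fromV : ∀ {m} (v : V m) i → coeff (fromV v) (toℕ i) ≡ v i
  coeff-fromV v zero    = ≡.refl
  coeff-fromV v (suc i) = coeff-fromV (v ∘ suc) i

  fromV-small : ∀ {m} (v : V m) → VanishFrom m (fromV v)
  fromV-small {zero}  v i _ = refl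
  fromV-small {suc m} v (suc i) (s≤s m≤i) = fromV-small (v ∘ suc) i m≤i

  private
    x-basis : ∀ j → suc j ℕ.< d → x (toV (monomial j 1#)) ≋ toV (monomial (suc j) 1#)
    x-basis j (s≤s j<d′) i = trans (+-cong (shifted i) (-‿cong (trans (*-congʳ top≈0) (zeroˡ _)))) (solve 1 (λ x → x :- :0 := x) refl _)
      where
      top≈0 : top (σ ∘ toV (monomial j 1#)) ≈ 0#
      top≈0 = trans (σ-cong (coeff-monomial-≢ j 1# (λ p → ℕ.<⇒≢ j<d′ (≡.trans (≡.sym p) (Fin.toℕ-fromℕ d′))))) σ-0
      σ-monomial : ∀ j i → σ (coeff (monomial j 1#) i) ≈ coeff (monomial j 1#) i
      σ-monomial zero    zero    = σ-1
      σ-monomial zero    (suc i) = σ-0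
      σ-monomial (suc j) zero    = σ-0
      σ-monomial (suc j) (suc i) = σ-monomial j i
      shifted : ∀ i → shift (σ ∘ toV (monomial j 1#)) i ≈ toV (monomial (suc j) 1#) i
      shifted zero    = refl
      shifted (suc i) = trans (reflexive (≡.cong (λ k → σ (coeff (monomial j 1#) k)) (Fin.toℕ-inject₁ i))) (σ-monomial j (toℕ i))

    coeff-replicate : ∀ j i → coeff (replicate j 0# ++ₗ []) i ≈ 0#
    coeff-replicate zero    i       = refl
    coeff-replicate (suc j) zero    = refl
    coeff-replicate (suc j) (suc i) = coeff-replicate j i

    coeff-shift-∷ : ∀ j a r i → a * coeff (monomial j 1#) i + coeff (replicate (suc j) 0# ++ₗ r) i ≈ coeff (replicate j 0# ++ₗ a ∷ r) i
    coeff-shift-∷ zero    a r zero    = trans (+-identityʳ _) (*-identityʳ a)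
    coeff-shift-∷ zero    a r (suc i) = trans (+-congʳ (zeroʳ a)) (+-identityˡ _)
    coeff-shift-∷ (suc j) a r zero    = trans (+-identityʳ _) (zeroʳ a)
    coeff-shift-∷ (suc j) a r (suc i) = coeff-shift-∷ j a r i

    -- While degrees stay below d no reduction takes place, so `r` acts by shifting its own
    -- coefficients.
    ev-basis : ∀ r j → j ℕ.< d → (∀ i → d ℕ.≤ i ℕ.+ j → coeff r i ≈ 0#) → ev x r (toV (monomial j 1#)) ≋ toV (replicate j 0# ++ₗ r)
    ev-basis [] j _ _ i = sym (coeff-replicate j (toℕ i))
    ev-basis (a ∷ r) j j<d z i = trans (+-congˡ (rest (ℕ.m≤n⇒m<n∨m≡n j<d))) (coeff-shift-∷ j a r (toℕ i))
      where
      rest : suc j ℕ.< d ⊎ suc j ≡ d → ev x r (x (toV (monomial j 1#))) i ≈ coeff (replicate (suc j) 0# ++ₗ r) (toℕ i)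
      rest (inj₁ 1+j<d) = trans (E.ev-cong r (x-basis j 1+j<d) i)
        (ev-basis r (suc j) 1+j<d (λ i d≤ → z (suc i) (ℕ.≤-trans d≤ (ℕ.≤-reflexive (ℕ.+-suc i j)))) i)
      rest (inj₂ ≡.refl) = trans (E.ev-zero r (λ i → z (suc i) (s≤s (ℕ.m≤n+m j i))) i)
        (sym (reflexive (coeff-shift-< (suc j) r (Fin.toℕ<n i))))

  one : V d
  one = toV (1# ∷ [])

  ev-one : ∀ r → VanishFrom d r → ev x r one ≋ toV r
  ev-one r z = ev-basis r 0 (s≤s z≤n) (λ i d≤ → z i (ℕ.≤-trans d≤ (ℕ.≤-reflexive (ℕ.+-identityʳ i))))

  ev-fromV : ∀ v → ev x (fromV v) one ≋ v
  ev-fromV v i = trans (ev-one (fromV v) (fromV-small v) i) (reflexive (coeff-fromV v i))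

  private
    x^d′ : iter d′ x one ≋ toV (monomial d′ 1#)
    x^d′ i = trans (trans (sym (*-identityˡ _)) (sym (E.ev-monomial d′ 1# one i)))
      (ev-one (monomial d′ 1#) (λ j d≤j → coeff-monomial-≢ d′ 1# (ℕ.<⇒≢ d≤j ∘ ≡.sym)) i)

    x^d : iter d x one ≋ (λ i → - coeff g (toℕ i))
    x^d i = trans (x.⟨cong⟩ x^d′ i) (trans (+-cong (shifted i) (-‿cong (trans (*-congʳ top≈1) (*-identityˡ _)))) (+-identityˡ _))
      where
      top≈1 : top (σ ∘ toV (monomial d′ 1#)) ≈ 1#
      top≈1 = trans (σ-cong (reflexive (≡.trans (≡.cong (coeff (monomial d′ 1#)) (Fin.toℕ-fromℕ d′)) (coeff-monomial d′ 1#)))) σ-1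
      shifted : ∀ i → shift (σ ∘ toV (monomial d′ 1#)) i ≈ 0#
      shifted zero    = refl
      shifted (suc i) = trans (σ-cong (coeff-monomial-≢ d′ 1# (λ p → ℕ.<⇒≢ (Fin.toℕ<n i) (≡.trans (≡.sym (Fin.toℕ-inject₁ i)) p)))) σ-0

  g-kills-one : ev x g one ≋ 𝟎
  g-kills-one i = begin
    ev x g one i
      ≈⟨ solve 2 (λ x y → x := (x :+ (:- :1) :* y) :+ y) refl _ (iter d x one i) ⟩
    (ev x g one i + - 1# * iter d x one i) + iter d x one i
      ≈⟨ +-cong (trans (+-congˡ (sym (E.ev-monomial d (- 1#) one i))) (sym (E.ev-⊕ g _ one i))) (x^d i) ⟩
    ev x r one i + - coeff g (toℕ i)
      ≈⟨ +-congʳ (trans (ev-one r r-small i) (trans (coeff-⊕ g _ (toℕ i))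
           (trans (+-congˡ (coeff-monomial-≢ d (- 1#) (ℕ.<⇒≢ (Fin.toℕ<n i)))) (+-identityʳ _)))) ⟩
    coeff g (toℕ i) + - coeff g (toℕ i)
      ≈⟨ -‿inverseʳ _ ⟩
    0# ∎
    where
    r = g ⊕ monomial d (- 1#)
    r-small : VanishFrom d r
    r-small = cancel-top {d} {g} (trans (+-congʳ (proj₁ g-monic)) (-‿inverseʳ 1#)) (proj₂ g-monic)

  ev-𝟎 : ∀ {D τ} {X : V D → V D} → IsSemilinear τ X → ∀ p → ev X p 𝟎 ≋ 𝟎
  ev-𝟎 XS []      i = refl
  ev-𝟎 {X = X} XS (a ∷ p) i = trans (+-cong (zeroʳ a) (trans (Eval.ev-cong XS p (semilinear-𝟎 XS) i) (ev-𝟎 XS p i))) (+-identityʳ 0#)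

  private
    module YL = IsLinear Y-linear
    YS = linear⇒semilinear Y-linear

  ev-Y-linear : ∀ p → IsLinear (ev Y p)
  ev-Y-linear p = record { ⟨cong⟩ = Eval.ev-cong YS p ; ⟨+⟩ = plus p ; ⟨*⟩ = scale p }
    where
    plus : ∀ p v w → ev Y p (v ⊞ w) ≋ ev Y p v ⊞ ev Y p w
    plus [] v w i = sym (+-identityʳ 0#)
    plus (a ∷ p) v w i = trans (+-congˡ (trans (Eval.ev-cong YS p (YL.⟨+⟩ v w) i) (plus p (Y v) (Y w) i)))
      (solve 5 (λ a v w x y → a :* (v :+ w) :+ (x :+ y) := (a :* v :+ x) :+ (a :* w :+ y)) refl a (v i) (w i) _ _)
    scale : ∀ p b v → ev Y p (b ⊡ v) ≋ b ⊡ ev Y p v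
    scale [] b v i = sym (zeroʳ b)
    scale (a ∷ p) b v i = trans (+-congˡ (trans (Eval.ev-cong YS p (YL.⟨*⟩ b v) i) (scale p b (Y v) i)))
      (solve 4 (λ a b v x → a :* (b :* v) :+ b :* x := b :* (a :* v :+ x)) refl a b (v i) _)

  -- The coefficients of `p` are fixed by `σ` and `Y` is a power of `x`, so evaluation at `Y`
  -- commutes with `x`.
  central : ∀ {p} → KPoly p → ∀ r v → ev Y p (ev x r v) ≋ ev x r (ev Y p v)
  central {p} p∈K r v i = trans
    (E.ev-commute (linear⇒semilinear (ev-Y-linear p)) x.⟨cong⟩ comm r v i)
    (E.ev-≋ (mapₗ id r) r (λ j → coeff-map refl r j) i)
    where
    comm : ∀ v → ev Y p (x v) ≋ x (ev Y p v)
    comm v i = sym (trans (Eval.ev-commute YS x-semilinear YL.⟨cong⟩ (λ v i → reflexive (≡.cong (λ w → w i) (≡.sym (iter-comm n x v)))) p v i)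
      (Eval.ev-≋ YS (mapₗ σ p) p (λ j → trans (coeff-map σ-0 p j) (p∈K j)) i))

  -- `one` generates the module, and a central element needs testing on a generator only.
  annihilator : ∀ {p} → KPoly p → ev Y p one ≋ 𝟎 → ∀ v → ev Y p v ≋ 𝟎
  annihilator {p} p∈K z v i = begin
    ev Y p v i                           ≈⟨ Eval.ev-cong YS p (ev-fromV v) i ⟨
    ev Y p (ev x (fromV v) one) i        ≈⟨ central {p} p∈K (fromV v) one i ⟩
    ev x (fromV v) (ev Y p one) i        ≈⟨ trans (E.ev-cong (fromV v) z i) (ev-𝟎 x-semilinear (fromV v) i) ⟩
    0#                                   ∎

  multiple-kills-one : ∀ {p q} → (∀ i → coeff p i ≈ coeff (q · g) i) → ev x p one ≋ 𝟎
  multiple-kills-one {p} {q} eq i = trans (E.ev-≋ p (q · g) eq i)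
    (trans (E.ev-mul q g one i) (trans (E.ev-cong q g-kills-one i) (ev-𝟎 x-semilinear q i)))

  γ : Carrier
  γ = pow (- 1#) d * coeff g 0

  -- All columns but the last have head zero, so the expansion along coordinate zero keeps one
  -- minor, the identity. Passing the other columns gives the sign.
  det-C : det (map C (std d)) ≈ γ
  det-C = begin
    det (map C (std d))
      ≡⟨ ≡.cong (λ vs → det {d} (map C vs)) (std-tabulate d) ⟩
    det (map C (tabulate (e {d})))
      ≡⟨ ≡.cong (det {d}) (≡.sym (Vec.tabulate-∘ C e)) ⟩
    det (tabulate (C ∘ e))
      ≈⟨ last-head d′ (C ∘ e) (det ∘ map tl) (λ i → trans (+-congˡ (-‿cong (trans (*-congʳ (e-top i)) (zeroˡ _)))) (-‿inverseʳ 0#)) ⟩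
    pow (- 1#) d′ * C (e (fromℕ d′)) zero * det (map tl (tabulate (C ∘ e ∘ inject₁)))
      ≈⟨ *-cong (*-congˡ (+-congˡ (-‿cong (trans (*-congʳ (Dedekind.e-≡ S (fromℕ d′))) (*-identityˡ _)))))
                (trans (reflexive (≡.cong (det {d′}) (≡.sym (Vec.tabulate-∘ tl (C ∘ e ∘ inject₁)))))
                (trans (alt-cong (det-alt {d′}) (pointwise _ _ lower)) (trans (reflexive (≡.cong (det {d′}) (≡.sym (std-tabulate d′)))) (det-std d′)))) ⟩
    pow (- 1#) d′ * (0# - coeff g 0) * 1#
      ≈⟨ solve 2 (λ p g → p :* (:0 :- g) :* :1 := ((:- :1) :* p) :* g) refl (pow (- 1#) d′) (coeff g 0) ⟩
    γ ∎
    where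
    last-head : ∀ {D} m (h : Fin (suc m) → V (suc D)) (f : Form (suc D) m) → (∀ i → h (inject₁ i) zero ≈ 0#) →
                expand zero f (tabulate h) ≈ pow (- 1#) m * h (fromℕ m) zero * f (tabulate (h ∘ inject₁))
    last-head zero h f z = *-congʳ (sym (*-identityˡ _))
    last-head (suc m) h f z = trans (+-cong (trans (*-congʳ (z zero)) (zeroˡ _)) (-‿cong (last-head m (h ∘ suc) _ (z ∘ suc))))
      (solve 3 (λ p h f → :0 :- p :* h :* f := ((:- :1) :* p) :* h :* f) refl _ _ _)
    pointwise : ∀ {m D} (v w : Fin m → V D) → (∀ i → v i ≋ w i) → Pointwise _≋_ (tabulate v) (tabulate w)
    pointwise {zero}  v w p = []
    pointwise {suc m} v w p = p zero ∷ pointwise (v ∘ suc) (w ∘ suc) (p ∘ suc)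
    e-top : ∀ {m} (i : Fin m) → e (inject₁ i) (fromℕ m) ≈ 0#
    e-top zero    = refl
    e-top (suc i) = e-top i
    e-inject : ∀ {m} (i j : Fin m) → e (inject₁ i) (inject₁ j) ≈ e i j
    e-inject zero    zero    = refl
    e-inject zero    (suc j) = refl
    e-inject (suc i) zero    = refl
    e-inject (suc i) (suc j) = e-inject i j
    lower : ∀ i → tl (C (e (inject₁ i))) ≋ e i
    lower i k = trans (+-cong (e-inject i k) (-‿cong (trans (*-congʳ (e-top i)) (zeroˡ _)))) (solve 1 (λ x → x :- :0 := x) refl _)

  det-x : ∀ vs → det (map x vs) ≈ γ * σ (det vs)
  det-x vs = begin
    det (map x vs)                            ≡⟨ ≡.cong (det {d}) (Vec.map-∘ C (σ ∘_) vs) ⟩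
    det (map C (map (σ ∘_) vs))               ≈⟨ det-map C-linear (map (σ ∘_) vs) ⟩
    det (map (σ ∘_) vs) * det (map C (std d)) ≈⟨ *-cong (sym (DetHom.det-hom σ-hom vs)) det-C ⟩
    σ (det vs) * γ                            ≈⟨ *-comm _ _ ⟩
    γ * σ (det vs)                            ∎

  -- Each application of `x` conjugates the determinant obtained so far and multiplies it by `γ`;
  -- after n of them the norm of `γ` has built up.
  det-iter : ∀ k vs → det (map (iter k x) vs) ≈ normAux k γ * σ^ k (det vs)
  det-iter zero vs = trans (reflexive (≡.cong (det {d}) (Vec.map-id vs))) (sym (*-identityˡ _))
  det-iter (suc k) vs = begin
    det (map (iter (suc k) x) vs)                ≡⟨ ≡.cong (det {d}) (Vec.map-∘ x (iter k x) vs) ⟩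
    det (map x (map (iter k x) vs))              ≈⟨ det-x _ ⟩
    γ * σ (det (map (iter k x) vs))              ≈⟨ *-congˡ (trans (σ-cong (det-iter k vs)) (σ-* _ _)) ⟩
    γ * (σ (normAux k γ) * σ^ (suc k) (det vs))  ≈⟨ *-congˡ (*-congʳ (σ-normAux k γ)) ⟩
    γ * (normAux k (σ γ) * σ^ (suc k) (det vs))  ≈⟨ solve 3 (λ a b c → a :* (b :* c) := (b :* a) :* c) refl γ _ _ ⟩
    (normAux k (σ γ) * γ) * σ^ (suc k) (det vs)  ≈⟨ *-congʳ (normAux-suc k γ) ⟨
    normAux (suc k) γ * σ^ (suc k) (det vs)      ∎

  det-Y : det (map Y (std d)) ≈ Norm γ
  det-Y = trans (det-iter n (std d)) (trans (*-congˡ (trans (IsHom.⟨cong⟩ (σ^-hom n) (det-std d)) (IsHom.⟨1⟩ (σ^-hom n)))) (*-identityʳ _))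

-- Reversed characteristic polynomials

module SeriesHom {c ℓ} (A : CommutativeRing c ℓ) where
  open CommutativeRing A hiding (zero)
  open PowerSeries A

  coefficientwise : ∀ {φ} → IsHom A A φ → IsHom seriesRing seriesRing (φ ∘_)
  coefficientwise {φ} H = record
    { ⟨cong⟩ = λ p i → H.⟨cong⟩ (p i) ; ⟨+⟩ = λ p q i → H.⟨+⟩ (p i) (q i) ; ⟨*⟩ = mult
    ; ⟨1⟩ = λ { zero → H.⟨1⟩ ; (suc _) → H.⟨0⟩ } }
    where
    module H = IsHom H
    mult : ∀ p q k → φ ((p ⋆ q) k) ≈ ((φ ∘ p) ⋆ (φ ∘ q)) k
    mult p q zero    = H.⟨*⟩ _ _
    mult p q (suc k) = trans (H.⟨+⟩ _ _) (+-cong (H.⟨*⟩ _ _) (mult (p ∘ suc) q k))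

  const-hom : IsHom A seriesRing const
  const-hom = record
    { ⟨cong⟩ = λ { p zero → p ; p (suc _) → refl }
    ; ⟨+⟩ = λ { a b zero → refl ; a b (suc _) → sym (+-identityʳ 0#) }
    ; ⟨*⟩ = λ { a b zero → refl ; a b (suc k) → sym (trans (const-⋆ a (const b) (suc k)) (zeroʳ a)) }
    ; ⟨1⟩ = λ { zero → refl ; (suc _) → refl } }

  head-hom : IsHom seriesRing A (λ p → p 0)
  head-hom = record { ⟨cong⟩ = λ p → p 0 ; ⟨+⟩ = λ _ _ → refl ; ⟨*⟩ = λ _ _ → refl ; ⟨1⟩ = refl }

  𝕋⋆-suc : ∀ p k → (𝕋 ⋆ p) (suc k) ≈ p k
  𝕋⋆-suc p k = trans (+-cong (zeroˡ _) (trans (const-⋆ 1# p k) (*-identityˡ _))) (+-identityˡ _)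

-- The reversed characteristic polynomial det (1 - T Z), as a power series.
module Characteristic {c ℓ} (A : CommutativeRing c ℓ) where
  open CommutativeRing A hiding (zero)
  open PowerSeries A
  open SeriesHom A
  open RingSolver A
  open Vectors A
  open Alternating A
  private
    B = seriesRing
    module B = CommutativeRing B
    module BV = Vectors B
    module BA = Alternating B
    module BS = RingSolver B

  embed : ∀ {D} → V D → BV.V D
  embed v i = const (v i)

  1-T : ∀ {D} → (Fin D → V D) → Fin D → BV.V D
  1-T cols j k = BV.e j k B.- 𝕋 ⋆ const (cols j k)

  characteristic : ∀ {D} → (Fin D → V D) → Series
  characteristic {D} cols = BA.det (tabulate {n = D} (1-T cols))

  app-1-T : ∀ {D} (cols : Fin D → V D) v → BV.app (1-T cols) (embed v) BV.≋ (λ k → const (v k) B.- 𝕋 ⋆ const (app cols v k))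
  app-1-T {D} cols v k = begin
    BV.sum (λ j → const (v j) ⋆ (BV.e j k B.- 𝕋 ⋆ const (cols j k)))
      ≈⟨ BV.sum-cong-≋ (λ j → BS.solve 4 (λ v e t c → v BS.:* (e BS.:- t BS.:* c) BS.:= v BS.:* e BS.:+ (BS.:- t) BS.:* (v BS.:* c)) B.refl (const (v j)) (BV.e j k) 𝕋 _) ⟩
    BV.sum (λ j → (const (v j) ⋆ BV.e j k) B.+ (B.- 𝕋) ⋆ (const (v j) ⋆ const (cols j k)))
      ≈⟨ BV.∑-distrib-+ (λ j → const (v j) ⋆ BV.e j k) _ ⟩
    BV.sum (λ j → const (v j) ⋆ BV.e j k) B.+ BV.sum (λ j → (B.- 𝕋) ⋆ (const (v j) ⋆ const (cols j k)))
      ≈⟨ B.+-cong (B.sym (BV.∑-e (embed v) k)) (B.sym (BV.*-distribˡ-sum (B.- 𝕋) (λ j → const (v j) ⋆ const (cols j k)))) ⟩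
    const (v k) B.+ (B.- 𝕋) ⋆ BV.sum (λ j → const (v j) ⋆ const (cols j k))
      ≈⟨ B.+-congˡ (B.*-congˡ (BV.sum-cong-≋ (λ j → B.sym (IsHom.⟨*⟩ const-hom (v j) (cols j k))))) ⟩
    const (v k) B.+ (B.- 𝕋) ⋆ BV.sum (λ j → const (v j * cols j k))
      ≈⟨ B.+-congˡ (B.*-congˡ (B.sym (DetHom.sum-hom const-hom (λ j → v j * cols j k)))) ⟩
    const (v k) B.+ (B.- 𝕋) ⋆ const (app cols v k)
      ≈⟨ BS.solve 3 (λ v t c → v BS.:+ (BS.:- t) BS.:* c BS.:= v BS.:- t BS.:* c) B.refl _ 𝕋 _ ⟩
    const (v k) B.- 𝕋 ⋆ const (app cols v k) ∎
    where open import Relation.Binary.Reasoning.Setoid B.setoid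

  e-const : ∀ {D} (j k : Fin D) → BV.e j k B.≈ const (e j k)
  e-const zero    zero    = B.refl
  e-const zero    (suc k) = B.sym (IsHom.⟨0⟩ const-hom)
  e-const (suc j) zero    = B.sym (IsHom.⟨0⟩ const-hom)
  e-const (suc j) (suc k) = e-const j k

  pointwise : ∀ {m} {r} {P : Set c} {Q : Set c} {R : P → Q → Set r} {v : Fin m → P} {w : Fin m → Q} → (∀ i → R (v i) (w i)) → Pointwise R (tabulate v) (tabulate w)
  pointwise = Pointwise.tabulate⁺

  characteristic-hom : ∀ {D φ} → IsHom A A φ → (cols : Fin D → V D) →
                       φ ∘ characteristic cols B.≈ characteristic (λ j k → φ (cols j k))
  characteristic-hom {D} {φ} H cols = B.trans (DetHom.det-hom Ĥ (tabulate (1-T cols)))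
    (B.trans (B.reflexive (≡.cong (BA.det {D}) (≡.sym (Vec.tabulate-∘ ((φ ∘_) ∘_) (1-T cols)))))
      (BA.alt-cong (BA.det-alt {D}) (pointwise λ j k →
        B.trans (Ĥ.⟨+⟩ (BV.e j k) _) (B.+-cong (e-fixed j k) (B.trans (Ĥ.⟨-⟩ (𝕋 ⋆ const (cols j k))) (B.-‿cong
          (B.trans (Ĥ.⟨*⟩ 𝕋 (const (cols j k))) (B.*-cong T-fixed (λ { zero → refl ; (suc _) → H.⟨0⟩ })))))))))
    where
    Ĥ = coefficientwise H
    module Ĥ = IsHom Ĥ
    module H = IsHom H
    T-fixed : (φ ∘ 𝕋) B.≈ 𝕋
    T-fixed zero = H.⟨0⟩
    T-fixed (suc zero) = H.⟨1⟩
    T-fixed (suc (suc _)) = H.⟨0⟩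
    e-fixed : ∀ {D} (j k : Fin D) → (φ ∘ BV.e j k) B.≈ BV.e j k
    e-fixed zero    zero    = Ĥ.⟨1⟩
    e-fixed zero    (suc k) = Ĥ.⟨0⟩
    e-fixed (suc j) zero    = Ĥ.⟨0⟩
    e-fixed (suc j) (suc k) = e-fixed j k

  characteristic-head : ∀ {D} (cols : Fin D → V D) → characteristic cols 0 ≈ 1#
  characteristic-head {D} cols = trans (DetHom.det-hom head-hom (tabulate (1-T cols)))
    (trans (reflexive (≡.cong (det {D}) (≡.sym (Vec.tabulate-∘ ((λ p → p 0) ∘_) (1-T cols)))))
    (trans (alt-cong (det-alt {D}) (pointwise λ j k → trans (+-congˡ (-‿cong (zeroˡ _))) (trans (solve 1 (λ x → x :- :0 := x) refl _) (e-const j k 0))))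
    (trans (reflexive (≡.cong (det {D}) (≡.sym (std-tabulate D)))) (det-std D))))

  top-1 : HasTop 0 (const 1#) 1#
  top-1 = refl , λ { (suc _) _ → refl }

  top-sub : ∀ {m p q s t} → HasTop m p s → HasTop m q t → HasTop m (p B.- q) (s - t)
  top-sub (a , b) (a′ , b′) = +-cong a (-‿cong a′) , λ i m<i → trans (+-cong (b i m<i) (-‿cong (b′ i m<i))) (-‿inverseʳ 0#)

  -- The grading of `DetRelation` counts the degree in T: each entry has degree at most one, with
  -- minus the matrix entry as its formal leading coefficient.
  characteristic-top : ∀ {D} (cols : Fin D → V D) → HasTop D (characteristic cols) (det (tabulate (λ j k → - cols j k)))
  characteristic-top {D} cols = DetRelation.det-related B A HasTop top-1 (λ {m} p q → top-⋆ 1 p q) top-sub (pointwise entry)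
    where
    e-high : ∀ {D} (j k : Fin D) i → BV.e j k (suc i) ≈ 0#
    e-high j k i = e-const j k (suc i)
    entry : ∀ j k → HasTop 1 (1-T cols j k) (- cols j k)
    entry j k = trans (+-cong (e-high j k 0) (-‿cong (𝕋⋆-suc (const (cols j k)) 0))) (+-identityˡ _)
              , λ { (suc zero) (s≤s ()) ; (suc (suc i)) _ → trans (+-cong (e-high j k (suc i)) (-‿cong (𝕋⋆-suc (const (cols j k)) (suc i)))) (-‿inverseʳ 0#) }

  -- The intertwining relation extends to the operators 1 - T Z over the series, and
  -- multiplicativity of the determinant is applied to both sides. Cancelling the determinant of `C`
  -- is left to the point of use.
  conjugate-characteristic : ∀ {D} (cols cols′ : Fin D → V D) {C : V D → V D} → IsLinear C →
    (∀ j → app cols (C (e j)) ≋ C (cols′ j)) →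
    ∀ i → det (map C (std D)) * characteristic cols i ≈ characteristic cols′ i * det (map C (std D))
  conjugate-characteristic {D} cols cols′ {C} CL comm i = begin
    γ * characteristic cols i                                ≈⟨ const-⋆ γ (characteristic cols) i ⟨
    (const γ ⋆ characteristic cols) i                        ≈⟨ B.*-cong γ≈ (P≈ cols) i ⟩
    (BA.det Ĉs ⋆ BA.det (map (Φ cols) (BV.std D))) i         ≈⟨ BA.det-map (BV.app-linear (1-T cols)) Ĉs i ⟨
    BA.det (map (Φ cols) Ĉs) i                               ≈⟨ BA.alt-cong (BA.det-alt {D}) exchange i ⟩
    BA.det (map Ĉ Φs) i                                      ≈⟨ BA.det-map ĈL Φs i ⟩
    (BA.det Φs ⋆ BA.det (map Ĉ (BV.std D))) i                ≈⟨ B.*-cong (B.refl {characteristic cols′}) (B.trans (B.reflexive (≡.cong (BA.det {D}) std≡)) (B.sym γ≈)) i ⟩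
    (characteristic cols′ ⋆ const γ) i                       ≈⟨ ⋆-comm (characteristic cols′) (const γ) i ⟩
    (const γ ⋆ characteristic cols′) i                       ≈⟨ const-⋆ γ (characteristic cols′) i ⟩
    γ * characteristic cols′ i                               ≈⟨ *-comm _ _ ⟩
    characteristic cols′ i * γ                               ∎
    where
    open import Relation.Binary.Reasoning.Setoid setoid
    γ = det (map C (std D))
    Φ = λ cols → BV.app (1-T {D} cols)
    Ĉ = BV.app (λ j → embed (C (e j)))
    ĈL = BV.app-linear (λ j → embed (C (e j)))
    Ĉs = tabulate (λ j → Ĉ (BV.e j))
    Φs = tabulate (1-T cols′)
    std≡ : map Ĉ (BV.std D) ≡ Ĉs
    std≡ = ≡.trans (≡.cong (map Ĉ) (BV.std-tabulate D)) (≡.sym (Vec.tabulate-∘ Ĉ BV.e))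
    Ĉ-embed : ∀ v → Ĉ (embed v) BV.≋ embed (C v)
    Ĉ-embed v k = B.trans (BV.sum-cong-≋ (λ j → B.sym (IsHom.⟨*⟩ const-hom (v j) (C (e j) k))))
      (B.trans (B.sym (DetHom.sum-hom const-hom (λ j → v j * C (e j) k))) (IsHom.⟨cong⟩ const-hom (sym (linear-∑ CL v k))))
    Ĉe : ∀ j → Ĉ (BV.e j) BV.≋ embed (C (e j))
    Ĉe j = BV.app-e (λ j → embed (C (e j))) j
    γ≈ : const γ B.≈ BA.det Ĉs
    γ≈ = B.trans (DetHom.det-hom const-hom (map C (std D)))
      (B.trans (B.reflexive (≡.cong (BA.det {D}) (≡.trans (≡.cong (map (const ∘_)) (≡.trans (≡.cong (map C) (std-tabulate D)) (≡.sym (Vec.tabulate-∘ C e))))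
        (≡.sym (Vec.tabulate-∘ (const ∘_) (C ∘ e))))))
      (BA.alt-cong (BA.det-alt {D}) (pointwise λ j k → B.sym (Ĉe j k))))
    P≈ : ∀ cols → characteristic cols B.≈ BA.det (map (Φ cols) (BV.std D))
    P≈ cols = B.sym (B.trans (B.reflexive (≡.cong (BA.det {D}) (≡.trans (≡.cong (map (Φ cols)) (BV.std-tabulate D)) (≡.sym (Vec.tabulate-∘ (Φ cols) BV.e)))))
      (BA.alt-cong (BA.det-alt {D}) (pointwise λ j → BV.app-e (1-T cols) j)))
    exchange : Pointwise BV._≋_ (map (Φ cols) Ĉs) (map Ĉ Φs)
    exchange = ≡.subst₂ (Pointwise BV._≋_) (Vec.tabulate-∘ (Φ cols) (λ j → Ĉ (BV.e j))) (Vec.tabulate-∘ Ĉ (1-T cols′)) (pointwise λ j k →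
      B.trans (BV.IsLinear.⟨cong⟩ (BV.app-linear (1-T cols)) (Ĉe j) k)
      (B.trans (app-1-T cols (C (e j)) k)
      (B.trans (B.+-cong (B.sym (Ĉe j k)) (B.trans (B.-‿cong (B.*-congˡ {𝕋} (IsHom.⟨cong⟩ const-hom (comm j k))))
        (B.trans (BS.solve 2 (λ t x → BS.:- (t BS.:* x) BS.:= (BS.:- t) BS.:* x) B.refl 𝕋 (const (C (cols′ j) k)))
                 (B.*-congˡ {B.- 𝕋} (B.sym (Ĉ-embed (cols′ j) k))))))
      (B.trans (B.+-congˡ {Ĉ (BV.e j) k} (B.sym (BV.IsLinear.⟨*⟩ ĈL (B.- 𝕋) (embed (cols′ j)) k)))
      (B.trans (B.sym (BV.IsLinear.⟨+⟩ ĈL (BV.e j) ((B.- 𝕋) BV.⊡ embed (cols′ j)) k))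
        (BV.IsLinear.⟨cong⟩ ĈL (λ k → B.+-congˡ {BV.e j k} (BS.solve 2 (λ t x → (BS.:- t) BS.:* x BS.:= BS.:- (t BS.:* x)) B.refl 𝕋 (const (cols′ j k)))) k))))))

-- The characteristic identity and the norm formula

module CastDet {c ℓ} (A : CommutativeRing c ℓ) where
  open CommutativeRing A hiding (zero)
  open Vectors A
  open Alternating A
  open Spans A

  -- The total length of the blocks and the dimension agree only by a proved equation, not by
  -- computation.
  det′ : ∀ {m D} → m ≡ D → Form D m
  det′ ≡.refl = det

  det′-alt : ∀ {m D} (eq : m ≡ D) → IsAlt (det′ eq)
  det′-alt ≡.refl = det-alt

  det′-map : ∀ {m D} (eq : m ≡ D) {t : V D → V D} → IsLinear t → ∀ vs → det′ eq (map t vs) ≈ det′ eq vs * det (map t (std D))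
  det′-map ≡.refl = det-map

  det′-independent : ¬ 1# ≈ 0# → ∀ {m D} (eq : m ≡ D) {vs : Vec (V D) m} → Independent vs → ¬ (det′ eq vs ≈ 0#)
  det′-independent 1≉0 ≡.refl = independent-det 1≉0

module CastDetHom {c ℓ c′ ℓ′} {A : CommutativeRing c ℓ} {B : CommutativeRing c′ ℓ′} {φ} (H : IsHom A B φ) where
  det′-hom : ∀ {m D} (eq : m ≡ D) vs → CommutativeRing._≈_ B (φ (CastDet.det′ A eq vs)) (CastDet.det′ B eq (map (φ ∘_) vs))
  det′-hom ≡.refl = DetHom.det-hom H

module CharacteristicIdentity {c ℓ} (S : CyclicSetup c ℓ) where
  open CyclicSetup S hiding (zero)
  open Skew S

  -- The common core of both parts. Irreducibility enters through three consequences: no proper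
  -- factor over K, a nonzero constant term, and reducedness of K.
  module _
    {F g q : Poly} {m k d′ : ℕ} (F∈K : KPoly F) (F-monic : MonicDeg F (suc m)) (noFactor : NoProperFactor S F (suc m))
    (F₀≉0 : ¬ (coeff F 0 ≈ 0#)) (reduced : ∀ {a} → InK a → a * a ≈ 0# → a ≈ 0#)
    (g-monic : MonicDeg g (suc d′)) (lift≋ : lift F ≋ (q · g)) (d≡sk : suc d′ ≡ suc m ℕ.* k) where

    private
      s = suc m
      d = suc d′

    open Galois S
    open Vectors L renaming (_≋_ to _≋ᵥ_)
    open Alternating L
    open Spans L
    open Polynomials S
    open RingSolver L
    open PowerSeries L
    open SeriesHom L
    open Characteristic L
    open Companion S g d′ g-monic

    private
      B = seriesRing
      module B = CommutativeRing B
      module BV = Vectors B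
      module BA = Alternating B
      module BC = Spans B
      module BS = RingSolver B
      module BD = BlockDiagonal B
      module BB = BlockDeterminant B 𝕋
      open module BK = Blocks B using () renaming (descending to descendingᴮ; concatBlocks to concatBlocksᴮ)
      open import Algebra.Properties.Semiring.Exp B.semiring using (_^_; ^-assocʳ)

    cols : Fin d → V d
    cols j = Y (e j)

    Y≋ : ∀ v → Y v ≋ᵥ app cols v
    Y≋ = linear-∑ Y-linear

    open ScalarExtension S cols
    open BlockDeterminant B 𝕋 using (horner)

    F-kills : ∀ w → ev (app cols) F w ≋ᵥ 𝟎
    F-kills w i = begin
      ev (app cols) F w i            ≈⟨ Eval.ev-≋ (linear⇒semilinear (app-linear cols)) F (mapₗ id F) (λ j → sym (coeff-map refl F j)) i ⟩
      ev (app cols) (mapₗ id F) w i  ≈⟨ Eval.ev-commute (linear⇒semilinear Y-linear) {t = id}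
                                         (record { ⟨cong⟩ = id ; ⟨+⟩ = λ _ _ _ → refl ; ⟨*⟩ = λ _ _ _ → refl })
                                         (IsLinear.⟨cong⟩ (app-linear cols)) Y≋ F w i ⟨
      ev Y F w i                     ≈⟨ annihilator {F} F∈K (λ i → trans (sym (ev-lift x-semilinear F one i)) (multiple-kills-one {lift F} {q} lift≋ i)) w i ⟩
      0#                             ∎
      where open import Relation.Binary.Reasoning.Setoid setoid

    open RationalBases.RationalBasis S {F} F∈K F-monic (s≤s z≤n) noFactor Z-linear Σ-semilinear ΣZ
      (ι ∘ generator) (Σι ∘ generator) (ev-ι {F} F∈K F-kills ∘ generator) (λ vs h i → spanning vs h (e i))

    -- F = y ^ s + r
    private
      r : Poly
      r = F ⊕ monomial s (- 1#)

      r-small : VanishFrom s r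
      r-small = cancel-top {s} {F} (trans (+-congʳ (proj₁ F-monic)) (-‿inverseʳ 1#)) (proj₂ F-monic)

      r₀ : coeff r 0 ≈ coeff F 0
      r₀ = trans (coeff-⊕ F _ 0) (+-identityʳ _)

      r∈K : KPoly r
      r∈K i = trans (σ-cong (coeff-⊕ F _ i)) (trans (σ-+ _ _) (trans (+-cong (F∈K i) (monomial∈K s i)) (sym (coeff-⊕ F _ i))))
        where
        monomial∈K : ∀ s i → σ (coeff (monomial s (- 1#)) i) ≈ coeff (monomial s (- 1#)) i
        monomial∈K zero    zero    = trans (σ-neg 1#) (-‿cong σ-1)
        monomial∈K zero    (suc i) = σ-0
        monomial∈K (suc s) zero    = σ-0
        monomial∈K (suc s) (suc i) = monomial∈K s i

    -- Listed from the top degree down, to match `descending`; this is where the reversal of `F`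
    -- originates.
    topCoeffs : ∀ j → Poly → V j
    topCoeffs (suc j) p zero    = coeff p j
    topCoeffs (suc j) p (suc i) = topCoeffs j p i

    topCoeffs-cong : ∀ j {p p′} → (∀ i → i ℕ.< j → coeff p i ≈ coeff p′ i) → topCoeffs j p ≋ᵥ topCoeffs j p′
    topCoeffs-cong (suc j) h zero    = h j ℕ.≤-refl
    topCoeffs-cong (suc j) h (suc i) = topCoeffs-cong j (λ i i<j → h i (ℕ.m<n⇒m<1+n i<j)) i

    open Blocks L using (descending)

    module _ {D} {X : V D → V D} (XL : IsLinear X) where
      private module E = Eval (linear⇒semilinear XL)

      ev-comb : ∀ j p {v} → VanishFrom j p → ev X p v ≋ᵥ comb (topCoeffs j p) (descending (λ i → iter i X v) j)
      ev-comb zero    p z = E.ev-zero p (λ i → z i z≤n)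
      ev-comb (suc j) p {v} z i = begin
        ev X p v i
          ≈⟨ solve 3 (λ x a y → x := a :* y :+ (x :+ (:- a) :* y)) refl _ (coeff p j) (iter j X v i) ⟩
        coeff p j * iter j X v i + (ev X p v i + (- coeff p j) * iter j X v i)
          ≈⟨ +-congˡ (trans (+-congˡ (sym (E.ev-monomial j (- coeff p j) v i))) (sym (E.ev-⊕ p _ v i))) ⟩
        coeff p j * iter j X v i + ev X p′ v i
          ≈⟨ +-congˡ (trans (ev-comb j p′ p′-small i)
               (IsLinear.⟨cong⟩ (comb-linear (descending (λ i → iter i X v) j)) (topCoeffs-cong j {p′} {p} p′-low) i)) ⟩
        coeff p j * iter j X v i + comb (topCoeffs j p) (descending (λ i → iter i X v) j) i ∎
        where
        open import Relation.Binary.Reasoning.Setoid setoid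
        p′ = p ⊕ monomial j (- coeff p j)
        p′-small : VanishFrom j p′
        p′-small = cancel-top {j} {p} (-‿inverseʳ _) z
        p′-low : ∀ i → i ℕ.< j → coeff p′ i ≈ coeff p i
        p′-low i i<j = trans (coeff-⊕ p _ i) (trans (+-congˡ (coeff-monomial-≢ j _ (ℕ.<⇒≢ i<j))) (+-identityʳ _))

    embed-comb : ∀ {m D} (α : V m) (vs : Vec (V D) m) → embed (comb α vs) BV.≋ BC.comb (const ∘ α) (map embed vs)
    embed-comb α []       k = IsHom.⟨0⟩ const-hom
    embed-comb α (v ∷ vs) k = B.trans (IsHom.⟨+⟩ const-hom _ _) (B.+-cong (IsHom.⟨*⟩ const-hom (α zero) (v k)) (embed-comb (α ∘ suc) vs k))

    map-descending : ∀ {D E} (t : V D → BV.V E) (b : ℕ → V D) j → map t (descending b j) ≡ descendingᴮ (t ∘ b) j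
    map-descending t b zero    = ≡.refl
    map-descending t b (suc j) = ≡.cong (t (b j) ∷_) (map-descending t b j)

    map-descendingᴮ : ∀ {D E} (t : BV.V D → BV.V E) (b : ℕ → BV.V D) j → map t (descendingᴮ b j) ≡ descendingᴮ (t ∘ b) j
    map-descendingᴮ t b zero    = ≡.refl
    map-descendingᴮ t b (suc j) = ≡.cong (t (b j) ∷_) (map-descendingᴮ t b j)

    -- 1 - T Z on the scalar extension.
    Φ : BV.V (n ℕ.* d) → BV.V (n ℕ.* d)
    Φ = BD.blockwise {n} {d} (λ i → BV.app (1-T (λ j k → σ^ (toℕ i) (cols j k))))

    Φ-linear : BV.IsLinear Φ
    Φ-linear = BD.blockwise-linear {n} {d} _ (λ i → BV.app-linear (1-T (λ j k → σ^ (toℕ i) (cols j k))))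

    Φ-embed : ∀ v → Φ (embed v) BV.≋ embed v BV.⊞ (B.- 𝕋) BV.⊡ embed (Z v)
    Φ-embed v k = B.trans (app-1-T (λ j l → σ^ (toℕ (proj₁ (remQuot {n} d k))) (cols j l)) (unflat v (proj₁ (remQuot {n} d k))) (proj₂ (remQuot {n} d k)))
      (B.trans (B.+-congʳ (B.reflexive (≡.cong const (flat-unflat v k))))
        (BS.solve 3 (λ v t z → v BS.:- t BS.:* z BS.:= v BS.:+ (BS.:- t) BS.:* z) B.refl (const (v k)) 𝕋 (const (Z v k))))

    b̂ ĉ : Fin N → ℕ → BV.V (n ℕ.* d)
    b̂ a j = embed (Z^ j ·u a)
    ĉ a j = Φ (b̂ a j)

    ĉ≋ : ∀ a j → ĉ a j BV.≋ b̂ a j BV.⊞ (B.- 𝕋) BV.⊡ b̂ a (suc j)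
    ĉ≋ a j = Φ-embed (Z^ j ·u a)

    -- The coordinates, in the block of `u`, of the image of its leading vector under 1 - T Z. The
    -- relation F(Z) u = 0 replaces the s-th power of Z by - r(Z), whence the plus sign.
    frev : BV.V s
    frev i = BV.e zero i B.+ 𝕋 ⋆ const (topCoeffs s r i)

    ĉ-top : ∀ a → ĉ a m BV.≋ BC.comb frev (descendingᴮ (b̂ a) s)
    ĉ-top a k = begin
      ĉ a m k
        ≈⟨ ĉ≋ a m k ⟩
      b̂ a m k B.+ (B.- 𝕋) ⋆ const ((Z^ s ·u a) k)
        ≈⟨ B.+-congˡ (B.*-congˡ {B.- 𝕋} (B.trans (IsHom.⟨cong⟩ const-hom Z^s) (IsHom.⟨-⟩ const-hom _))) ⟩
      b̂ a m k B.+ (B.- 𝕋) ⋆ (B.- const (ev Z r (ι (generator a)) k))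
        ≈⟨ B.+-cong (B.sym (B.trans (B.+-cong (B.*-identityˡ (b̂ a m k)) (BV.IsLinear.⟨0⟩ (BC.comb-linear bs) k)) (B.+-identityʳ _)))
            (B.trans (BS.solve 2 (λ t x → (BS.:- t) BS.:* (BS.:- x) BS.:= t BS.:* x) B.refl 𝕋 (const (ev Z r (ι (generator a)) k)))
              (B.*-congˡ {𝕋} embedded)) ⟩
      BC.comb (BV.e zero) (descendingᴮ (b̂ a) s) k B.+ 𝕋 ⋆ BC.comb (const ∘ topCoeffs s r) (descendingᴮ (b̂ a) s) k
        ≈⟨ B.+-congˡ (BV.IsLinear.⟨*⟩ (BC.comb-linear (descendingᴮ (b̂ a) s)) 𝕋 (const ∘ topCoeffs s r) k) ⟨
      BC.comb (BV.e zero) (descendingᴮ (b̂ a) s) k B.+ BC.comb (𝕋 BV.⊡ (const ∘ topCoeffs s r)) (descendingᴮ (b̂ a) s) k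
        ≈⟨ BV.IsLinear.⟨+⟩ (BC.comb-linear (descendingᴮ (b̂ a) s)) (BV.e zero) (𝕋 BV.⊡ (const ∘ topCoeffs s r)) k ⟨
      BC.comb frev (descendingᴮ (b̂ a) s) k ∎
      where
      open import Relation.Binary.Reasoning.Setoid B.setoid
      bs = descendingᴮ (b̂ a) m
      module E = Eval (linear⇒semilinear Z-linear)
      Z^s : (Z^ s ·u a) k ≈ - ev Z r (ι (generator a)) k
      Z^s = trans (solve 1 (λ x → x := :- (:0 :+ (:- :1) :* x)) refl _)
        (-‿cong (sym (trans (E.ev-⊕ F _ (ι (generator a)) k) (+-cong (ev-ι {F} F∈K F-kills (generator a) k) (E.ev-monomial s (- 1#) (ι (generator a)) k)))))
      embedded : const (ev Z r (ι (generator a)) k) B.≈ BC.comb (const ∘ topCoeffs s r) (descendingᴮ (b̂ a) s) k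
      embedded = B.trans (IsHom.⟨cong⟩ const-hom (ev-comb Z-linear s r r-small k))
        (B.trans (embed-comb (topCoeffs s r) (descending (λ i → iter i Z (ι (generator a))) s) k)
          (B.reflexive (≡.cong (λ vs → BC.comb (const ∘ topCoeffs s r) vs k) (map-descending embed (λ i → iter i Z (ι (generator a))) s))))

    -- The reversal T ^ s F (1 / T).
    Frev : Series
    Frev = horner frev

    private
      h : Series
      h = horner (const ∘ topCoeffs s r)

      horner-linear : ∀ {m} (v w : BV.V m) → horner (v BV.⊞ 𝕋 BV.⊡ w) B.≈ horner v B.+ 𝕋 ⋆ horner w
      horner-linear {zero}  v w = BS.solve 1 (λ t → BS.:0 BS.:= BS.:0 BS.:+ t BS.:* BS.:0) B.refl 𝕋
      horner-linear {suc m} v w = B.trans (B.+-congˡ {v zero B.+ 𝕋 ⋆ w zero} (B.*-congˡ {𝕋} (horner-linear (v ∘ suc) (w ∘ suc))))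
        (BS.solve 5 (λ v w t x y → (v BS.:+ t BS.:* w) BS.:+ t BS.:* (x BS.:+ t BS.:* y) BS.:= (v BS.:+ t BS.:* x) BS.:+ t BS.:* (w BS.:+ t BS.:* y)) B.refl
          (v zero) (w zero) 𝕋 _ _)

      horner-0 : ∀ m → horner {m} BV.𝟎 B.≈ B.0#
      horner-0 zero    = B.refl
      horner-0 (suc m) = B.trans (B.+-congˡ {B.0#} (B.*-congˡ {𝕋} (horner-0 m))) (BS.solve 1 (λ t → BS.:0 BS.:+ t BS.:* BS.:0 BS.:= BS.:0) B.refl 𝕋)

      -- The leading term of `F` becomes the constant term 1, which the uniqueness of roots
      -- requires.
      Frev≈ : Frev B.≈ const 1# B.+ 𝕋 ⋆ h
      Frev≈ = B.trans (horner-linear (BV.e zero) (const ∘ topCoeffs s r))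
        (B.+-congʳ (B.trans (B.+-congˡ {const 1#} (B.*-congˡ {𝕋} (horner-0 m))) (BS.solve 1 (λ t → BS.:1 BS.:+ t BS.:* BS.:0 BS.:= BS.:1) B.refl 𝕋)))

      Frev-suc : ∀ i → Frev (suc i) ≈ h i
      Frev-suc i = trans (Frev≈ (suc i)) (trans (+-identityˡ _) (𝕋⋆-suc h i))

      Frev-0 : Frev 0 ≈ 1#
      Frev-0 = trans (Frev≈ 0) (trans (+-congˡ (zeroˡ _)) (+-identityʳ 1#))

      horner-top : ∀ m p → HasTop m (horner (const ∘ topCoeffs (suc m) p)) (coeff p 0)
      horner-top zero p = trans (+-congˡ (zeroˡ _)) (+-identityʳ _)
        , λ { (suc i) _ → trans (+-congˡ (𝕋⋆-suc B.0# i)) (+-identityʳ 0#) }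
      horner-top (suc m) p = trans (+-identityˡ _) (trans (𝕋⋆-suc h′ m) (proj₁ (horner-top m p)))
        , λ { (suc i) (s≤s m<i) → trans (+-identityˡ _) (trans (𝕋⋆-suc h′ i) (proj₂ (horner-top m p) i m<i)) }
        where h′ = horner (const ∘ topCoeffs (suc m) p)

      horner∈K : ∀ m p → KPoly p → ∀ i → InK (horner (const ∘ topCoeffs m p) i)
      horner∈K zero    p p∈K i = σ-0
      horner∈K (suc m) p p∈K zero = trans (σ-+ _ _) (+-cong (p∈K m) (trans (σ-* 0# _) (trans (*-congʳ σ-0) (trans (zeroˡ _) (sym (zeroˡ _))))))
      horner∈K (suc m) p p∈K (suc i) = trans (σ-cong eq) (trans (horner∈K m p p∈K i) (sym eq))
        where eq = trans (+-identityˡ _) (𝕋⋆-suc (horner (const ∘ topCoeffs m p)) i)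

    Frev-top : HasTop s Frev (coeff F 0)
    Frev-top = trans (Frev-suc m) (trans (proj₁ (horner-top m r)) r₀)
      , λ { (suc i) (s≤s m<i) → trans (Frev-suc i) (proj₂ (horner-top m r) i m<i) }

    Frev∈K : ∀ i → InK (Frev i)
    Frev∈K zero    = trans (σ-cong Frev-0) (trans σ-1 (sym Frev-0))
    Frev∈K (suc i) = trans (σ-cong (Frev-suc i)) (trans (horner∈K s r r∈K i) (sym (Frev-suc i)))

    P : Series
    P = characteristic cols

    -- The constant term of `F` is the product of those of `q` and `g`, and `γ` is the latter up to
    -- sign.
    γ≉0 : ¬ (γ ≈ 0#)
    γ≉0 γ≈0 = F₀≉0 (begin
      coeff F 0              ≡⟨ coeff-lift F 0 ⟨
      coeff (lift F) 0       ≈⟨ lift≋ 0 ⟩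
      coeff (q · g) 0        ≈⟨ constant q ⟩
      coeff q 0 * coeff g 0  ≈⟨ trans (*-congˡ (*-unit-cancel (sign≉0 d) γ≈0)) (zeroʳ _) ⟩
      0#                     ∎)
      where
      open import Relation.Binary.Reasoning.Setoid setoid
      constant : ∀ q → coeff (q · g) 0 ≈ coeff q 0 * coeff g 0
      constant []      = sym (zeroˡ _)
      constant (a ∷ q) = coeff-mul-zero σ a q g
      sign≉0 : ∀ d → ¬ (pow (- 1#) d ≈ 0#)
      sign≉0 zero    p = 1≉0 p
      sign≉0 (suc d) p = sign≉0 d (trans (solve 1 (λ x → x := :- ((:- :1) :* x)) refl _) (trans (-‿cong p) (solve 0 (:- :0 := :0) refl)))

    -- `x` commutes with its power `Y`, so `C` intertwines the matrix of `Y` with its conjugate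
    -- under `σ`. Both matrices have the same characteristic series because the determinant of `C`
    -- is nonzero.
    P∈K : ∀ i → InK (P i)
    P∈K i = sym (x∙y⁻¹≈ε⇒x≈y _ _ (*-unit-cancel (γ≉0 ∘ trans (sym det-C)) (begin
      det (map C (std d)) * (P i - σ (P i))
        ≈⟨ solve 3 (λ c p q → c :* (p :- q) := c :* p :- q :* c) refl _ _ _ ⟩
      det (map C (std d)) * P i - σ (P i) * det (map C (std d))
        ≈⟨ +-congˡ (-‿cong (*-congʳ (characteristic-hom σ-hom cols i))) ⟩
      det (map C (std d)) * P i - characteristic (λ j k → σ (cols j k)) i * det (map C (std d))
        ≈⟨ +-congʳ (conjugate-characteristic cols (λ j k → σ (cols j k)) C-linear comm i) ⟩
      characteristic (λ j k → σ (cols j k)) i * det (map C (std d)) - characteristic (λ j k → σ (cols j k)) i * det (map C (std d))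
        ≈⟨ -‿inverseʳ _ ⟩
      0# ∎)))
      where
      open import Relation.Binary.Reasoning.Setoid setoid
      open import Algebra.Properties.AbelianGroup +-abelianGroup using (x∙y⁻¹≈ε⇒x≈y)
      comm : ∀ j → app cols (C (e j)) ≋ᵥ C (λ k → σ (cols j k))
      comm j k = begin
        app cols (C (e j)) k  ≈⟨ Y≋ (C (e j)) k ⟨
        Y (C (e j)) k         ≈⟨ IsLinear.⟨cong⟩ Y-linear (IsLinear.⟨cong⟩ C-linear (σ^-e 1 j)) k ⟨
        Y (x (e j)) k         ≡⟨ ≡.cong (λ v → v k) (iter-comm n x (e j)) ⟩
        C (λ k → σ (cols j k)) k ∎

    private
      prod-constant : ∀ {m} (p : BV.V m) {p₀} → (∀ i → p i B.≈ p₀) → BD.prod p B.≈ p₀ ^ m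
      prod-constant {zero}  p eq = B.refl
      prod-constant {suc m} p eq = B.*-cong (eq zero) (prod-constant (p ∘ suc) (eq ∘ suc))

      fixed : ∀ j {a} → InK a → σ^ j a ≈ a
      fixed zero    p = refl
      fixed (suc j) p = trans (σ-cong (fixed j p)) p

      det-app : ∀ {D} (c : Fin D → BV.V D) → BA.det (map (BV.app c) (BV.std D)) B.≈ BA.det (tabulate c)
      det-app {D} c = B.trans (B.reflexive (≡.cong (BA.det {D}) (≡.trans (≡.cong (map (BV.app c)) (BV.std-tabulate D)) (≡.sym (Vec.tabulate-∘ (BV.app c) BV.e)))))
        (BA.alt-cong (BA.det-alt {D}) (pointwise (BV.app-e c)))

    -- The i-th diagonal block contributes the i-th conjugate of `P`, and `P` is fixed by `σ`.
    det-Φ : BA.det (map Φ (BV.std (n ℕ.* d))) B.≈ P ^ n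
    det-Φ = B.trans (BD.det-blockwise {n} {d} _ (λ i → BV.app-linear (1-T (λ j k → σ^ (toℕ i) (cols j k)))))
      (prod-constant {n} _ (λ i → B.trans (det-app (1-T (λ j k → σ^ (toℕ i) (cols j k))))
        (B.trans (B.sym (characteristic-hom (σ^-hom (toℕ i)) cols)) (λ j → fixed (toℕ i) (P∈K j)))))

    private
      rank : k ℕ.* n ℕ.* s ≡ n ℕ.* d
      rank = ≡.trans (≡.cong (ℕ._* s) (ℕ.*-comm k n)) (≡.trans (ℕ.*-assoc n k s) (≡.cong (n ℕ.*_) (≡.trans (ℕ.*-comm k s) (≡.sym d≡sk))))

      open CastDet B using () renaming (det′ to det′ᴮ; det′-alt to det′ᴮ-alt; det′-map to det′ᴮ-map)
      open CastDet L using (det′; det′-independent)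

      map-concat : ∀ {D r} (t : V D → BV.V D) (b : Fin N → ℕ → V D) (T : Vec (Fin N) r) →
                   map t (Blocks.concatBlocks L (map (λ a → descending (b a) s) T)) ≡ concatBlocksᴮ (map (λ a → descendingᴮ (t ∘ b a) s) T)
      map-concat t b []      = ≡.refl
      map-concat t b (a ∷ T) = ≡.trans (Vec.map-++ t (descending (b a) s) _) (≡.cong₂ _++_ (map-descending t (b a) s) (map-concat t b T))

      map-concatᴮ : ∀ {D r} (t : BV.V D → BV.V D) (b : Fin N → ℕ → BV.V D) (T : Vec (Fin N) r) →
                    map t (concatBlocksᴮ (map (λ a → descendingᴮ (b a) s) T)) ≡ concatBlocksᴮ (map (λ a → descendingᴮ (t ∘ b a) s) T)
      map-concatᴮ t b []      = ≡.refl
      map-concatᴮ t b (a ∷ T) = ≡.trans (Vec.map-++ t (descendingᴮ (b a) s) _) (≡.cong₂ _++_ (map-descendingᴮ t (b a) s) (map-concatᴮ t b T))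

    δ : Vec (Fin N) (k ℕ.* n) → Carrier
    δ T = det′ rank (blocks T)

    -- The determinant of `Φ` applied to the candidate vectors is computed twice, by
    -- multiplicativity and block by block.
    δ-kills : ∀ T i → δ T * ((P ^ n) i - (Frev ^ (k ℕ.* n)) i) ≈ 0#
    δ-kills T i = begin
      δ T * ((P ^ n) i - (Frev ^ (k ℕ.* n)) i)
        ≈⟨ solve 3 (λ c p q → c :* (p :- q) := c :* p :- c :* q) refl _ _ _ ⟩
      δ T * (P ^ n) i - δ T * (Frev ^ (k ℕ.* n)) i
        ≈⟨ +-cong (sym (const-⋆ (δ T) (P ^ n) i)) (-‿cong (trans (sym (const-⋆ (δ T) _ i)) (⋆-comm (const (δ T)) _ i))) ⟩
      (const (δ T) ⋆ P ^ n) i - (Frev ^ (k ℕ.* n) ⋆ const (δ T)) i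
        ≈⟨ +-cong (B.*-cong δ̂ (B.sym det-Φ) i) (-‿cong (B.*-congˡ {Frev ^ (k ℕ.* n)} δ̂ i)) ⟩
      (det′ᴮ rank B̂ ⋆ BA.det (map Φ (BV.std (n ℕ.* d)))) i - (Frev ^ (k ℕ.* n) ⋆ det′ᴮ rank B̂) i
        ≈⟨ +-cong (sym (det′ᴮ-map rank Φ-linear B̂ i)) (-‿cong (sym (BB.blocks-det ĉ≋ s frev ĉ-top (det′ᴮ-alt rank) T i))) ⟩
      det′ᴮ rank (map Φ B̂) i - det′ᴮ rank Ĉ i
        ≡⟨ ≡.cong (λ vs → det′ᴮ rank vs i - det′ᴮ rank Ĉ i) (map-concatᴮ Φ b̂ T) ⟩
      det′ᴮ rank Ĉ i - det′ᴮ rank Ĉ i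
        ≈⟨ -‿inverseʳ _ ⟩
      0# ∎
      where
      open import Relation.Binary.Reasoning.Setoid setoid
      B̂ = concatBlocksᴮ (map (λ a → descendingᴮ (b̂ a) s) T)
      Ĉ = concatBlocksᴮ (map (λ a → descendingᴮ (ĉ a) s) T)
      δ̂ : const (δ T) B.≈ det′ᴮ rank B̂
      δ̂ = B.trans (CastDetHom.det′-hom const-hom rank (blocks T))
        (B.reflexive (≡.cong (det′ᴮ rank) (map-concat embed (λ a j → Z^ j ·u a) T)))

    -- That some `δ T` is nonzero is known only up to double negation; `common-annihilator` still
    -- removes the factors `δ T`.
    power-identity : P ^ n B.≈ (Frev ^ k) ^ n
    power-identity = B.trans (λ i → x∙y⁻¹≈ε⇒x≈y _ _ (common-annihilator (k ℕ.* n) δ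
        (λ δ≈0 → rational-basis (k ℕ.* n) (ℕ.≤-reflexive rank) (λ T ind → δ≈0 T (det′-independent 1≉0 rank ind)))
        (λ T → δ-kills T i))) (B.sym (^-assocʳ Frev k n))
      where open import Algebra.Properties.AbelianGroup +-abelianGroup using (x∙y⁻¹≈ε⇒x≈y)

    fixedField : ReducedSubring L InK
    fixedField = record
      { S-resp = λ p h → trans (σ-cong (sym p)) (trans h p)
      ; S-0 = σ-0 ; S-1 = σ-1
      ; S-+ = λ h h′ → trans (σ-+ _ _) (+-cong h h′)
      ; S-* = λ h h′ → trans (σ-* _ _) (*-cong h h′)
      ; S-neg = λ h → trans (σ-neg _) (-‿cong h)
      ; reduced = reduced }

    characteristic-identity : P B.≈ Frev ^ k
    characteristic-identity = SeriesRoots.root-unique fixedField n {{ℕ.>-nonZero (ℕ.≤-trans (s≤s z≤n) 2≤n)}} P∈K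
      (Roots.S-^ (SeriesRoots.seriesReduced fixedField) k Frev∈K) (characteristic-head cols) (SeriesRoots.^-head fixedField Frev-0 k) power-identity

    private
      top-^ : ∀ k {p t} → HasTop s p t → HasTop (k ℕ.* s) (p ^ k) (pow t k)
      top-^ zero    h = top-1
      top-^ (suc k) h = top-⋆ s h (top-^ k h)

      pow-+ : ∀ a i j → pow a (i ℕ.+ j) ≈ pow a i * pow a j
      pow-+ a zero    j = sym (*-identityˡ _)
      pow-+ a (suc i) j = trans (*-congˡ (pow-+ a i j)) (sym (*-assoc _ _ _))

      pow-* : ∀ a i j → pow a (i ℕ.* j) ≈ pow (pow a i) j
      pow-* a i zero = reflexive (≡.cong (pow a) (ℕ.*-zeroʳ i))
      pow-* a i (suc j) = trans (reflexive (≡.cong (pow a) (ℕ.*-suc i j))) (trans (pow-+ a i (i ℕ.* j)) (*-congˡ (pow-* a i j)))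

      pow-square : ∀ {a} → a * a ≈ 1# → ∀ j → pow a j * pow a j ≈ 1#
      pow-square p zero    = *-identityˡ 1#
      pow-square {a} p (suc j) = trans (solve 2 (λ a x → (a :* x) :* (a :* x) := (a :* a) :* (x :* x)) refl a _)
        (trans (*-cong p (pow-square p j)) (*-identityˡ 1#))

      σ^-pow : ∀ i j → σ^ i (pow (- 1#) j) ≈ pow (- 1#) j
      σ^-pow i j = fixed i (sign∈K j)
        where
        sign∈K : ∀ j → σ (pow (- 1#) j) ≈ pow (- 1#) j
        sign∈K zero    = σ-1
        sign∈K (suc j) = trans (σ-* _ _) (*-cong (trans (σ-neg 1#) (-‿cong σ-1)) (sign∈K j))

      normAux-sign : ∀ i j → normAux i (pow (- 1#) j) ≈ pow (pow (- 1#) j) i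
      normAux-sign zero    j = refl
      normAux-sign (suc i) j = *-cong (σ^-pow i j) (normAux-sign i j)

      det-neg : ∀ {D m} {f : Form D m} → IsAlt f → ∀ vs → f (map (- 1# ⊡_) vs) ≈ pow (- 1#) m * f vs
      det-neg F [] = sym (*-identityˡ _)
      det-neg F (v ∷ vs) = trans (HeadLinear.⟨*⟩ (headLinear F) _ _ _) (trans (*-congˡ (det-neg (partial F v) vs)) (sym (*-assoc _ _ _)))

    -- The coefficient of degree d in the identity: on one side the determinant of minus `Y`, on the
    -- other the k-th power of the leading coefficient of `Frev`.
    det-top : pow (- 1#) d * Norm γ ≈ pow (coeff F 0) k
    det-top = begin
      pow (- 1#) d * Norm γ                     ≈⟨ *-congˡ det-Y ⟨
      pow (- 1#) d * det (map Y (std d))        ≈⟨ det-neg (det-alt {d}) (map Y (std d)) ⟨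
      det (map (- 1# ⊡_) (map Y (std d)))       ≡⟨ ≡.cong (det {d}) (≡.trans (≡.cong (map (- 1# ⊡_)) (≡.trans (≡.cong (map Y) (std-tabulate d)) (≡.sym (Vec.tabulate-∘ Y e)))) (≡.sym (Vec.tabulate-∘ (- 1# ⊡_) (Y ∘ e)))) ⟩
      det (tabulate (λ j → - 1# ⊡ cols j))      ≈⟨ alt-cong (det-alt {d}) (pointwise λ j k → -1*x≈-x (cols j k)) ⟩
      det (tabulate (λ j k → - cols j k))       ≈⟨ proj₁ (characteristic-top cols) ⟨
      P d                                       ≈⟨ characteristic-identity d ⟩
      (Frev ^ k) d                              ≡⟨ ≡.cong (Frev ^ k) (≡.trans d≡sk (ℕ.*-comm s k)) ⟩
      (Frev ^ k) (k ℕ.* s)                      ≈⟨ proj₁ (top-^ k Frev-top) ⟩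
      pow (coeff F 0) k                         ∎
      where
      open import Relation.Binary.Reasoning.Setoid setoid
      open import Algebra.Properties.Ring ring using (-1*x≈-x)

    -- With `ε` the d-th power of -1, the norm of `γ` is that of the constant term times the n-th
    -- power of `ε`, and the leading coefficient brings one more `ε`. Since `ε` squares to 1, the
    -- exponent n + 1 may be lowered to n - 1.
    norm-formula : Norm (coeff g 0) ≈ pow (- 1#) (d ℕ.* (n ℕ.∸ 1)) * pow (coeff F 0) k
    norm-formula = begin
      Norm (coeff g 0)
        ≈⟨ cancel n 2≤n ⟩
      pow ε (n ℕ.∸ 1) * (ε * (pow ε n * Norm (coeff g 0)))
        ≈⟨ *-congˡ (*-congˡ (*-congʳ (normAux-sign n d))) ⟨
      pow ε (n ℕ.∸ 1) * (ε * (Norm ε * Norm (coeff g 0)))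
        ≈⟨ *-congˡ (*-congˡ (normAux-* n ε (coeff g 0))) ⟨
      pow ε (n ℕ.∸ 1) * (ε * Norm γ)
        ≈⟨ *-cong (sym (pow-* (- 1#) d (n ℕ.∸ 1))) det-top ⟩
      pow (- 1#) (d ℕ.* (n ℕ.∸ 1)) * pow (coeff F 0) k ∎
      where
      open import Relation.Binary.Reasoning.Setoid setoid
      ε = pow (- 1#) d
      ε² : ε * ε ≈ 1#
      ε² = pow-square (solve 0 ((:- :1) :* (:- :1) := :1) refl) d
      -- The lower bound presents n as a successor, which makes the truncated subtraction exact.
      cancel : ∀ n → 2 ℕ.≤ n → ∀ {x} → x ≈ pow ε (n ℕ.∸ 1) * (ε * (pow ε n * x))
      cancel (suc n) _ {x} = sym (trans (solve 3 (λ p e x → p :* (e :* ((e :* p) :* x)) := ((e :* e) :* (p :* p)) :* x) refl (pow ε n) ε x)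
        (trans (*-congʳ (trans (*-cong ε² (pow-square ε² n)) (*-identityˡ 1#))) (*-identityˡ x)))

-- Consequences of irreducibility

module Irreducibility {c ℓ} (S : CyclicSetup c ℓ) where
  open CyclicSetup S hiding (zero)
  open Skew S
  open Galois S
  open Polynomials S
  open RingSolver L
  open import Relation.Binary.Reasoning.Setoid setoid

  monic⇒≉0 : ∀ {p d} → MonicDeg p d → ¬ (coeff p d ≈ 0#)
  monic⇒≉0 (top , _) p≈0 = 1≉0 (trans (sym top) p≈0)

  monic-0⇒unit : ∀ {p} → MonicDeg p 0 → IsUnit p
  monic-0⇒unit {p} M = monic⇒≉0 {p} M , λ i → proj₂ M (suc i) (s≤s z≤n)

  unit⇒degree-0 : ∀ {p e} → MonicDeg p e → IsUnit p → e ≡ 0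
  unit⇒degree-0 {e = zero}      M _       = ≡.refl
  unit⇒degree-0 {p} {e = suc e} M (_ , z) = ⊥-elim (monic⇒≉0 {p} M (z e))

  module _ {τ : Carrier → Carrier} (τ-hom : IsHom L L τ) where
    private module τ = IsHom τ-hom

    coeff-const-mul : ∀ {q} → (∀ i → coeff q (suc i) ≈ 0#) → ∀ p i → coeff (mulWith τ q p) i ≈ coeff q 0 * coeff p i
    coeff-const-mul {[]}    z p i       = sym (zeroˡ _)
    coeff-const-mul {a ∷ q} z p zero    = coeff-mul-zero τ a q p
    coeff-const-mul {a ∷ q} z p (suc i) = trans (coeff-mul-suc τ a q p i) (trans (+-congˡ (mul-zeroˡ τ q _ z i)) (+-identityʳ _))

    unit-cofactor : ∀ {f q p d e} → MonicDeg f d → MonicDeg p e → f ≋ mulWith τ q p → IsUnit q → d ≤ℕ e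
    unit-cofactor {f} {q} {p} {d} {e} M N eq (_ , z) with d ℕ.≤? e
    ... | yes d≤e = d≤e
    ... | no d≰e  = ⊥-elim (monic⇒≉0 {f} M (trans (eq d) (trans (coeff-const-mul {q} z p d) (trans (*-congˡ (proj₂ N d (ℕ.≰⇒> d≰e))) (zeroʳ _)))))

    coeff-linear-mul : ∀ a b p i → coeff (mulWith τ (a ∷ b ∷ []) p) (suc i) ≈ a * coeff p (suc i) + b * τ (coeff p i)
    coeff-linear-mul a b p i = trans (coeff-mul-suc τ a (b ∷ []) p i)
      (+-congˡ (trans (coeff-const-mul {b ∷ []} (λ _ → refl) (mapₗ τ p) i) (*-congˡ (coeff-map {f = τ} τ.⟨0⟩ p i))))

    -- A square-zero ε in K gives the factorisation f = (1 + ε x) ((1 - ε x) f).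
    module SquareZero {ε} (ε-fixed : τ ε ≈ ε) (ε²≈0 : ε * ε ≈ 0#) (f : Poly) where

      1+εx cofactor : Poly
      1+εx     = 1# ∷ ε ∷ []
      cofactor = mulWith τ (1# ∷ - ε ∷ []) f

      factorisation : f ≋ mulWith τ 1+εx cofactor
      factorisation zero = sym (trans (coeff-mul-zero τ 1# (ε ∷ []) cofactor) (trans (*-identityˡ _) (trans (coeff-mul-zero τ 1# (- ε ∷ []) f) (*-identityˡ _))))
      factorisation (suc i) = sym (begin
        coeff (mulWith τ 1+εx cofactor) (suc i)
          ≈⟨ coeff-linear-mul 1# ε cofactor i ⟩
        1# * coeff cofactor (suc i) + ε * τ (coeff cofactor i)
          ≈⟨ +-cong (trans (*-identityˡ _) (coeff-linear-mul 1# (- ε) f i)) (cofactor-τ i) ⟩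
        (1# * coeff f (suc i) + - ε * τ (coeff f i)) + ε * τ (coeff f i)
          ≈⟨ solve 3 (λ f e t → (:1 :* f :+ (:- e) :* t) :+ e :* t := f) refl (coeff f (suc i)) ε _ ⟩
        coeff f (suc i) ∎)
        where
        cofactor-τ : ∀ i → ε * τ (coeff cofactor i) ≈ ε * τ (coeff f i)
        cofactor-τ zero = *-congˡ (τ.⟨cong⟩ (trans (coeff-mul-zero τ 1# (- ε ∷ []) f) (*-identityˡ _)))
        cofactor-τ (suc i) = begin
          ε * τ (coeff cofactor (suc i))
            ≈⟨ *-congˡ (τ.⟨cong⟩ (coeff-linear-mul 1# (- ε) f i)) ⟩
          ε * τ (1# * coeff f (suc i) + - ε * τ (coeff f i))
            ≈⟨ *-congˡ (trans (τ.⟨+⟩ _ _) (+-cong (τ.⟨cong⟩ (*-identityˡ _)) (trans (τ.⟨*⟩ _ _) (*-congʳ (trans (τ.⟨-⟩ ε) (-‿cong ε-fixed)))))) ⟩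
          ε * (τ (coeff f (suc i)) + - ε * τ (τ (coeff f i)))
            ≈⟨ solve 3 (λ e x y → e :* (x :+ (:- e) :* y) := e :* x :- (e :* e) :* y) refl ε _ _ ⟩
          ε * τ (coeff f (suc i)) - (ε * ε) * τ (τ (coeff f i))
            ≈⟨ +-congˡ (-‿cong (trans (*-congʳ ε²≈0) (zeroˡ _))) ⟩
          ε * τ (coeff f (suc i)) - 0#
            ≈⟨ solve 1 (λ x → x :- :0 := x) refl _ ⟩
          ε * τ (coeff f (suc i)) ∎

      -- In the first case `ε` is itself a coefficient that must vanish. In the second the
      -- coefficient of degree m + 1 of the cofactor, 1 - ε τ(f m), vanishes, and multiplying it by
      -- `ε` leaves `ε`.
      ε≈0 : ∀ {m} → MonicDeg f (suc m) → IsUnit 1+εx ⊎ IsUnit cofactor → ε ≈ 0#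
      ε≈0 M (inj₁ (_ , z)) = z 0
      ε≈0 {m} (top , _) (inj₂ (_ , z)) = begin
        ε
          ≈⟨ solve 2 (λ e x → e := e :* (:1 :* :1 :+ (:- e) :* x) :+ (e :* e) :* x) refl ε (τ (coeff f m)) ⟩
        ε * (1# * 1# + - ε * τ (coeff f m)) + (ε * ε) * τ (coeff f m)
          ≈⟨ +-cong (*-congˡ (trans (+-congʳ (*-congˡ (sym top))) (trans (sym (coeff-linear-mul 1# (- ε) f m)) (z m)))) (*-congʳ ε²≈0) ⟩
        ε * 0# + 0# * τ (coeff f m)
          ≈⟨ solve 2 (λ e x → e :* :0 :+ :0 :* x := :0) refl ε _ ⟩
        0# ∎

  id-hom : IsHom L L id
  id-hom = record { ⟨cong⟩ = id ; ⟨+⟩ = λ _ _ → refl ; ⟨*⟩ = λ _ _ → refl ; ⟨1⟩ = refl }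

  module _ {F m} (irreducible : IrreducibleK F) (F-monic : MonicDeg F (suc m)) where
    private
      F∈K   = proj₁ irreducible
      split = proj₂ (proj₂ (proj₂ irreducible))

    irreducibleK⇒noProperFactor : NoProperFactor S F (suc m)
    irreducibleK⇒noProperFactor p q e p∈K q∈K M 0<e e<s eq with split q p q∈K p∈K eq
    ... | inj₁ q-unit = ℕ.<⇒≱ e<s (unit-cofactor id-hom {F} {q} {p} F-monic M eq q-unit)
    ... | inj₂ p-unit = ℕ.<⇒≢ 0<e (≡.sym (unit⇒degree-0 {p} M p-unit))

    -- Both factors of the square-zero factorisation have coefficients in K because `ε` and `F` do,
    -- so irreducibility over K applies.
    irreducibleK⇒reduced : ∀ {ε} → InK ε → ε * ε ≈ 0# → ε ≈ 0#
    irreducibleK⇒reduced {ε} ε∈K ε²≈0 = Z.ε≈0 F-monic (split Z.1+εx Z.cofactor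
        (λ { zero → σ-1 ; (suc zero) → ε∈K ; (suc (suc i)) → σ-0 }) cofactor∈K Z.factorisation)
      where
      module Z = SquareZero id-hom {ε} refl ε²≈0 F
      cofactor∈K : KPoly Z.cofactor
      cofactor∈K zero = trans (σ-cong eq) (trans (F∈K 0) (sym eq))
        where eq = trans (coeff-mul-zero id 1# (- ε ∷ []) F) (*-identityˡ _)
      cofactor∈K (suc i) = trans (σ-cong eq) (trans (σ-+ _ _) (trans (+-cong (trans (σ-* _ _) (*-cong σ-1 (F∈K (suc i))))
          (trans (σ-* _ _) (*-cong (trans (σ-neg ε) (-‿cong ε∈K)) (F∈K i)))) (sym eq)))
        where eq = coeff-linear-mul id-hom 1# (- ε) F i

    -- A vanishing constant term splits off the factor y, and irreducibility leaves only F = y.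
    irreducibleK⇒constant≉0 : ¬ (F ≋ (0# ∷ 1# ∷ [])) → ¬ (coeff F 0 ≈ 0#)
    irreducibleK⇒constant≉0 F≢y F₀≈0 = go F F∈K F-monic split F≢y F₀≈0
      where
      go : ∀ F → KPoly F → MonicDeg F (suc m) → (∀ G H → KPoly G → KPoly H → F ≋ (G ⊗ H) → IsUnit G ⊎ IsUnit H) →
           ¬ (F ≋ (0# ∷ 1# ∷ [])) → ¬ (coeff F 0 ≈ 0#)
      go [] _ M _ _ _ = monic⇒≉0 {[]} M refl
      go (a ∷ F) F∈K M split F≢y a≈0 with split (0# ∷ 1# ∷ []) F (λ { zero → σ-0 ; (suc zero) → σ-1 ; (suc (suc i)) → σ-0 }) (F∈K ∘ suc)
        (λ { zero → trans a≈0 (sym (trans (coeff-mul-zero id 0# (1# ∷ []) F) (zeroˡ _)))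
           ; (suc i) → sym (trans (coeff-linear-mul id-hom 0# 1# F i) (solve 2 (λ x y → :0 :* x :+ :1 :* y := y) refl _ _)) })
      ... | inj₁ (0≉0 , _) = 0≉0 refl
      ... | inj₂ (_ , z) = F≢y (λ { zero → a≈0 ; (suc zero) → linear m M ; (suc (suc i)) → z i })
        where
        linear : ∀ m → MonicDeg (a ∷ F) (suc m) → coeff F 0 ≈ 1#
        linear zero    (top , _) = top
        linear (suc m) N         = ⊥-elim (monic⇒≉0 {a ∷ F} N (z m))

-- The bound of an irreducible skew polynomial

-- The annihilator of M = R / R f is a two-sided ideal inside R f, so F is the minimal
-- polynomial of x ^ n on M. Since M is simple, a polynomial in x ^ n over K is zero or
-- injective on M, which rules out proper factors of F.
module Bounds {c ℓ} (S : CyclicSetup c ℓ) where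
  open CyclicSetup S hiding (zero)
  open Skew S

  module OfIrreducible
    {f F : Poly} {d′ m : ℕ} (f-monic : MonicDeg f (suc d′)) (f-irreducible : IrreducibleR f) (f₀≉0 : ¬ (coeff f 0 ≈ 0#))
    (bound : Bound f F) (F-monic : MonicDeg F (suc m)) where

    private
      d = suc d′
      s = suc m
      F∈K = proj₁ bound
      split = proj₂ (proj₂ f-irreducible)

    open Galois S
    open Polynomials S
    open Irreducibility S
    open LeastDegree S
    open Vectors L renaming (_≋_ to _≋ᵥ_)
    open Spans L
    open RingSolver L
    open Companion S f d′ f-monic
    open import Relation.Binary.Reasoning.Setoid setoid
    private
      module E = Eval x-semilinear
      module EY = Eval (linear⇒semilinear Y-linear)

    lift-multiple : InLeft f (lift F)
    lift-multiple = proj₁ (proj₂ (proj₂ bound)) (lift F)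
      (1# ∷ [] , λ i → sym (trans (coeff-const-mul σ-hom {1# ∷ []} (λ _ → refl) (lift F) i) (*-identityˡ _)))

    divideByMonic : ∀ p {g e} → MonicDeg g e → Division σ σ-cong σ-0 σ-1 (λ _ → ⊤) p g e
    divideByMonic p {g} {e} M = divide σ σ-cong σ-0 σ-1 (λ _ _ → tt) tt (λ _ → tt) (λ _ _ _ → tt) p {g} {e} M (λ _ → tt) (λ _ → tt)

    Annihilates : Poly → Set _
    Annihilates p = ∀ v → ev x p v ≋ᵥ 𝟎

    annihilates-twoSided : TwoSided Annihilates
    annihilates-twoSided =
        (λ p q p≋q h v i → trans (sym (E.ev-≋ p q p≋q i)) (h v i))
      , (λ _ _ → refl)
      , (λ p q h h′ v i → trans (E.ev-⊕ p q v i) (trans (+-cong (h v i) (h′ v i)) (+-identityʳ 0#)))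
      , (λ r p h v i → trans (E.ev-mul r p v i) (trans (E.ev-cong r (h v) i) (ev-𝟎 x-semilinear r i)))
      , (λ p r h v i → trans (E.ev-mul p r v i) (h _ i))

    kills-one⇒multiple : ∀ p → ev x p one ≋ᵥ 𝟎 → InLeft f p
    kills-one⇒multiple p h = D.quotient , λ i → trans (D.division i) (trans (coeff-⊕ (D.quotient · f) _ i) (trans (+-congˡ (rem≈0 i)) (+-identityʳ _)))
      where
      module D = Division (divideByMonic p {f} {d} f-monic)
      rem-kills : ev x D.remainder one ≋ᵥ 𝟎
      rem-kills i = begin
        ev x D.remainder one i
          ≈⟨ +-identityˡ _ ⟨
        0# + ev x D.remainder one i
          ≈⟨ +-congʳ (multiple-kills-one {D.quotient · f} {D.quotient} (λ _ → refl) i) ⟨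
        ev x (D.quotient · f) one i + ev x D.remainder one i
          ≈⟨ E.ev-⊕ (D.quotient · f) D.remainder one i ⟨
        ev x ((D.quotient · f) ⊕ D.remainder) one i
          ≈⟨ E.ev-≋ p ((D.quotient · f) ⊕ D.remainder) D.division i ⟨
        ev x p one i
          ≈⟨ h i ⟩
        0# ∎
      rem≈0 : ∀ i → coeff D.remainder i ≈ 0#
      rem≈0 i with d ℕ.≤? i
      ... | yes d≤i = D.small i d≤i
      ... | no d≰i = trans (reflexive (≡.cong (coeff D.remainder) (≡.sym (Fin.toℕ-fromℕ< (ℕ.≰⇒> d≰i)))))
        (trans (sym (ev-one D.remainder D.small (fromℕ< (ℕ.≰⇒> d≰i)))) (rem-kills _))

    -- `lift G` is a left multiple of `lift F` of degree below s n, so the quotient is zero.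
    minimal : ∀ G → (∀ v → ev Y G v ≋ᵥ 𝟎) → VanishFrom s G → ∀ i → coeff G i ≈ 0#
    minimal G h z with proj₂ (proj₂ (proj₂ bound)) Annihilates annihilates-twoSided (λ p h → kills-one⇒multiple p (h one))
                         (lift G) (λ v i → trans (ev-lift x-semilinear G v i) (h v i))
    ... | q , eq = lift-≋0 G (λ i → trans (eq i) (mul-zeroˡ σ q (lift F)
            (λ i → quotient-degree σ σ-cong σ-0 σ-1 0 {lift F} (lift-monic {F} F-monic) q
              (λ j s*n≤j → trans (sym (eq j)) (lift-vanish s G z j (ℕ.≤-trans (ℕ.≤-reflexive (≡.sym (ℕ.+-identityʳ (s ℕ.* n)))) s*n≤j))) i z≤n) i))

    F-annihilates : ∀ v → ev Y F v ≋ᵥ 𝟎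
    F-annihilates = annihilator {F} F∈K (λ i → trans (sym (ev-lift x-semilinear F one i))
      (multiple-kills-one {lift F} {proj₁ lift-multiple} (proj₂ lift-multiple) i))

    reduced : ∀ {ε} → InK ε → ε * ε ≈ 0# → ε ≈ 0#
    reduced ε∈K ε²≈0 = Z.ε≈0 f-monic (split Z.1+εx Z.cofactor Z.factorisation)
      where module Z = SquareZero σ-hom ε∈K ε²≈0 f

    -- Coordinate zero of `x w` is minus the top of `σ ∘ w` times the constant term of `f`. So the
    -- top vanishes first, and then `x` is a mere shift of conjugated coordinates.
    x-injective : ∀ {w} → x w ≋ᵥ 𝟎 → w ≋ᵥ 𝟎
    x-injective {w} h i = σ-injective (trans (zeros i) (sym σ-0))
      where
      open import Data.Fin.Relation.Unary.Top using (view; ‵fromℕ; ‵inject₁)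
      open Dedekind S using (σ-injective)
      top≈0 : top (σ ∘ w) ≈ 0#
      top≈0 = *-unit-cancel f₀≉0 (trans (solve 2 (λ t g → g :* t := :- (:0 :- t :* g)) refl (top (σ ∘ w)) _)
        (trans (-‿cong (h zero)) (solve 0 (:- :0 := :0) refl)))
      zeros : ∀ i → σ (w i) ≈ 0#
      zeros i with view i
      ... | ‵fromℕ     = top≈0
      ... | ‵inject₁ j = trans (solve 2 (λ s g → s := (s :- :0 :* g)) refl (σ (w (inject₁ j))) _)
        (trans (+-congˡ (-‿cong (*-congʳ (sym top≈0)))) (h (suc j)))

    Y-injective : ∀ {w} → Y w ≋ᵥ 𝟎 → w ≋ᵥ 𝟎
    Y-injective = go n
      where
      go : ∀ k {w} → iter k x w ≋ᵥ 𝟎 → w ≋ᵥ 𝟎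
      go zero    h = h
      go (suc k) h = go k (x-injective h)

    -- If F = y G, then injectivity of `Y` makes `G` annihilate the module in degree below s.
    constant≉0 : ¬ (coeff F 0 ≈ 0#)
    constant≉0 = go F F-monic F-annihilates
      where
      go : ∀ G → MonicDeg G s → (∀ v → ev Y G v ≋ᵥ 𝟎) → ¬ (coeff G 0 ≈ 0#)
      go []      M _ _ = monic⇒≉0 {[]} M refl
      go (a ∷ G) M h a≈0 = 1≉0 (trans (sym (proj₁ M)) (minimal G (λ v → Y-injective (λ i → begin
          Y (ev Y G v) i                    ≈⟨ EY.ev-commute (linear⇒semilinear Y-linear) (IsLinear.⟨cong⟩ Y-linear) (λ _ _ → refl) G v i ⟩
          ev Y (mapₗ id G) (Y v) i          ≈⟨ EY.ev-≋ (mapₗ id G) G (λ j → coeff-map refl G j) i ⟩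
          ev Y G (Y v) i                    ≈⟨ trans (+-congʳ (trans (*-congʳ a≈0) (zeroˡ _))) (+-identityˡ _) ⟨
          a * v i + ev Y G (Y v) i          ≈⟨ h v i ⟩
          0#                                ∎)) (λ i s≤i → proj₂ M (suc i) (s≤s s≤i)) m))

    noProperFactor : NoProperFactor S F s
    noProperFactor p q e p∈K q∈K p-monic 0<e e<s F≋qp = ¬¬-excluded-middle λ
      { (yes u≈0) → monic⇒≉0 {p} p-monic (minimal p (annihilator {p} p∈K u≈0) (λ i s≤i → proj₂ p-monic i (ℕ.<-≤-trans e<s s≤i)) e)
      ; (no u≉0) → ¬¬-least (λ a {r} → J-scale a {r}) d {f} f-monic f∈J λ (e′ , e′≤d , L) → simple u≉0 e′ e′≤d L }
      where
      u : V d
      u = ev Y p one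

      -- The preimage in R of the submodule generated by `u`. It is a left ideal containing `f`, so
      -- its least member divides `f` on the right.
      J : Poly → Set _
      J r = ∃ λ t → ev x r one ≋ᵥ ev x t u

      J-scale : ∀ a {r} → J r → J (mapₗ (a *_) r)
      J-scale a {r} (t , h) = mapₗ (a *_) t , λ i → trans (E.ev-scale a r one i) (trans (*-congˡ (h i)) (sym (E.ev-scale a t u i)))

      f∈J : J f
      f∈J = [] , g-kills-one

      qu≈0 : ev Y q u ≋ᵥ 𝟎
      qu≈0 i = trans (sym (EY.ev-mul q p one i)) (trans (sym (EY.ev-≋ F (q ⊗ p) F≋qp i)) (F-annihilates one i))

      -- The other factor `p` has degree at least 1, which leaves degree below s for `q`.
      q-small : VanishFrom s q
      q-small = quotient-degree id id refl refl s {p} p-monic q (λ i e+s≤i → trans (sym (F≋qp i))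
        (proj₂ F-monic i (ℕ.≤-trans (ℕ.+-monoˡ-≤ s 0<e) e+s≤i)))

      -- If `u` generates the module, then `q`, which kills `u`, annihilates all of it.
      generated : (∃ λ t → one ≋ᵥ ev x t u) → ⊥
      generated (t , one≋) = monic⇒≉0 {F} F-monic (trans (F≋qp s) (mul-zeroˡ id q p (minimal q (annihilator {q} q∈K (λ i → begin
          ev Y q one i             ≈⟨ EY.ev-cong q one≋ i ⟩
          ev Y q (ev x t u) i      ≈⟨ central {q} q∈K t u i ⟩
          ev x t (ev Y q u) i      ≈⟨ trans (E.ev-cong t qu≈0 i) (ev-𝟎 x-semilinear t i) ⟩
          0#                       ∎)) q-small) s))

      simple : ¬ (u ≋ᵥ 𝟎) → ∀ e′ → e′ ≤ℕ d → ¬ Least J e′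
      simple u≉0 e′ e′≤d L = least D.remainder rem∈J D.small λ rem≈0 →
          cases (split D.quotient poly (λ i → trans (D.division i) (trans (coeff-⊕ (D.quotient · poly) _ i) (trans (+-congˡ (rem≈0 i)) (+-identityʳ _)))))
        where
        open Least L
        module D = Division (divideByMonic f {poly} {e′} monic)
        t = proj₁ member
        rem∈J : J D.remainder
        rem∈J = mapₗ (- 1# *_) (D.quotient · t) , λ i → begin
          ev x D.remainder one i
            ≈⟨ solve 2 (λ r q → r := (q :+ r) :+ (:- :1) :* q) refl _ (ev x (D.quotient · poly) one i) ⟩
          (ev x (D.quotient · poly) one i + ev x D.remainder one i) + - 1# * ev x (D.quotient · poly) one i
            ≈⟨ +-congʳ (trans (sym (E.ev-⊕ (D.quotient · poly) D.remainder one i))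
                 (trans (sym (E.ev-≋ f ((D.quotient · poly) ⊕ D.remainder) D.division i)) (g-kills-one i))) ⟩
          0# + - 1# * ev x (D.quotient · poly) one i
            ≈⟨ trans (+-identityˡ _) (*-congˡ (trans (E.ev-mul D.quotient poly one i)
                 (trans (E.ev-cong D.quotient (proj₂ member) i) (sym (E.ev-mul D.quotient t u i))))) ⟩
          - 1# * ev x (D.quotient · t) u i
            ≈⟨ E.ev-scale (- 1#) (D.quotient · t) u i ⟨
          ev x (mapₗ (- 1# *_) (D.quotient · t)) u i ∎
        cases : IsUnit D.quotient ⊎ IsUnit poly → ⊥
        cases (inj₂ poly-unit) = generated (t , λ i → trans (sym (trans (E.ev-≋ poly (1# ∷ []) constant i)
            (trans (+-identityʳ _) (*-identityˡ _)))) (proj₂ member i))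
          where
          constant : poly ≋ (1# ∷ [])
          constant zero    = trans (reflexive (≡.cong (coeff poly) (≡.sym (unit⇒degree-0 {poly} monic poly-unit)))) (proj₁ monic)
          constant (suc i) = proj₂ poly-unit i
        -- A unit quotient forces the least degree up to d. Then `u`, represented in degree below d,
        -- is a smaller member of `J` and cannot be nonzero.
        cases (inj₁ quotient-unit) = least (fromV u) ((1# ∷ []) , λ i → trans (ev-fromV u i) (sym (trans (+-identityʳ _) (*-identityˡ _))))
          (λ i e′≤i → fromV-small u i (ℕ.≤-trans d≤e′ e′≤i))
          (λ u≈0 → u≉0 (λ i → trans (reflexive (≡.sym (coeff-fromV u i))) (u≈0 (toℕ i))))
          where
          d≤e′ : d ≤ℕ e′
          d≤e′ = ℕ.≮⇒≥ (λ e′<d → least D.remainder rem∈J D.small (λ rem≈0 → ℕ.<⇒≱ e′<d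
            (unit-cofactor σ-hom {f} {D.quotient} {poly} f-monic monic
              (λ i → trans (D.division i) (trans (coeff-⊕ (D.quotient · poly) _ i) (trans (+-congˡ (rem≈0 i)) (+-identityʳ _)))) quotient-unit)))

mainTheorem2 : ∀ {c ℓ : Level} (S : CyclicSetup c ℓ) →
    let open CyclicSetup S
        open Skew S
    in
    (∀ (f F : Poly) (d s m l : ℕ) →
      MonicDeg f d → IrreducibleR f → ¬ (coeff f 0 ≈ 0#) →
      Bound f F → MonicDeg F s →
      FactorsInto F m → m *ℕ l ≡ n →
      d ≡ s *ℕ l →
      Norm (coeff f 0) ≈ pow -1# (s *ℕ l *ℕ (n ∸ 1)) * pow (coeff F 0) l)
    ×
    (∀ (F g : Poly) (s m l h d : ℕ) →
      IrreducibleK F → MonicDeg F s → ¬ (F ≋ (0# ∷ 1# ∷ [])) →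
      FactorsInto F m → m *ℕ l ≡ n →
      MonicDeg g d → (∃ λ q → lift F ≋ (q · g)) →
      1 ≤ℕ h → h ≤ℕ m → d ≡ s *ℕ h *ℕ l →
      Norm (coeff g 0) ≈ pow -1# (s *ℕ h *ℕ l *ℕ (n ∸ 1)) * pow (coeff F 0) (h *ℕ l))
mainTheorem2 S = partA , partB
  where
  open CyclicSetup S hiding (zero)
  open Skew S
  open Irreducibility S

  partA : ∀ f F d s m l → MonicDeg f d → IrreducibleR f → ¬ (coeff f 0 ≈ 0#) → Bound f F → MonicDeg F s →
          FactorsInto F m → m *ℕ l ≡ n → d ≡ s *ℕ l →
          Norm (coeff f 0) ≈ pow -1# (s *ℕ l *ℕ (n ∸ 1)) * pow (coeff F 0) l
  -- A monic polynomial of degree zero is a unit.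
  partA f F zero s m l f-monic f-irreducible _ _ _ _ _ _ = ⊥-elim (proj₁ (proj₂ f-irreducible) (monic-0⇒unit {f} f-monic))
  partA f F (suc d′) (suc m) _ l f-monic f-irreducible f₀≉0 bound F-monic _ _ d≡sl =
    ≡.subst (λ d → Norm (coeff f 0) ≈ pow -1# (d *ℕ (n ∸ 1)) * pow (coeff F 0) l) d≡sl
      (CharacteristicIdentity.norm-formula S {F} {f} {proj₁ lift-multiple} {m} {l} {d′} (proj₁ bound) F-monic noProperFactor
        constant≉0 reduced f-monic (proj₂ lift-multiple) d≡sl)
    where open Bounds.OfIrreducible S {f} {F} f-monic f-irreducible f₀≉0 bound F-monic

  partB : ∀ F g s m l h d → IrreducibleK F → MonicDeg F s → ¬ (F ≋ (0# ∷ 1# ∷ [])) → FactorsInto F m → m *ℕ l ≡ n →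
          MonicDeg g d → (∃ λ q → lift F ≋ (q · g)) → 1 ≤ℕ h → h ≤ℕ m → d ≡ s *ℕ h *ℕ l →
          Norm (coeff g 0) ≈ pow -1# (s *ℕ h *ℕ l *ℕ (n ∸ 1)) * pow (coeff F 0) (h *ℕ l)
  partB F g zero m l h d F-irreducible F-monic = ⊥-elim (proj₁ (proj₂ (proj₂ F-irreducible)) (monic-0⇒unit {F} F-monic))
  -- A vanishing `l` would make n zero.
  partB F g (suc s′) m zero h d _ _ _ _ ml≡n = ⊥-elim (ℕ.<⇒≱ 2≤n (ℕ.≤-trans (ℕ.≤-reflexive (≡.trans (≡.sym ml≡n) (ℕ.*-zeroʳ m))) z≤n))
  partB F g (suc s′) m (suc l) (suc h) zero _ _ _ _ _ _ _ _ _ ()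
  partB F g (suc s′) m l@(suc _) h@(suc _) (suc d′) F-irreducible F-monic F≢y _ _ g-monic (q , lift≋) _ _ d≡shl =
    -- The number of blocks k is `h *ℕ l` here, so the degree of `g` has to be rebracketed.
    ≡.subst (λ d → Norm (coeff g 0) ≈ pow -1# (d *ℕ (n ∸ 1)) * pow (coeff F 0) (h *ℕ l)) d≡shl
      (CharacteristicIdentity.norm-formula S {F} {g} {q} {s′} {h *ℕ l} {d′} (proj₁ F-irreducible) F-monic
        (irreducibleK⇒noProperFactor {F} F-irreducible F-monic) (irreducibleK⇒constant≉0 {F} F-irreducible F-monic F≢y)
        (irreducibleK⇒reduced {F} F-irreducible F-monic) g-monic lift≋ (≡.trans d≡shl (ℕ.*-assoc (suc s′) h l)))
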